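{- Let $k\ge2$, $m\ge3$ and $0<\alpha<1$. Among all $k$-uniform hypertrees with $m$ hyperedges, the second last hypertree in $S_\alpha$-order is the starlike hypertree $S^{(k)}_{1,2,1,\dots,1}$ (with $m$ hyperedges in total, i.e. $m-3$ trailing $1$'s).
   Context: Hypergraphs are finite; $k$-uniform means every hyperedge has exactly $k$ vertices; a hypertree is a connected hypergraph without cycles. The hyperpath of length $r$ is obtained from the path graph with $r$ edges by inserting $k-2$ new vertices (of degree one) into each edge. The starlike hypertree $S^{(k)}_{n_1,\dots,n_p}$ ($p\ge1$, $n_i\ge1$) is obtained from $p$ hyperpaths of lengths $n_1,\dots,n_p$ by identifying one end vertex of each into a single common vertex; when all $n_i=1$ it is the hyperstar $S_p^{(k)}$. For a $k$-uniform hypergraph $\mathcal{H}$ on $[n]$, $\mathcal{A}(\mathcal{H})$ is the $k$-order $n$-dimensional tensor with entry $\frac1{(k-1)!}$ at $(i_1,\dots,i_k)$ if $\{i_1,\dots,i_k\}\in E(\mathcal{H})$ and $0$ otherwise; $\mathcal{D}(\mathcal{H})$ is the diagonal tensor of vertex degrees; $\mathcal{A}_\alpha(\mathcal{H})=\alpha\mathcal{D}(\mathcal{H})+(1-\alpha)\mathcal{A}(\mathcal{H})$. For a tensor $\mathcal{T}$, $\mathrm{Tr}_d(\mathcal{T})$ is the sum of the $d$-th powers of all $n(k-1)^{n-1}$ eigenvalues of $\mathcal{T}$ (roots of its characteristic polynomial, with multiplicity); in particular $\mathrm{Tr}_0(\mathcal{T})=n(k-1)^{n-1}$, and for $d\ge1$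 $$\mathrm{Tr}_{d}(\mathcal{T})=(k-1)^{n-1}\sum_{d_1+\cdots+d_n=d}\ \prod_{i=1}^{n}\frac{1}{(d_i(k-1))!}\Big(\sum_{\gamma\in[n]^{k-1}}(\mathcal{T})_{i\gamma}\frac{\partial}{\partial a_{i\gamma}}\Big)^{d_i}\mathrm{tr}\big(A^{d(k-1)}\big),$$ with $A=(a_{ij})$ an $n\times n$ matrix of indeterminates, $d_i\ge0$ integers, $\frac{\partial}{\partial a_{i\gamma}}=\frac{\partial}{\partial a_{i i_2}}\cdots\frac{\partial}{\partial a_{i i_k}}$ for $\gamma=i_2\cdots i_k$. $S_\alpha$-order: for $k$-uniform hypergraphs $\mathcal{H}_1,\mathcal{H}_2$ with $n$ vertices, $\mathcal{H}_1\prec_\alpha\mathcal{H}_2$ if there is $d\in\{1,\dots,n(k-1)^{n-1}-1\}$ with $\mathrm{Tr}_t(\mathcal{A}_\alpha(\mathcal{H}_1))=\mathrm{Tr}_t(\mathcal{A}_\alpha(\mathcal{H}_2))$ for $t=0,\dots,d-1$ and $\mathrm{Tr}_d(\mathcal{A}_\alpha(\mathcal{H}_1))<\mathrm{Tr}_d(\mathcal{A}_\alpha(\mathcal{H}_2))$. "$L$ is the last in a class" means $L$ is in the class and $\mathcal{H}\prec_\alpha L$ for every $\mathcal{H}$ in the class not isomorphic to $L$; "$X$ is the second last" means that the class has a last member $L$, $X$ is in the class and not isomorphic to $L$, and $\mathcal{H}\prec_\alpha X$ for every $\mathcal{H}$ in the class isomorphic to neither $X$ nor $L$. (Here the last hypertree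 is the hyperstar $S_m^{(k)}$.) -}

module Defs where

open import Level using (Level; _⊔_) renaming (suc to lsuc)
open import Algebra.Bundles using (CommutativeRing)
open import Algebra.Apartness.Bundles using (HeytingField)
open import Algebra.Apartness.Structures using (IsHeytingField)
import Algebra.Apartness.Properties.HeytingCommutativeRing as HeytingProperties
import Algebra.Properties.Ring as RingProperties
import Data.Bool.Properties as Bool
open import Data.Bool.Base using (if_then_else_)
open import Data.Empty using (⊥-elim)
open import Data.Fin.Base using (Fin; zero; suc; inject₁; fromℕ; splitAt; join)
open import Data.Fin.Permutation using (Permutation; _⟨$⟩ʳ_)
open import Data.Fin.Properties using (any?; join-splitAt) renaming (_≟_ to _≟ᶠ_)
open import Data.Fin.Subset
  using (Subset; inside; outside; ⊤; ⊥; ⋃; ⁅_⁆; _∈_; ∣_∣)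
open import Data.Fin.Subset.Properties using (_∈?_)
open import Data.List.Base as List
  using (List; []; _∷_; allFin; upTo; concatMap; filter; foldr; length)
open import Data.Nat.Base as ℕ
  using (ℕ; zero; suc; _∸_; _^_; _≤_; _!; NonZero)
open import Data.Nat.Properties using (_!≢0)
open import Data.Product.Base using (∃-syntax; _×_; _,_; proj₁)
open import Data.Product.Properties using () renaming (≡-dec to ×-≡-dec)
open import Data.Sum.Base using (_⊎_; inj₁; inj₂; [_,_])
open import Data.Vec.Base as Vec using (Vec; []; _∷_; _++_; lookup; tail; toList)
open import Data.Vec.Properties
  using (∷-injectiveˡ; ∷-injectiveʳ; ++-injectiveˡ; ++-injectiveʳ)
  renaming (≡-dec to Vec-≡-dec)
import Data.Vec.Functional as F
open import Data.Vec.Relation.Unary.All using (all?)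
open import Function.Base using (_∘_)
open import Function.Bundles using (_⇔_)
open import Function.Definitions using (Injective)
open import Relation.Binary.Construct.Closure.ReflexiveTransitive using (Star)
open import Relation.Binary.Core using (Rel)
open import Relation.Binary.Definitions using (DecidableEquality)
open import Relation.Binary.PropositionalEquality
  using (_≡_; _≢_; refl; sym; trans; cong; cong₂)
open import Relation.Binary.Structures using (IsStrictPartialOrder)
open import Relation.Nullary.Decidable using (Dec; does)
open import Relation.Nullary.Negation using (¬_)

record Hypergraph : Set where
  field
    order    : ℕ
    size     : ℕ
    edge     : Fin size → Subset order
    distinct : Injective _≡_ _≡_ edge

open Hypergraph public

Uniform : ℕ → Hypergraph → Set
Uniform k H = ∀ j → ∣ edge H j ∣ ≡ k

Adjacent : (H : Hypergraph) → Rel (Fin (order H)) _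
Adjacent H u v = ∃[ j ] (u ∈ edge H j × v ∈ edge H j)

Connected : Hypergraph → Set
Connected H = ∀ u v → Star (Adjacent H) u v

-- v₀ e₀ v₁ e₁ … e_{q-1} v_q with v₀ = v_q, and otherwise distinct vertices
-- and distinct edges.
record Cycle (H : Hypergraph) (q : ℕ) : Set where
  field
    vertex    : Fin (suc q) → Fin (order H)
    link      : Fin q → Fin (size H)
    closed    : vertex zero ≡ vertex (fromℕ q)
    distinctᵛ : Injective _≡_ _≡_ (vertex ∘ suc)
    distinctᵉ : Injective _≡_ _≡_ link
    source    : ∀ i → vertex (inject₁ i) ∈ edge H (link i)
    target    : ∀ i → vertex (suc i) ∈ edge H (link i)

-- A closed walk of length 1 (a vertex in an edge) is not a cycle; length 2
-- (two edges sharing two vertices) is.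
Acyclic : Hypergraph → Set
Acyclic H = ∀ q → 2 ≤ q → ¬ Cycle H q

Hypertree : Hypergraph → Set
Hypertree H = Connected H × Acyclic H

UniformHypertree : (k m : ℕ) → Hypergraph → Set
UniformHypertree k m H = Uniform k H × Hypertree H × size H ≡ m

record _≅_ (H G : Hypergraph) : Set where
  field
    vertices  : Permutation (order H) (order G)
    edges     : Permutation (size H) (size G)
    incidence : ∀ v j →
      v ∈ edge H j ⇔ (vertices ⟨$⟩ʳ v) ∈ edge G (edges ⟨$⟩ʳ j)

degree : (H : Hypergraph) → Fin (order H) → ℕ
degree H v = length (filter (λ j → v ∈? edge H j) (allFin (size H)))

IsEdge : (H : Hypergraph) → Subset (order H) → Set
IsEdge H S = ∃[ j ] edge H j ≡ S

isEdge? : ∀ H S → Dec (IsEdge H S)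
isEdge? H S = any? (λ j → Vec-≡-dec Bool._≟_ (edge H j) S)

-- A hypergraph whose vertex zero is a root.  The condition `proper` says that
-- no edge is contained in {root}; it keeps the edges distinct when two roots
-- are identified.
record Rooted : Set where
  field
    others   : ℕ
    sizeʳ    : ℕ
    edgeʳ    : Fin sizeʳ → Subset (suc others)
    distinctʳ : Injective _≡_ _≡_ edgeʳ
    proper   : ∀ j → tail (edgeʳ j) ≢ ⊥

open Rooted

forget : Rooted → Hypergraph
forget G = record
  { order = suc (others G) ; size = sizeʳ G
  ; edge = edgeʳ G ; distinct = distinctʳ G }

single : Rooted
single = record
  { others = 0 ; sizeʳ = 0 ; edgeʳ = λ () ; distinctʳ = λ { {()} } ; proper = λ () }

private
  ∷-tail : ∀ {n b} {S : Subset (suc n)} → tail S ≢ ⊥ → S ≢ b ∷ ⊥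
  ∷-tail t refl = t refl

-- One more edge at the root: a new root, then c new inserted vertices, then
-- the old root followed by the old vertices.
extend : ℕ → Rooted → Rooted
extend c G = record
  { others    = c ℕ.+ suc (others G)
  ; sizeʳ     = suc (sizeʳ G)
  ; edgeʳ     = new F.∷ (old ∘ edgeʳ G)
  ; distinctʳ = λ {i} {j} → inj i j
  ; proper    = prp
  }
  where
  new : Subset (suc (c ℕ.+ suc (others G)))
  new = inside ∷ (⊤ {c} ++ inside ∷ ⊥)

  old : Subset (suc (others G)) → Subset (suc (c ℕ.+ suc (others G)))
  old S = outside ∷ (⊥ {c} ++ S)

  ⊥-++ : ∀ c {n} → ⊥ {c ℕ.+ n} ≡ ⊥ {c} ++ ⊥ {n}
  ⊥-++ zero    = refl
  ⊥-++ (suc c) = cong (outside ∷_) (⊥-++ c)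

  inj : ∀ i j → (new F.∷ (old ∘ edgeʳ G)) i ≡ (new F.∷ (old ∘ edgeʳ G)) j → i ≡ j
  inj zero    zero    _  = refl
  inj zero    (suc j) eq with () ← ∷-injectiveˡ eq
  inj (suc i) zero    eq with () ← ∷-injectiveˡ eq
  inj (suc i) (suc j) eq =
    cong suc (distinctʳ G (++-injectiveʳ (⊥ {c}) ⊥ (∷-injectiveʳ eq)))

  prp : ∀ j → tail ((new F.∷ (old ∘ edgeʳ G)) j) ≢ ⊥
  prp zero    eq with () ← ++-injectiveʳ (⊤ {c}) ⊥ (trans eq (⊥-++ c))
  prp (suc j) eq =
    ∷-tail (proper G j) (++-injectiveʳ (⊥ {c}) ⊥ (trans eq (⊥-++ c)))

-- The k-uniform hyperpath of length r (k ≥ 2), rooted at an end vertex.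
hyperpath : (k r : ℕ) → Rooted
hyperpath k zero    = single
hyperpath k (suc r) = extend (k ∸ 2) (hyperpath k r)

-- Disjoint union with the two roots identified.
coalesce : Rooted → Rooted → Rooted
coalesce G H = record
  { others    = a ℕ.+ b
  ; sizeʳ     = sizeʳ G ℕ.+ sizeʳ H
  ; edgeʳ     = (left ∘ edgeʳ G) F.++ (right ∘ edgeʳ H)
  ; distinctʳ = λ {i} {j} eq →
      trans (sym (join-splitAt (sizeʳ G) (sizeʳ H) i))
        (trans (cong (join (sizeʳ G) (sizeʳ H)) (inj (splitAt _ i) (splitAt _ j) eq))
          (join-splitAt (sizeʳ G) (sizeʳ H) j))
  ; proper    = λ j → prp (splitAt _ j)
  }
  where
  a b : ℕ
  a = others G
  b = others H

  left : Subset (suc a) → Subset (suc (a ℕ.+ b))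
  left (x ∷ S) = x ∷ (S ++ ⊥)

  right : Subset (suc b) → Subset (suc (a ℕ.+ b))
  right (x ∷ S) = x ∷ (⊥ {a} ++ S)

  both : Fin (sizeʳ G) ⊎ Fin (sizeʳ H) → Subset (suc (a ℕ.+ b))
  both = [ left ∘ edgeʳ G , right ∘ edgeʳ H ]

  ⊥-++ : ∀ a → ⊥ {a ℕ.+ b} ≡ ⊥ {a} ++ ⊥ {b}
  ⊥-++ zero    = refl
  ⊥-++ (suc a) = cong (outside ∷_) (⊥-++ a)

  left-inj : ∀ S T → left S ≡ left T → S ≡ T
  left-inj (x ∷ S) (y ∷ T) eq =
    cong₂ _∷_ (∷-injectiveˡ eq) (++-injectiveˡ S T (∷-injectiveʳ eq))

  right-inj : ∀ S T → right S ≡ right T → S ≡ T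
  right-inj (x ∷ S) (y ∷ T) eq =
    cong₂ _∷_ (∷-injectiveˡ eq) (++-injectiveʳ (⊥ {a}) ⊥ (∷-injectiveʳ eq))

  left≢right : ∀ S T → tail S ≢ ⊥ → left S ≢ right T
  left≢right (x ∷ S) (y ∷ T) S≢⊥ eq = S≢⊥ (++-injectiveˡ S ⊥ (∷-injectiveʳ eq))

  left-proper : ∀ S → tail S ≢ ⊥ → tail (left S) ≢ ⊥
  left-proper (x ∷ S) S≢⊥ eq = S≢⊥ (++-injectiveˡ S ⊥ (trans eq (⊥-++ a)))

  right-proper : ∀ S → tail S ≢ ⊥ → tail (right S) ≢ ⊥
  right-proper (x ∷ S) S≢⊥ eq = S≢⊥ (++-injectiveʳ (⊥ {a}) ⊥ (trans eq (⊥-++ a)))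

  inj : ∀ x y → both x ≡ both y → x ≡ y
  inj (inj₁ i) (inj₁ j) eq = cong inj₁ (distinctʳ G (left-inj (edgeʳ G i) (edgeʳ G j) eq))
  inj (inj₂ i) (inj₂ j) eq = cong inj₂ (distinctʳ H (right-inj (edgeʳ H i) (edgeʳ H j) eq))
  inj (inj₁ i) (inj₂ j) eq =
    ⊥-elim (left≢right (edgeʳ G i) (edgeʳ H j) (proper G i) eq)
  inj (inj₂ i) (inj₁ j) eq =
    ⊥-elim (left≢right (edgeʳ G j) (edgeʳ H i) (proper G j) (sym eq))

  prp : ∀ x → tail (both x) ≢ ⊥
  prp (inj₁ i) = left-proper (edgeʳ G i) (proper G i)
  prp (inj₂ j) = right-proper (edgeʳ H j) (proper H j)

starlike : (k : ℕ) → List ℕ → Hypergraph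
starlike k ns = forget (foldr (λ n G → coalesce (hyperpath k n) G) single ns)

module _ {ℓ₁ ℓ₂ : Level} (_≺_ : Rel Hypergraph ℓ₁) (C : Hypergraph → Set ℓ₂) where

  IsLast : Hypergraph → Set (ℓ₁ ⊔ ℓ₂)
  IsLast L = C L × (∀ H → C H → ¬ (H ≅ L) → H ≺ L)

  IsSecondLast : Hypergraph → Set (ℓ₁ ⊔ ℓ₂)
  IsSecondLast X =
    ∃[ L ] (IsLast L × C X × ¬ (X ≅ L) ×
            (∀ H → C H → ¬ (H ≅ X) → ¬ (H ≅ L) → H ≺ X))

record OrderedField c ℓ₁ ℓ₂ : Set (lsuc (c ⊔ ℓ₁ ⊔ ℓ₂)) where
  infix  8 -_
  infixl 7 _*_
  infixl 6 _+_
  infix  4 _≈_ _<_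
  field
    Carrier : Set c
    _≈_     : Rel Carrier ℓ₁
    _<_     : Rel Carrier ℓ₂
    _+_     : Carrier → Carrier → Carrier
    _*_     : Carrier → Carrier → Carrier
    -_      : Carrier → Carrier
    0#      : Carrier
    1#      : Carrier
    isHeytingField :
      IsHeytingField _≈_ (λ x y → x < y ⊎ y < x) _+_ _*_ -_ 0# 1#
    isStrictPartialOrder : IsStrictPartialOrder _≈_ _<_
    +-monoˡ-< : ∀ z {x y} → x < y → x + z < y + z
    *-pos     : ∀ {x y} → 0# < x → 0# < y → 0# < x * y

  open IsHeytingField isHeytingField public

  module <-Order = IsStrictPartialOrder isStrictPartialOrder

  commutativeRing : CommutativeRing c ℓ₁
  commutativeRing = record { isCommutativeRing = isCommutativeRing }

  heytingField : HeytingField c ℓ₁ ℓ₂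
  heytingField = record { isHeytingField = isHeytingField }

  fromℕ# : ℕ → Carrier
  fromℕ# zero    = 0#
  fromℕ# (suc n) = 1# + fromℕ# n

module OrderedFieldProperties {c ℓ₁ ℓ₂ : Level} (R : OrderedField c ℓ₁ ℓ₂) where
  open OrderedField R
  open HeytingProperties (HeytingField.heytingCommutativeRing heytingField) using (1#0)
  open RingProperties (CommutativeRing.ring commutativeRing)
    using (-‿distribˡ-*; -‿involutive)
  private module E = CommutativeRing commutativeRing

  0<1 : 0# < 1#
  0<1 with 1#0
  ... | inj₂ p = p
  ... | inj₁ 1<0 = <-Order.<-respʳ-≈ square (*-pos 0<-1 0<-1)
    where
    0<-1 : 0# < - 1#
    0<-1 = <-Order.<-respˡ-≈ (E.-‿inverseʳ 1#)
             (<-Order.<-respʳ-≈ (E.+-identityˡ (- 1#)) (+-monoˡ-< (- 1#) 1<0))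

    square : - 1# * - 1# ≈ 1#
    square = E.trans (E.sym (-‿distribˡ-* 1# (- 1#)))
               (E.trans (E.-‿cong (E.*-identityˡ (- 1#))) (-‿involutive 1#))

  fromℕ#-suc-pos : ∀ n → 0# < fromℕ# (suc n)
  fromℕ#-suc-pos zero = <-Order.<-respʳ-≈ (E.sym (E.+-identityʳ 1#)) 0<1
  fromℕ#-suc-pos (suc n) = <-Order.trans (fromℕ#-suc-pos n)
    (<-Order.<-respˡ-≈ (E.+-identityˡ (fromℕ# (suc n))) (+-monoˡ-< (fromℕ# (suc n)) 0<1))

  fromℕ#-pos : ∀ n .{{_ : NonZero n}} → 0# < fromℕ# n
  fromℕ#-pos (suc n) = fromℕ#-suc-pos n

  -- The library phrases invertibility of x as that of x - 0#.
  recip : ∀ x → 0# < x → Carrier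
  recip x 0<x = proj₁ (#⇒invertible (inj₂ 0<x))

  1/_! : ℕ → Carrier
  1/ n ! = recip (fromℕ# (n !)) (fromℕ#-pos (n !) {{n !≢0}})

-- The reals as a complete Archimedean ordered field.  The axioms hold both for
-- classical and for constructive reals; with excluded middle they characterise
-- ℝ up to isomorphism.
record Reals c ℓ₁ ℓ₂ : Set (lsuc (c ⊔ ℓ₁ ⊔ ℓ₂)) where
  field
    orderedField : OrderedField c ℓ₁ ℓ₂

  open OrderedField orderedField public

  IsCauchy : (ℕ → Carrier) → Set _
  IsCauchy f = ∀ ε → 0# < ε → ∃[ N ] (∀ i j → N ≤ i → N ≤ j → f i - f j < ε)

  Converges : (ℕ → Carrier) → Carrier → Set _
  Converges f l =
    ∀ ε → 0# < ε → ∃[ N ] (∀ i → N ≤ i → (f i - l < ε) × (l - f i < ε))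

  field
    archimedean : ∀ x → ∃[ n ] x < fromℕ# n
    complete    : ∀ f → IsCauchy f → ∃[ l ] Converges f l

-- A polynomial is a formal sum of terms, a term being a coefficient together
-- with a monomial, and a monomial a list of indeterminates (order irrelevant).
-- The representation is not unique; only `constantTerm` is read off from it.
module Polynomials {c ℓ₁ ℓ₂ : Level} (R : OrderedField c ℓ₁ ℓ₂)
                   {X : Set} (_≟_ : DecidableEquality X) where
  open OrderedField R using (Carrier; _+_; _*_; 0#; 1#)

  Monomial : Set
  Monomial = List X

  Poly : Set c
  Poly = List (Carrier × Monomial)

  0ᴾ 1ᴾ : Poly
  0ᴾ = []
  1ᴾ = (1# , []) ∷ []

  var : X → Poly
  var x = (1# , x ∷ []) ∷ []

  _+ᴾ_ _*ᴾ_ : Poly → Poly → Poly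
  p +ᴾ q = p List.++ q
  p *ᴾ q = concatMap (λ (a , u) → List.map (λ (b , w) → a * b , u List.++ w) q) p

  scale : Carrier → Poly → Poly
  scale a = List.map (λ (b , w) → a * b , w)

  ∑ : ∀ {A : Set} → List A → (A → Poly) → Poly
  ∑ xs f = foldr (λ x p → f x +ᴾ p) 0ᴾ xs

  -- Leibniz rule: one summand for each occurrence of x.
  ∂ᴹ : X → Monomial → List Monomial
  ∂ᴹ x []      = []
  ∂ᴹ x (y ∷ w) =
    (if does (x ≟ y) then w ∷ [] else []) List.++ List.map (y ∷_) (∂ᴹ x w)

  ∂ : X → Poly → Poly
  ∂ x = concatMap (λ (a , w) → List.map (a ,_) (∂ᴹ x w))

  constantTerm : Poly → Carrier
  constantTerm []                = 0#
  constantTerm ((a , [])    ∷ p) = a + constantTerm p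
  constantTerm ((_ , _ ∷ _) ∷ p) = constantTerm p

vectors : ∀ {A : Set} → List A → ∀ r → List (Vec A r)
vectors xs zero    = [] ∷ []
vectors xs (suc r) = concatMap (λ x → List.map (x ∷_) (vectors xs r)) xs

compositions : ∀ n → ℕ → List (Vec ℕ n)
compositions zero    zero    = [] ∷ []
compositions zero    (suc d) = []
compositions (suc n) d =
  concatMap (λ a → List.map (a ∷_) (compositions n (d ∸ a))) (upTo (suc d))

module Spectral {c ℓ₁ ℓ₂ : Level} (R : OrderedField c ℓ₁ ℓ₂) where
  open OrderedField R
  open OrderedFieldProperties R using (1/_!)

  -- Tensors of order k and dimension n; the entry at (i, i₂, …, i_k) is
  -- T i (i₂ ∷ … ∷ i_k ∷ []).
  Tensor : (k n : ℕ) → Set c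
  Tensor k n = Fin n → Vec (Fin n) (k ∸ 1) → Carrier

  adjacencyTensor : (k : ℕ) (H : Hypergraph) → Tensor k (order H)
  adjacencyTensor k H i γ =
    if does (isEdge? H (⋃ (List.map ⁅_⁆ (i ∷ toList γ)))) then 1/ (k ∸ 1) ! else 0#

  degreeTensor : (k : ℕ) (H : Hypergraph) → Tensor k (order H)
  degreeTensor k H i γ =
    if does (all? (i ≟ᶠ_) γ) then fromℕ# (degree H i) else 0#

  A⟨_⟩ : Carrier → (k : ℕ) (H : Hypergraph) → Tensor k (order H)
  A⟨ α ⟩ k H i γ =
    α * degreeTensor k H i γ + (1# - α) * adjacencyTensor k H i γ

  module _ {k n : ℕ} (T : Tensor k n) where
    open Polynomials R (×-≡-dec (_≟ᶠ_ {n}) (_≟ᶠ_ {n}))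

    matrixPower : ℕ → Fin n → Fin n → Poly
    matrixPower zero    i j = if does (i ≟ᶠ j) then 1ᴾ else 0ᴾ
    matrixPower (suc N) i j = ∑ (allFin n) (λ l → var (i , l) *ᴾ matrixPower N l j)

    tracePower : ℕ → Poly
    tracePower N = ∑ (allFin n) (λ i → matrixPower N i i)

    ∂ⱽ : ∀ {r} → Fin n → Vec (Fin n) r → Poly → Poly
    ∂ⱽ i γ p = Vec.foldr _ (λ j → ∂ (i , j)) p γ

    rowOperator : Fin n → Poly → Poly
    rowOperator i p =
      ∑ (vectors (allFin n) (k ∸ 1)) (λ γ → scale (T i γ) (∂ⱽ i γ p))

    iterate : ℕ → (Poly → Poly) → Poly → Poly
    iterate zero    f p = p
    iterate (suc e) f p = f (iterate e f p)

    compositionOperator : Vec ℕ n → Poly → Poly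
    compositionOperator ds p =
      foldr (λ i q → scale (1/ (lookup ds i ℕ.* (k ∸ 1)) !)
                           (iterate (lookup ds i) (rowOperator i) q))
            p (allFin n)

    -- The sum of the d-th powers of the eigenvalues, through the
    -- Morozov–Shakirov formula.  All derivatives together have the degree
    -- d(k-1) of tr(A^(d(k-1))), so the resulting polynomial is constant.
    Tr : ℕ → Carrier
    Tr zero      = fromℕ# (n ℕ.* (k ∸ 1) ^ (n ∸ 1))
    Tr d@(suc _) = fromℕ# ((k ∸ 1) ^ (n ∸ 1)) *
      constantTerm (∑ (compositions n d)
        (λ ds → compositionOperator ds (tracePower (d ℕ.* (k ∸ 1)))))

  Tr[_,_] : Carrier → (k : ℕ) → Hypergraph → ℕ → Carrier
  Tr[ α , k ] H = Tr {k} {order H} (A⟨ α ⟩ k H)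

  -- Only hypergraphs with the same number of vertices are related.
  S-Order : Carrier → ℕ → Rel Hypergraph (ℓ₁ ⊔ ℓ₂)
  S-Order α k H₁ H₂ = order H₁ ≡ order H₂ ×
    ∃[ d ] (1 ≤ d × d ≤ order H₁ ℕ.* (k ∸ 1) ^ (order H₁ ∸ 1) ∸ 1 ×
            (∀ t → t ℕ.< d → Tr[ α , k ] H₁ t ≈ Tr[ α , k ] H₂ t) ×
            Tr[ α , k ] H₁ d < Tr[ α , k ] H₂ d)

{-# OPTIONS --safe #-}

-- The order is decided by the second trace.  In the Morozov–Shakirov formula a
-- product of row operators sees only closed walks whose arcs leave the chosen
-- rows, so the term of d·eᵢ is the d-th power of the diagonal entry α dᵢ, and
-- for d = 2 the term of eᵢ + eⱼ vanishes when k ≥ 3 and comes from the edge ij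
-- when k = 2.  Hence Tr₁ depends on Σ dᵢ = km only, and Tr₂ on α² Σ dᵢ² apart
-- from terms depending on n, k, m.
--
-- Root a hypertree at r.  Every edge e has one vertex, its gate, joined to r
-- without using e, and every vertex other than r lies below exactly one edge,
-- its parent, of which it is not the gate.  This gives n = 1 + m(k-1), so the
-- excesses xᵢ = dᵢ - 1 are nonnegative with sum m-1, and Σ dᵢ² is ordered as
-- Σ xᵢ².  A hypertree with a vertex of degree m is the hyperstar, one with a
-- vertex of degree m-1 is S_{1,2,1,…,1}: the parent labels have the same
-- multiplicities and the gates match.  In all others xᵢ ≤ m-3, so that
-- Σ xᵢ² ≤ (m-3)(m-1) < (m-2)² + 1.

module Submission where

open import Defs
import Data.Nat.Properties as ℕ

-- Polynomials are unnormalised lists of terms without a usable equality, so the proof never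
-- compares two of them. The constant term is a linear functional given by its values on monomials,
-- and every differential operator is moved onto the functional as its adjoint. What stays behind is
-- the bare trace of a matrix power, a sum over closed walks, and a term vanishes as soon as its
-- functional vanishes on every such walk. The order of the field need not be decidable. All
-- comparisons are therefore made between natural numbers, and reach the traces only through adding
-- constants and multiplying by positive ones. A rooting takes the place of an induction on
-- hypertrees, which would change the sets of vertices and edges at each removal. With gates and
-- parents as plain maps, counts are exchanges of finite sums over fixed index sets. The crude
-- estimate Σ xᵢ² ≤ max xᵢ · Σ xᵢ is sharp enough: (m-3)(m-1) = (m-2)² - 1 stays two below (m-2)² +
-- 1.

module Hypertrees where
  open import Algebra.Properties.Semiring.Sum ℕ.+-*-semiring using (sum; sum-cong-≗; ∑-comm; ∑-distrib-+; *-distribˡ-sum; sum-remove)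
  open import Data.Bool.Base using (true; false; if_then_else_)
  open import Data.Empty using (⊥; ⊥-elim)
  open import Data.Fin.Base using (Fin; zero; suc; punchIn; punchOut; inject₁; fromℕ; splitAt; _↑ˡ_; _↑ʳ_)
  open import Data.Fin.Permutation using (Permutation; _⟨$⟩ʳ_; _⟨$⟩ˡ_; inverseˡ; inverseʳ; cast-id; transpose; _∘ₚ_; insert; insert-punchIn)
  import Data.Fin.Permutation as Perm
  open import Data.Fin.Properties using (punchInᵢ≢i; punchIn-punchOut; splitAt-↑ˡ; splitAt-↑ʳ; splitAt⁻¹-↑ˡ; splitAt⁻¹-↑ʳ; suc-injective) renaming (_≟_ to _≟ᶠ_; any? to anyᶠ?)
  open import Data.Fin.Relation.Unary.Top using (view; ‵fromℕ; ‵inject₁)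
  open import Data.Fin.Subset using (Subset; _∈_; _∉_; ∣_∣; inside; outside) renaming (⊤ to ⊤ˢ; ⊥ to ⊥ˢ)
  open import Data.Fin.Subset.Properties using (_∈?_; ∈⊤; ∉⊥; drop-there; ∣⊥∣≡0; ∣⊤∣≡n)
  open import Data.List.Base as List using (List; []; _∷_; replicate)
  open import Data.Maybe.Base as Maybe using (Maybe; just; nothing)
  open import Data.Maybe.Properties using (just-injective) renaming (≡-dec to Maybe-≡-dec)
  open import Data.Nat.Base
  open import Data.Nat.Tactic.RingSolver using (solve-∀)
  open import Data.Product.Base using (∃-syntax; _×_; _,_; proj₁; proj₂)
  open import Data.Sum.Base as Sum using (_⊎_; inj₁; inj₂; [_,_]′)
  open import Data.Sum.Properties using (inj₂-injective)
  open import Data.Unit.Base using (⊤; tt)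
  open import Data.Vec.Base as Vec using (Vec; []; _∷_; lookup; here; there)
  open import Data.Vec.Membership.Propositional using () renaming (_∈_ to _∈ⱽ_; _∉_ to _∉ⱽ_)
  open import Data.Vec.Membership.Propositional.Properties using (∈-lookup)
  open import Data.Vec.Relation.Unary.Any as AnyV using (here; there)
  open import Function.Base using (_∘_; id; const)
  open import Function.Bundles using (_⇔_; mk⇔; module Equivalence)
  open import Function.Construct.Composition using (_⇔-∘_)
  open import Function.Definitions using (Injective)
  open import Level using (Level)
  open import Relation.Binary.Construct.Closure.ReflexiveTransitive as Star using (Star; ε; _◅_; _◅◅_)
  open import Relation.Binary.Definitions using (DecidableEquality)
  open import Relation.Binary.PropositionalEquality
  open import Relation.Nullary.Decidable using (Dec; yes; no; does; dec-true; dec-false; does-⇔)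
  open import Relation.Nullary.Negation using (¬_; contradiction)
  open import Relation.Unary using (Pred; Decidable)
  open Equivalence using (to; from)

  private variable
    ℓ ℓ′ : Level
    P Q : Set ℓ
    n m : ℕ

  -- Indicator sums over finite index sets.

  𝟙 : Dec P → ℕ
  𝟙 d = if does d then 1 else 0

  𝟙-yes : (d : Dec P) → P → 𝟙 d ≡ 1
  𝟙-yes d x rewrite dec-true d x = refl

  𝟙-no : (d : Dec P) → ¬ P → 𝟙 d ≡ 0
  𝟙-no d x rewrite dec-false d x = refl

  𝟙-cong : (d : Dec P) (e : Dec Q) → P ⇔ Q → 𝟙 d ≡ 𝟙 e
  𝟙-cong d e P⇔Q = cong (if_then 1 else 0) (does-⇔ P⇔Q d e)

  𝟙-⊎ : {R : Set ℓ} (d : Dec R) (e : Dec P) (f : Dec Q) → R ⇔ (P ⊎ Q) → (P → ¬ Q) →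
        𝟙 d ≡ 𝟙 e + 𝟙 f
  𝟙-⊎ d (yes x) (yes y) eq ¬both = contradiction y (¬both x)
  𝟙-⊎ d (yes x) (no _)  eq ¬both = 𝟙-yes d (Equivalence.from eq (inj₁ x))
  𝟙-⊎ d (no _)  (yes y) eq ¬both = 𝟙-yes d (Equivalence.from eq (inj₂ y))
  𝟙-⊎ d (no ¬x) (no ¬y) eq ¬both = 𝟙-no d ([ ¬x , ¬y ]′ ∘ Equivalence.to eq)

  sum-zero : (f : Fin n → ℕ) → (∀ i → f i ≡ 0) → sum f ≡ 0
  sum-zero {zero}  f f≡0 = refl
  sum-zero {suc n} f f≡0 rewrite f≡0 zero = sum-zero (f ∘ suc) (f≡0 ∘ suc)

  sum-single : (f : Fin n → ℕ) (i : Fin n) → (∀ j → j ≢ i → f j ≡ 0) → sum f ≡ f i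
  sum-single {suc n} f i f≡0 = trans (sum-remove f)
    (trans (cong (f i +_) (sum-zero _ (λ j → f≡0 _ (punchInᵢ≢i i j)))) (ℕ.+-identityʳ _))

  sum-mono-≤ : {f g : Fin n → ℕ} → (∀ i → f i ≤ g i) → sum f ≤ sum g
  sum-mono-≤ {zero}  f≤g = z≤n
  sum-mono-≤ {suc n} f≤g = ℕ.+-mono-≤ (f≤g zero) (sum-mono-≤ (f≤g ∘ suc))

  term≤sum : (f : Fin n → ℕ) (i : Fin n) → f i ≤ sum f
  term≤sum {suc n} f i = subst (f i ≤_) (sym (sum-remove f)) (ℕ.m≤m+n _ _)

  terms≤sum : (f : Fin n → ℕ) {i j : Fin n} → i ≢ j → f i + f j ≤ sum f
  terms≤sum {suc n} f {i} {j} i≢j = subst (f i + f j ≤_) (sym (sum-remove f))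
    (ℕ.+-monoʳ-≤ (f i) (subst (_≤ sum (f ∘ punchIn i)) (cong f (punchIn-punchOut i≢j))
      (term≤sum (f ∘ punchIn i) (punchOut i≢j))))

  sum-const : ∀ n c → sum {n} (λ _ → c) ≡ n * c
  sum-const zero    c = refl
  sum-const (suc n) c = cong (c +_) (sum-const n c)

  sum-𝟙≟ : (i : Fin n) → sum (λ j → 𝟙 (i ≟ᶠ j)) ≡ 1
  sum-𝟙≟ i = trans (sum-single _ i (λ j j≢i → 𝟙-no (i ≟ᶠ j) (j≢i ∘ sym))) (𝟙-yes (i ≟ᶠ i) refl)

  ∣∣-sum : (S : Subset n) → ∣ S ∣ ≡ sum (λ v → 𝟙 (v ∈? S))
  ∣∣-sum []            = refl
  ∣∣-sum (inside  ∷ S) = cong suc (∣∣-sum S)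
  ∣∣-sum (outside ∷ S) = ∣∣-sum S

  length-filter-tabulate : ∀ {A : Set ℓ} {P : Pred A ℓ′} (P? : Decidable P) (f : Fin n → A) →
    List.length (List.filter P? (List.tabulate f)) ≡ sum (λ i → 𝟙 (P? (f i)))
  length-filter-tabulate {n = zero}  P? f = refl
  length-filter-tabulate {n = suc n} P? f with does (P? (f zero))
  ... | true  = cong suc (length-filter-tabulate P? (f ∘ suc))
  ... | false = length-filter-tabulate P? (f ∘ suc)

  degree-sum : ∀ H v → degree H v ≡ sum (λ j → 𝟙 (v ∈? edge H j))
  degree-sum H v = length-filter-tabulate (λ j → v ∈? edge H j) id

  lookup-∷-injective : ∀ {A : Set} {q} {x : A} {xs : Vec A q} → x ∉ⱽ xs →
    Injective _≡_ _≡_ (lookup xs) → Injective _≡_ _≡_ (lookup (x ∷ xs))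
  lookup-∷-injective x∉ inj {zero}  {zero}  eq = refl
  lookup-∷-injective {xs = xs} x∉ inj {zero} {suc j} refl = contradiction (∈-lookup j xs) x∉
  lookup-∷-injective {xs = xs} x∉ inj {suc i} {zero} refl = contradiction (∈-lookup i xs) x∉
  lookup-∷-injective x∉ inj {suc i} {suc j} eq = cong suc (inj eq)

  -- Simple paths and the bridge property of edges in acyclic hypergraphs.

  module _ (H : Hypergraph) where

    private
      V E : Set
      V = Fin (order H)
      E = Fin (size H)

    Linked : (E → Set) → V → V → Set
    Linked P u v = ∃[ j ] (P j × u ∈ edge H j × v ∈ edge H j)

    -- A path with pairwise distinct vertices and pairwise distinct edges, all
    -- satisfying P; the first vector omits the starting vertex.
    data Path (P : E → Set) : ∀ {q} → V → Vec V q → Vec E q → V → Set where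
      []   : ∀ {u} → Path P u [] [] u
      hop : ∀ {q u w v e} {vs : Vec V q} {es : Vec E q} → P e → u ∈ edge H e → w ∈ edge H e →
             u ∉ⱽ w ∷ vs → e ∉ⱽ es → Path P w vs es v → Path P u (w ∷ vs) (e ∷ es) v

    module _ {P : E → Set} where

      suffix-from : ∀ {q u w v} {vs : Vec V q} {es : Vec E q} → Path P w vs es v → u ∈ⱽ w ∷ vs →
        ∃[ q′ ] ∃[ vs′ ] ∃[ es′ ] Path P {q′} u vs′ es′ v
      suffix-from p                   (here refl)   = _ , _ , _ , p
      suffix-from (hop _ _ _ _ _ p)  (there u∈)    = suffix-from p u∈

      -- The path is cut at the vertex where it leaves `e`. As its edges are distinct, the rest does
      -- not use `e`, which is thus free to become the first edge of a new path.
      suffix-after : ∀ {q e w v} {vs : Vec V q} {es : Vec E q} → Path P w vs es v → e ∈ⱽ es →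
        ∃[ q′ ] ∃[ w′ ] ∃[ vs′ ] ∃[ es′ ] (Path P {q′} w′ vs′ es′ v × w′ ∈ edge H e × e ∉ⱽ es′ ×
          (∀ {u} → u ∈ⱽ w′ ∷ vs′ → u ∈ⱽ w ∷ vs))
      suffix-after (hop _ _ w∈ _ e∉ p) (here refl) = _ , _ , _ , _ , p , w∈ , e∉ , there
      suffix-after (hop _ _ _ _ _ p) (there e∈) with suffix-after p e∈
      ... | _ , _ , _ , _ , p′ , w′∈ , e∉ , sub = _ , _ , _ , _ , p′ , w′∈ , e∉ , there ∘ sub

      -- One step of loop erasure. A repeated vertex is cured by starting at its occurrence; a
      -- repeated edge by travelling along it straight to the vertex where the old path left it.
      prepend : ∀ {q e u w v} {vs : Vec V q} {es : Vec E q} → P e → u ∈ edge H e → w ∈ edge H e →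
        Path P w vs es v → ∃[ q′ ] ∃[ vs′ ] ∃[ es′ ] Path P {q′} u vs′ es′ v
      prepend {e = e} {u} {w} {vs = vs} {es} Pe u∈ w∈ p
        with AnyV.any? (u ≟ᶠ_) (w ∷ vs) | AnyV.any? (e ≟ᶠ_) es
      ... | yes u∈p | _      = suffix-from p u∈p
      ... | no u∉p  | no e∉p = _ , _ , _ , hop Pe u∈ w∈ u∉p e∉p p
      ... | no u∉p  | yes e∈p with suffix-after p e∈p
      ...   | _ , _ , _ , _ , p′ , w′∈ , e∉ , sub = _ , _ , _ , hop Pe u∈ w′∈ (u∉p ∘ sub) e∉ p′

      simplify : ∀ {u v} → Star (Linked P) u v → ∃[ q ] ∃[ vs ] ∃[ es ] Path P {q} u vs es v
      simplify ε = _ , _ , _ , []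
      simplify ((e , Pe , u∈ , w∈) ◅ s) = prepend Pe u∈ w∈ (proj₂ (proj₂ (proj₂ (simplify s))))

      path⇒star : ∀ {q u v} {vs : Vec V q} {es : Vec E q} {Q : E → Set} → Path P u vs es v →
        (∀ {e} → P e → e ∈ⱽ es → Q e) → Star (Linked Q) u v
      path⇒star []                     f = ε
      path⇒star (hop Pe u∈ w∈ _ _ p) f =
        (_ , f Pe (here refl) , u∈ , w∈) ◅ path⇒star p (λ P e∈ → f P (there e∈))

      path-last : ∀ {q u v} {vs : Vec V q} {es : Vec E q} → Path P u vs es v →
        lookup (u ∷ vs) (fromℕ q) ≡ v
      path-last []                  = refl
      path-last (hop _ _ _ _ _ p)  = path-last p

      path-edges : ∀ {q u v} {vs : Vec V q} {es : Vec E q} → Path P u vs es v →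
        ∀ i → P (lookup es i)
      path-edges (hop Pe _ _ _ _ p) zero    = Pe
      path-edges (hop Pe _ _ _ _ p) (suc i) = path-edges p i

      path-source : ∀ {q u v} {vs : Vec V q} {es : Vec E q} → Path P u vs es v →
        ∀ i → lookup (u ∷ vs) (inject₁ i) ∈ edge H (lookup es i)
      path-source (hop _ u∈ _ _ _ p) zero    = u∈
      path-source (hop _ _  _ _ _ p) (suc i) = path-source p i

      path-target : ∀ {q u v} {vs : Vec V q} {es : Vec E q} → Path P u vs es v →
        ∀ i → lookup vs i ∈ edge H (lookup es i)
      path-target (hop _ _ w∈ _ _ p) zero    = w∈
      path-target (hop _ _ _ _ _ p) (suc i) = path-target p i

      path-distinctᵛ : ∀ {q u v} {vs : Vec V q} {es : Vec E q} → Path P u vs es v →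
        Injective _≡_ _≡_ (lookup (u ∷ vs))
      path-distinctᵛ []                    = lookup-∷-injective (λ ()) (λ { {()} })
      path-distinctᵛ (hop _ _ _ u∉ _ p)   = lookup-∷-injective u∉ (path-distinctᵛ p)

      path-distinctᵉ : ∀ {q u v} {vs : Vec V q} {es : Vec E q} → Path P u vs es v →
        Injective _≡_ _≡_ (lookup es)
      path-distinctᵉ []                  {()}
      path-distinctᵉ (hop _ _ _ _ e∉ p) = lookup-∷-injective e∉ (path-distinctᵉ p)

    -- A nonempty simple path from `u` to `v` avoiding `e` would be closed by `e` to a cycle with at
    -- least two edges.
    bridge : Acyclic H → ∀ {e u v} → u ∈ edge H e → v ∈ edge H e → Star (Linked (_≢ e)) u v → u ≡ v
    bridge acyclic {e} {u} {v} u∈ v∈ s with simplify s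
    ... | zero  , [] , [] , [] = refl
    ... | suc q , vs , es , p  = contradiction cycle (acyclic _ (s≤s (s≤s z≤n)))
      where
      e∉es : e ∉ⱽ es
      e∉es e∈ = path-edges p (AnyV.index e∈) (sym (AnyV-lookup-index e∈))
        where
        AnyV-lookup-index : ∀ {q} {x : E} {xs : Vec E q} (x∈ : x ∈ⱽ xs) → x ≡ lookup xs (AnyV.index x∈)
        AnyV-lookup-index (here eq)  = eq
        AnyV-lookup-index (there x∈) = AnyV-lookup-index x∈

      cycle : Cycle H (suc (suc q))
      cycle = record
        { vertex    = lookup (v ∷ u ∷ vs)
        ; link      = lookup (e ∷ es)
        ; closed    = sym (path-last p)
        ; distinctᵛ = path-distinctᵛ p
        ; distinctᵉ = lookup-∷-injective e∉es (path-distinctᵉ p)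
        ; source    = λ { zero → v∈ ; (suc i) → path-source p i }
        ; target    = λ { zero → u∈ ; (suc i) → path-target p i }
        }

    -- The edge e hangs below its gate, the vertex of e nearest to the root r;
    -- every vertex other than r hangs below exactly one edge, its parent.
    record Rooting (r : V) : Set where
      field
        gate        : E → V
        parent      : V → Maybe E
        member      : ∀ v e → v ∈ edge H e ⇔ (parent v ≡ just e ⊎ gate e ≡ v)
        parent-gate : ∀ e → parent (gate e) ≢ just e
        parent-root : ∀ v → parent v ≡ nothing ⇔ v ≡ r

      root-gate : ∀ e → r ∈ edge H e → gate e ≡ r
      root-gate e r∈ with Equivalence.to (member r e) r∈
      ... | inj₂ g≡r = g≡r
      ... | inj₁ p≡e with () ← trans (sym p≡e) (Equivalence.from (parent-root r) refl)

    -- Existence of a rooting at any vertex.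

    module _ (connected : Connected H) (acyclic : Acyclic H)
             (vertexOf : ∀ e → ∃[ v ] v ∈ edge H e) (r : V) where

      private
        Conn : E → V → V → Set
        Conn e = Star (Linked (_≢ e))

        -- The property `P` is carried along so that a walk already avoiding one edge can be made to
        -- avoid a second one too.
        last-use : ∀ e {P : E → Set} {u} → Star (Linked P) u r →
          Star (Linked (λ f → P f × f ≢ e)) u r ⊎
          ∃[ g ] (g ∈ edge H e × Star (Linked (λ f → P f × f ≢ e)) g r)
        last-use e ε = inj₁ ε
        last-use e ((f , Pf , u∈ , w∈) ◅ s) with last-use e s
        ... | inj₂ x = inj₂ x
        ... | inj₁ s′ with f ≟ᶠ e
        ...   | yes refl = inj₂ (_ , w∈ , s′)
        ...   | no f≢e   = inj₁ ((f , (Pf , f≢e) , u∈ , w∈) ◅ s′)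

        forgetˡ : ∀ {P Q : E → Set} {u v} → Star (Linked (λ f → P f × Q f)) u v → Star (Linked Q) u v
        forgetˡ = Star.map (λ (f , PQ , x) → f , proj₂ PQ , x)

        forgetʳ : ∀ {P Q : E → Set} {u v} → Star (Linked (λ f → P f × Q f)) u v → Star (Linked P) u v
        forgetʳ = Star.map (λ (f , PQ , x) → f , proj₁ PQ , x)

        toRoot : ∀ v → Star (Linked (const ⊤)) v r
        toRoot v = Star.map (λ (j , x) → j , tt , x) (connected v r)

        gate∃ : ∀ e → ∃[ g ] (g ∈ edge H e × Conn e g r)
        gate∃ e with last-use e (toRoot (proj₁ (vertexOf e)))
        ... | inj₁ s            = _ , proj₂ (vertexOf e) , forgetˡ s
        ... | inj₂ (g , g∈ , s) = g , g∈ , forgetˡ s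

        gate : E → V
        gate = proj₁ ∘ gate∃

        gate∈ : ∀ e → gate e ∈ edge H e
        gate∈ = proj₁ ∘ proj₂ ∘ gate∃

        Conn-sym : ∀ {e u v} → Conn e u v → Conn e v u
        Conn-sym = Star.reverse (λ (j , Pj , u∈ , v∈) → j , Pj , v∈ , u∈)

        gate-unique : ∀ {e v} → v ∈ edge H e → Conn e v r → gate e ≡ v
        gate-unique {e} v∈ s = bridge acyclic (gate∈ e) v∈ (proj₂ (proj₂ (gate∃ e)) ◅◅ Conn-sym s)

        Parent : V → E → Set
        Parent v e = v ∈ edge H e × gate e ≢ v

        Parent? : ∀ v e → Dec (Parent v e)
        Parent? v e with v ∈? edge H e | gate e ≟ᶠ v
        ... | yes v∈ | no g≢  = yes (v∈ , g≢)
        ... | no v∉  | _      = no (v∉ ∘ proj₁)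
        ... | _      | yes g≡ = no (λ (_ , g≢) → g≢ g≡)

        -- The first edge of a simple path from `v` to the root is the parent: the rest of the path
        -- avoids it, so its gate is the second vertex, which differs from `v`.
        parent∃ : ∀ v → v ≢ r → ∃[ e ] Parent v e
        parent∃ v v≢r with simplify (toRoot v)
        ... | _ , _ , _ , [] = contradiction refl v≢r
        ... | _ , _ , _ , hop {w = w} {e = e} {es = es} _ v∈ w∈ v∉ e∉ p =
          e , v∈ , λ g≡v → v∉ (here (trans (sym g≡v) (gate-unique w∈
            (path⇒star p (λ { _ e′∈ refl → e∉ e′∈ })))))

        -- Suppose `e` and `f` differ and follow the walk from the gate of `f` to the root. If it
        -- avoids `e`, then entering it from `v` through `f` makes `v` the gate of `e`. Otherwise,
        -- entering it from `v` through `e` at its last use of `e` makes `v` the gate of `f`.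
        parent-unique : ∀ {v e f} → Parent v e → Parent v f → e ≡ f
        parent-unique {v} {e} {f} (v∈e , ge≢) (v∈f , gf≢) with e ≟ᶠ f
        ... | yes e≡f = e≡f
        ... | no e≢f with last-use e (proj₂ (proj₂ (gate∃ f)))
        ...   | inj₁ s = contradiction
          (gate-unique v∈e ((f , e≢f ∘ sym , v∈f , gate∈ f) ◅ forgetˡ s)) ge≢
        ...   | inj₂ (y , y∈e , s) = contradiction
          (gate-unique v∈f ((e , e≢f , v∈e , y∈e) ◅ forgetʳ s)) gf≢

        parent : V → Maybe E
        parent v with anyᶠ? (Parent? v)
        ... | yes (e , _) = just e
        ... | no _        = nothing

        parent-to : ∀ {v e} → parent v ≡ just e → Parent v e
        parent-to {v} eq with anyᶠ? (Parent? v)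
        parent-to refl | yes (_ , x) = x

        parent-from : ∀ {v e} → Parent v e → parent v ≡ just e
        parent-from {v} {e} x with anyᶠ? (Parent? v)
        ... | yes (f , y) = cong just (parent-unique y x)
        ... | no ¬x       = contradiction (e , x) ¬x

        parent-nothing : ∀ v → parent v ≡ nothing → v ≡ r
        parent-nothing v eq with v ≟ᶠ r
        ... | yes v≡r = v≡r
        ... | no v≢r with () ← trans (sym eq) (parent-from (proj₂ (parent∃ v v≢r)))

        nothing-root : parent r ≡ nothing
        nothing-root with parent r in eq
        ... | nothing = refl
        ... | just e  = contradiction (gate-unique (proj₁ (parent-to eq)) ε) (proj₂ (parent-to {r} eq))

      rooting : Rooting r
      rooting = record
        { gate        = gate
        ; parent      = parent
        ; member      = λ v e → mk⇔
            member-to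
            [ proj₁ ∘ parent-to , (λ { refl → gate∈ e }) ]′
        ; parent-gate = λ e eq → proj₂ (parent-to {gate e} eq) refl
        ; parent-root = λ v → mk⇔ (parent-nothing v) (λ { refl → nothing-root })
        }
        where
        member-to : ∀ {v e} → v ∈ edge H e → parent v ≡ just e ⊎ gate e ≡ v
        member-to {v} {e} v∈ with gate e ≟ᶠ v
        ... | yes g≡v = inj₂ g≡v
        ... | no g≢v  = inj₁ (parent-from (v∈ , g≢v))

  -- Permutations with prescribed behaviour.

  infix 4 _≟ᴹ_
  _≟ᴹ_ : ∀ {n} → DecidableEquality (Maybe (Fin n))
  _≟ᴹ_ = Maybe-≡-dec _≟ᶠ_

  sum-𝟙≤ : ∀ {n p} {P : Pred (Fin n) p} (P? : Decidable P) → sum (λ i → 𝟙 (P? i)) ≤ n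
  sum-𝟙≤ {zero}  P? = z≤n
  sum-𝟙≤ {suc n} P? with P? zero
  ... | yes _ = s≤s (sum-𝟙≤ (P? ∘ suc))
  ... | no _  = ℕ.m≤n⇒m≤1+n (sum-𝟙≤ (P? ∘ suc))

  sum-𝟙≡n⇒all : ∀ {n p} {P : Pred (Fin n) p} (P? : Decidable P) → sum (λ i → 𝟙 (P? i)) ≡ n → ∀ i → P i
  sum-𝟙≡n⇒all {suc n} P? eq i with P? zero
  sum-𝟙≡n⇒all {suc n} P? eq zero    | yes x = x
  sum-𝟙≡n⇒all {suc n} P? eq (suc i) | yes x = sum-𝟙≡n⇒all (P? ∘ suc) (ℕ.suc-injective eq) i
  sum-𝟙≡n⇒all {suc n} P? eq i       | no _  =
    contradiction (sum-𝟙≤ (P? ∘ suc)) (ℕ.<⇒≱ (ℕ.≤-reflexive (sym eq)))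

  sum-𝟙-all-but-one : ∀ {n p} {P : Pred (Fin n) p} (P? : Decidable P) → suc (sum (λ i → 𝟙 (P? i))) ≡ n →
    ∃[ i ] (¬ P i × ∀ j → j ≢ i → P j)
  sum-𝟙-all-but-one {suc n} P? eq with P? zero
  ... | no ¬x = zero , ¬x , λ
    { zero    0≢0 → contradiction refl 0≢0
    ; (suc j) _   → sum-𝟙≡n⇒all (P? ∘ suc) (ℕ.suc-injective eq) j }
  ... | yes x with sum-𝟙-all-but-one (P? ∘ suc) (ℕ.suc-injective eq)
  ...   | i , ¬y , f = suc i , ¬y , λ { zero _ → x ; (suc j) j≢i → f j (j≢i ∘ cong suc) }

  sum-𝟙-positive : ∀ {n p} {P : Pred (Fin n) p} (P? : Decidable P) → 1 ≤ sum (λ i → 𝟙 (P? i)) → ∃[ i ] P i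
  sum-𝟙-positive {suc n} P? 1≤ with P? zero
  ... | yes x = zero , x
  ... | no _ with sum-𝟙-positive (P? ∘ suc) 1≤
  ...   | i , x = suc i , x

  -- Source of all vertex bijections: equal fibre sizes suffice. Index zero is paired with some `j`
  -- of the same value, and removing both keeps the fibre sizes equal.
  matching : ∀ {a} {A : Set a} (_≟_ : DecidableEquality A) {n n′} (f : Fin n → A) (g : Fin n′ → A) →
    (∀ a → sum (λ i → 𝟙 (f i ≟ a)) ≡ sum (λ j → 𝟙 (g j ≟ a))) →
    ∃[ π ] (∀ i → g (π ⟨$⟩ʳ i) ≡ f i)
  matching _≟_ {zero} {zero} f g eq = Perm.id , λ ()
  matching _≟_ {zero} {suc n′} f g eq with () ← trans (eq (g zero)) (cong (_+ sum (λ j → 𝟙 (g (suc j) ≟ g zero))) (𝟙-yes (g zero ≟ g zero) refl))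
  matching _≟_ {suc n} {n′} f g eq
    with sum-𝟙-positive (λ j → g j ≟ f zero)
           (subst (1 ≤_) (eq (f zero)) (subst (λ x → 1 ≤ x + sum (λ i → 𝟙 (f (suc i) ≟ f zero)))
              (sym (𝟙-yes (f zero ≟ f zero) refl)) (s≤s z≤n)))
  matching _≟_ {suc n} {suc n′} f g eq | j , gj≡f0 = insert zero j π , matches
    where
    rest : ∀ a → sum (λ i → 𝟙 (f (suc i) ≟ a)) ≡ sum (λ i → 𝟙 (g (punchIn j i) ≟ a))
    rest a = ℕ.+-cancelˡ-≡ (𝟙 (f zero ≟ a)) _ _ (trans (eq a) (trans (sum-remove (λ i → 𝟙 (g i ≟ a)))
      (cong (λ x → 𝟙 (x ≟ a) + sum (λ i → 𝟙 (g (punchIn j i) ≟ a))) gj≡f0)))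

    rec = matching _≟_ (f ∘ suc) (g ∘ punchIn j) rest
    π   = proj₁ rec

    matches : ∀ i → g (insert zero j π ⟨$⟩ʳ i) ≡ f i
    matches zero    = gj≡f0
    matches (suc i) = trans (cong g (insert-punchIn zero j π i)) (proj₂ rec i)

  transpose-left : ∀ {n} (i j : Fin n) → transpose i j ⟨$⟩ʳ i ≡ j
  transpose-left i j rewrite dec-true (i ≟ᶠ i) refl = refl

  transpose-fix : ∀ {n} {i j k : Fin n} → k ≢ i → k ≢ j → transpose i j ⟨$⟩ʳ k ≡ k
  transpose-fix {i = i} {j} {k} k≢i k≢j rewrite dec-false (k ≟ᶠ i) k≢i | dec-false (k ≟ᶠ j) k≢j = refl

  transpose-respects : ∀ {a} {A : Set a} {n} {i j : Fin n} (f : Fin n → A) → f i ≡ f j →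
    ∀ k → f (transpose i j ⟨$⟩ʳ k) ≡ f k
  transpose-respects {i = i} {j} f eq k with k ≟ᶠ i
  ... | yes refl = sym eq
  ... | no _ with k ≟ᶠ j
  ...   | yes refl = eq
  ...   | no _     = refl

  ⟨$⟩ʳ-injective : ∀ {m n} (π : Permutation m n) {i j} → π ⟨$⟩ʳ i ≡ π ⟨$⟩ʳ j → i ≡ j
  ⟨$⟩ʳ-injective π eq = trans (sym (inverseˡ π)) (trans (cong (π ⟨$⟩ˡ_) eq) (inverseˡ π))

  -- One transposition corrects the image of `a`, a second one that of `b`. The second leaves `a′`
  -- in place, as `a′` is neither the current image of `b` nor `b′`.
  two-point-permutation : ∀ {m n} → m ≡ n → {a b : Fin m} {a′ b′ : Fin n} → a ≢ b → a′ ≢ b′ →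
    ∃[ π ] (π ⟨$⟩ʳ a ≡ a′ × π ⟨$⟩ʳ b ≡ b′)
  two-point-permutation {m} {n} m≡n {a} {b} {a′} {b′} a≢b a′≢b′ =
    π₁ ∘ₚ transpose (π₁ ⟨$⟩ʳ b) b′ ,
    trans (transpose-fix (a≢b ∘ ⟨$⟩ʳ-injective π₁) (a′≢b′ ∘ trans (sym π₁a))) π₁a ,
    transpose-left (π₁ ⟨$⟩ʳ b) b′
    where
    π₀ π₁ : Permutation m n
    π₀ = cast-id m≡n
    π₁ = π₀ ∘ₚ transpose (π₀ ⟨$⟩ʳ a) a′

    π₁a : π₁ ⟨$⟩ʳ a ≡ a′
    π₁a = transpose-left (π₀ ⟨$⟩ʳ a) a′

  -- Double counting with parents and gates.

  module Rooted-counting (H : Hypergraph) {r : Fin (order H)} (R : Rooting H r) where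
    open Rooting R

    children : Fin (order H) → ℕ
    children v = sum (λ e → 𝟙 (gate e ≟ᶠ v))

    𝟙-member : ∀ v e → 𝟙 (v ∈? edge H e) ≡ 𝟙 (parent v ≟ᴹ just e) + 𝟙 (gate e ≟ᶠ v)
    𝟙-member v e = 𝟙-⊎ (v ∈? edge H e) (parent v ≟ᴹ just e) (gate e ≟ᶠ v) (member v e) (λ { p refl → parent-gate e p })

    sum-parent-root : sum (λ e → 𝟙 (parent r ≟ᴹ just e)) ≡ 0
    sum-parent-root rewrite Equivalence.from (parent-root r) refl = sum-zero {size H} (λ _ → 0) (λ _ → refl)

    sum-parent : ∀ v → v ≢ r → sum (λ e → 𝟙 (parent v ≟ᴹ just e)) ≡ 1
    sum-parent v v≢r with parent v in eq
    ... | nothing = contradiction (Equivalence.to (parent-root v) eq) v≢r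
    ... | just f  = trans (sum-cong-≗ (λ e → 𝟙-cong (just f ≟ᴹ just e) (f ≟ᶠ e) (mk⇔ just-injective (cong just))))
                      (sum-𝟙≟ f)

    degree-split : ∀ v → degree H v ≡ sum (λ e → 𝟙 (parent v ≟ᴹ just e)) + children v
    degree-split v = trans (degree-sum H v) (trans (sum-cong-≗ (𝟙-member v))
      (∑-distrib-+ (λ e → 𝟙 (parent v ≟ᴹ just e)) (λ e → 𝟙 (gate e ≟ᶠ v))))

    degree-nonroot : ∀ v → v ≢ r → degree H v ≡ suc (children v)
    degree-nonroot v v≢r = trans (degree-split v) (cong (_+ children v) (sum-parent v v≢r))

    module _ {k} (uniform : Uniform (suc k) H) where

      -- Of the k + 1 vertices of `e` exactly one is its gate, and the others have `e` as parent.
      edge-children : ∀ e → sum (λ v → 𝟙 (parent v ≟ᴹ just e)) ≡ k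
      edge-children e = ℕ.+-cancelʳ-≡ 1 _ _ (begin
        sum (λ v → 𝟙 (parent v ≟ᴹ just e)) + 1
          ≡⟨ cong (sum (λ v → 𝟙 (parent v ≟ᴹ just e)) +_) (sum-𝟙≟ (gate e)) ⟨
        sum (λ v → 𝟙 (parent v ≟ᴹ just e)) + sum (λ v → 𝟙 (gate e ≟ᶠ v))
          ≡⟨ ∑-distrib-+ (λ v → 𝟙 (parent v ≟ᴹ just e)) (λ v → 𝟙 (gate e ≟ᶠ v)) ⟨
        sum (λ v → 𝟙 (parent v ≟ᴹ just e) + 𝟙 (gate e ≟ᶠ v))
          ≡⟨ sum-cong-≗ (λ v → 𝟙-member v e) ⟨
        sum (λ v → 𝟙 (v ∈? edge H e)) ≡⟨ ∣∣-sum (edge H e) ⟨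
        ∣ edge H e ∣                  ≡⟨ uniform e ⟩
        suc k                         ≡⟨ ℕ.+-comm 1 k ⟩
        k + 1                         ∎)
        where open ≡-Reasoning

      order≡ : order H ≡ suc (size H * k)
      order≡ = begin
        order H
          ≡⟨ trans (sum-const (order H) 1) (ℕ.*-identityʳ _) ⟨
        sum {order H} (λ _ → 1)
          ≡⟨ sum-cong-≗ split ⟩
        sum (λ v → 𝟙 (r ≟ᶠ v) + sum (λ e → 𝟙 (parent v ≟ᴹ just e)))
          ≡⟨ ∑-distrib-+ (λ v → 𝟙 (r ≟ᶠ v)) (λ v → sum (λ e → 𝟙 (parent v ≟ᴹ just e))) ⟩
        sum (λ v → 𝟙 (r ≟ᶠ v)) + sum (λ v → sum (λ e → 𝟙 (parent v ≟ᴹ just e)))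
          ≡⟨ cong₂ _+_ (sum-𝟙≟ r) (trans (∑-comm (λ v e → 𝟙 (parent v ≟ᴹ just e)))
               (trans (sum-cong-≗ edge-children) (sum-const (size H) k))) ⟩
        suc (size H * k) ∎
        where
        open ≡-Reasoning
        split : ∀ v → 1 ≡ 𝟙 (r ≟ᶠ v) + sum (λ e → 𝟙 (parent v ≟ᴹ just e))
        split v with r ≟ᶠ v
        ... | yes refl = cong suc (sym sum-parent-root)
        ... | no r≢v   = sym (sum-parent v (r≢v ∘ sym))

      -- The right-hand side mentions neither the hypergraph nor `π`. Hence every bijection between
      -- the edges of two rooted hypergraphs lifts, by `matching`, to a vertex bijection that
      -- respects parents.
      label-count : ∀ {m} (π : Permutation (size H) m) x →
        sum (λ v → 𝟙 (Maybe.map (π ⟨$⟩ʳ_) (parent v) ≟ᴹ x)) ≡ Maybe.maybe (const k) 1 x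
      label-count π nothing = trans
        (sum-cong-≗ (λ v → 𝟙-cong (_ ≟ᴹ nothing) (r ≟ᶠ v)
          (mk⇔ (λ eq → sym (Equivalence.to (parent-root v) (unmap (parent v) eq)))
               (λ { refl → cong (Maybe.map _) (Equivalence.from (parent-root r) refl) }))))
        (sum-𝟙≟ r)
        where
        unmap : ∀ x → Maybe.map (π ⟨$⟩ʳ_) x ≡ nothing → x ≡ nothing
        unmap nothing _ = refl
      label-count π (just e′) = trans
        (sum-cong-≗ (λ v → 𝟙-cong (_ ≟ᴹ just e′) (parent v ≟ᴹ just (π ⟨$⟩ˡ e′))
          (mk⇔ (unmap (parent v)) (λ eq → trans (cong (Maybe.map (π ⟨$⟩ʳ_)) eq) (cong just (inverseʳ π))))))
        (edge-children (π ⟨$⟩ˡ e′))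
        where
        unmap : ∀ x → Maybe.map (π ⟨$⟩ʳ_) x ≡ just e′ → x ≡ just (π ⟨$⟩ˡ e′)
        unmap (just e) refl = cong just (sym (inverseˡ π))

  -- Isomorphisms from rootings.

  module _ (H G : Hypergraph) {r r′} (R : Rooting H r) (S : Rooting G r′) where
    private
      module R = Rooting R
      module S = Rooting S

    rooted-iso : (φ : Permutation (order H) (order G)) (π : Permutation (size H) (size G)) →
      (∀ v → S.parent (φ ⟨$⟩ʳ v) ≡ Maybe.map (π ⟨$⟩ʳ_) (R.parent v)) →
      (∀ e → S.gate (π ⟨$⟩ʳ e) ≡ φ ⟨$⟩ʳ R.gate e) → H ≅ G
    rooted-iso φ π par gat = record
      { vertices  = φ
      ; edges     = π
      ; incidence = λ v e → mk⇔
          (λ v∈ → Equivalence.from (S.member _ _) (Sum.map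
             (λ p → trans (par v) (cong (Maybe.map (π ⟨$⟩ʳ_)) p))
             (λ g → trans (gat e) (cong (φ ⟨$⟩ʳ_) g))
             (Equivalence.to (R.member v e) v∈)))
          (λ v∈ → Equivalence.from (R.member v e) (Sum.map
             (λ p → unmap (R.parent v) (trans (sym (par v)) p))
             (λ g → ⟨$⟩ʳ-injective φ (trans (sym (gat e)) g))
             (Equivalence.to (S.member _ _) v∈)))
      }
      where
      unmap : ∀ {e} x → Maybe.map (π ⟨$⟩ʳ_) x ≡ just (π ⟨$⟩ʳ e) → x ≡ just e
      unmap (just f) eq = cong just (⟨$⟩ʳ-injective π (just-injective eq))

    module _ {k} (uH : Uniform (suc k) H) (uG : Uniform (suc k) G) where

      parent-matching : (π : Permutation (size H) (size G)) → ∃[ φ ]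
        (∀ v → S.parent (φ ⟨$⟩ʳ v) ≡ Maybe.map (π ⟨$⟩ʳ_) (R.parent v))
      parent-matching π = matching _≟ᴹ_ (Maybe.map (π ⟨$⟩ʳ_) ∘ R.parent) S.parent λ x →
        trans (Rooted-counting.label-count H R uH π x)
          (trans (sym (Rooted-counting.label-count G S uG Perm.id x))
            (sum-cong-≗ (λ v → cong (λ y → 𝟙 (y ≟ᴹ x)) (map-id (S.parent v)))))
        where
        map-id : ∀ {A : Set} (x : Maybe A) → Maybe.map id x ≡ x
        map-id nothing  = refl
        map-id (just x) = refl

      root↦root : ∀ φ π → (∀ v → S.parent (φ ⟨$⟩ʳ v) ≡ Maybe.map (π ⟨$⟩ʳ_) (R.parent v)) →
        φ ⟨$⟩ʳ r ≡ r′
      root↦root φ π par = Equivalence.to (S.parent-root _)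
        (trans (par r) (cong (Maybe.map _) (Equivalence.from (R.parent-root r) refl)))

      -- Every gate is the root, and a bijection respecting parents sends root to root because only
      -- the root lacks a parent. So any bijection of edges will do.
      star-iso : size H ≡ size G → (∀ e → r ∈ edge H e) → (∀ e → r′ ∈ edge G e) → H ≅ G
      star-iso eq rH rG = rooted-iso φ π par λ e →
        trans (S.root-gate _ (rG _)) (sym (trans (cong (φ ⟨$⟩ʳ_) (R.root-gate e (rH e)))
          (root↦root φ π par)))
        where
        π = cast-id eq
        φ = proj₁ (parent-matching π)
        par = proj₂ (parent-matching π)

      -- The gate of the exceptional edge `f` is not the root, so it has a parent `e₁` other than
      -- `f`. The edge bijection has to respect both `f` and `e₁`; all gates other than that of `f`
      -- are the root.
      broom-iso : size H ≡ size G → ∀ {f f′} →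
        r ∉ edge H f → (∀ e → e ≢ f → r ∈ edge H e) →
        r′ ∉ edge G f′ → (∀ e → e ≢ f′ → r′ ∈ edge G e) → H ≅ G
      broom-iso eq {f} {f′} r∉f rH r′∉f′ rG = rooted-iso φ π par gat
        where
        outer-parent : ∀ (H : Hypergraph) {r} (R : Rooting H r) {f} → r ∉ edge H f →
          ∃[ e ] (Rooting.parent R (Rooting.gate R f) ≡ just e × f ≢ e)
        outer-parent H R {f} r∉ with Rooting.parent R (Rooting.gate R f) in eq
        ... | just e  = e , refl , λ { refl → Rooting.parent-gate R f eq }
        ... | nothing = contradiction (Equivalence.from (Rooting.member R _ f)
          (inj₂ (Equivalence.to (Rooting.parent-root R _) eq))) r∉

        e₁ = outer-parent H R r∉f
        e₁′ = outer-parent G S r′∉f′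
        π∃ = two-point-permutation eq (proj₂ (proj₂ e₁)) (proj₂ (proj₂ e₁′))
        π = proj₁ π∃
        φ₀ = proj₁ (parent-matching π)
        par₀ = proj₂ (parent-matching π)
        w = R.gate f
        w′ = S.gate f′
        -- The image of the gate of `f` under `φ₀` need not be the gate of `f′`, but both hang below
        -- `e₁′`, so swapping them preserves parents.
        φ = φ₀ ∘ₚ transpose (φ₀ ⟨$⟩ʳ w) w′

        par : ∀ v → S.parent (φ ⟨$⟩ʳ v) ≡ Maybe.map (π ⟨$⟩ʳ_) (R.parent v)
        par v = trans (transpose-respects S.parent
          (trans (par₀ w) (trans (cong (Maybe.map (π ⟨$⟩ʳ_)) (proj₁ (proj₂ e₁)))
            (trans (cong just (proj₂ (proj₂ π∃))) (sym (proj₁ (proj₂ e₁′))))))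
          (φ₀ ⟨$⟩ʳ v)) (par₀ v)

        gat : ∀ e → S.gate (π ⟨$⟩ʳ e) ≡ φ ⟨$⟩ʳ R.gate e
        gat e with e ≟ᶠ f
        ... | yes refl = trans (cong S.gate (proj₁ (proj₂ π∃))) (sym (transpose-left (φ₀ ⟨$⟩ʳ w) w′))
        ... | no e≢f = trans
          (S.root-gate _ (rG _ (λ πe≡ → e≢f (⟨$⟩ʳ-injective π (trans πe≡ (sym (proj₁ (proj₂ π∃))))))))
          (sym (trans (cong (φ ⟨$⟩ʳ_) (R.root-gate e (rH e e≢f))) (root↦root φ π par)))

  -- Ranked rootings as certificates of being a hypertree.

  HangsBelow : ∀ {n m} → (Fin n → Fin m) → Fin (suc n) → Fin m → Set
  HangsBelow parent zero    e = ⊥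
  HangsBelow parent (suc i) e = parent i ≡ e

  -- A witness that G is a hypertree rooted at vertex zero: every other vertex
  -- suc i hangs below the edge parent i, and ranks increase away from the root.
  record Layered (G : Rooted) : Set where
    open Rooted G
    field
      gate   : Fin sizeʳ → Fin (suc others)
      parent : Fin others → Fin sizeʳ
      rank   : Fin (suc others) → ℕ
      member : ∀ v e → v ∈ edgeʳ e ⇔ (HangsBelow parent v e ⊎ gate e ≡ v)
      rank-< : ∀ i → rank (gate (parent i)) < rank (suc i)

  module _ {G : Rooted} (L : Layered G) where
    open Layered L
    open Rooted G

    private
      H = forget G

      parent-rank : ∀ {v e} → HangsBelow parent v e → rank (gate e) < rank v
      parent-rank {suc i} refl = rank-< i

      parent-unique : ∀ {v e f} → HangsBelow parent v e → HangsBelow parent v f → e ≡ f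
      parent-unique {suc i} refl refl = refl

      gate∈ : ∀ e → gate e ∈ edgeʳ e
      gate∈ e = from (member _ e) (inj₂ refl)

    layered-connected : Connected H
    layered-connected u v =
      toRoot _ u ℕ.≤-refl ◅◅ Star.reverse (λ (j , u∈ , v∈) → j , v∈ , u∈) (toRoot _ v ℕ.≤-refl)
      where
      -- The bound `b` on the rank drives the recursion; passing to the gate of the parent lowers
      -- the rank.
      toRoot : ∀ b v → rank v < b → Star (Adjacent H) v zero
      toRoot _       zero    _         = ε
      toRoot (suc b) (suc i) (s≤s r≤b) =
        (parent i , from (member (suc i) (parent i)) (inj₁ refl) , gate∈ (parent i))
          ◅ toRoot b _ (ℕ.<-≤-trans (rank-< i) r≤b)

    -- Every vertex of a cycle shares an edge with another vertex of the cycle of larger rank.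
    -- Climbing often enough yields a rank above the sum of all ranks on the cycle.
    layered-acyclic : Acyclic H
    layered-acyclic (suc (suc q)) _ C =
      let (i , B≤) = unbounded (suc (sum (λ i → rank (vertex (suc i)))))
      in contradiction (term≤sum (λ i → rank (vertex (suc i))) i) (ℕ.<⇒≱ B≤)
      where
      open Cycle C

      Climbs : Fin (suc (suc q)) → Set
      Climbs i = ∃[ j ] rank (vertex (suc i)) < rank (vertex (suc j))

      next : ∀ i → ∃[ j ] (vertex (suc i) ∈ edgeʳ (link j) × j ≢ i)
      next i with view i
      -- The last vertex is also the starting vertex, so the edge following it is `link zero`.
      ... | ‵fromℕ     = zero , subst (_∈ edgeʳ (link zero)) closed (source zero) , λ ()
      ... | ‵inject₁ k = suc k , source (suc k) , suc≢inject₁ k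
        where
        suc≢inject₁ : ∀ {n} (k : Fin n) → suc k ≢ inject₁ k
        suc≢inject₁ (suc k) eq = suc≢inject₁ k (suc-injective eq)

      previous : ∀ i → ∃[ j ] (vertex (suc j) ∈ edgeʳ (link i) × j ≢ i)
      previous zero    = fromℕ _ , subst (_∈ edgeʳ (link zero)) closed (source zero) , λ ()
      previous (suc k) = inject₁ k , source (suc k) , inject₁≢suc k
        where
        inject₁≢suc : ∀ {n} (k : Fin n) → inject₁ k ≢ suc k
        inject₁≢suc (suc k) eq = inject₁≢suc k (suc-injective eq)

      climb-along : ∀ {i j e} → gate e ≡ vertex (suc i) → vertex (suc j) ∈ edgeʳ e → j ≢ i → Climbs i
      climb-along {i} {j} {e} g≡ j∈ j≢i with to (member _ e) j∈
      ... | inj₁ p   = j , subst (λ v → rank v < rank (vertex (suc j))) g≡ (parent-rank p)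
      ... | inj₂ g≡′ = contradiction (distinctᵛ (trans (sym g≡′) g≡)) j≢i

      -- A vertex of the cycle has only one parent, so it is the gate of one of
      -- its two edges on the cycle.
      climbs : ∀ i → Climbs i
      climbs i with next i
      ... | j , i∈ , j≢i with to (member _ (link i)) (target i) | to (member _ (link j)) i∈
      ...   | inj₁ p  | inj₁ p′ = contradiction (distinctᵉ (parent-unique p′ p)) j≢i
      ...   | inj₂ g≡ | _       = climb-along g≡ (proj₁ (proj₂ (previous i))) (proj₂ (proj₂ (previous i)))
      ...   | inj₁ _  | inj₂ g≡ = climb-along g≡ (target j) j≢i

      unbounded : ∀ b → ∃[ i ] b ≤ rank (vertex (suc i))
      unbounded zero    = zero , z≤n
      unbounded (suc b) with unbounded b
      ... | i , b≤ with climbs i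
      ...   | j , i<j = j , ℕ.≤-<-trans b≤ i<j
    layered-acyclic (suc zero) (s≤s ())

  single-layered : Layered single
  single-layered = record
    { gate = λ () ; parent = λ () ; rank = const 0 ; member = λ _ () ; rank-< = λ () }

  -- Uniformity and layerings of extensions and coalescences.

  ∈-++ : ∀ {a b} (S : Subset a) (T : Subset b) x →
    x ∈ S Vec.++ T ⇔ [ _∈ S , _∈ T ]′ (splitAt a x)
  ∈-++ []      T x       = mk⇔ id id
  ∈-++ (s ∷ S) T zero    = mk⇔ (λ { here → here }) (λ { here → here })
  ∈-++ {suc a} (s ∷ S) T (suc x) with splitAt a x | ∈-++ S T x
  ... | inj₁ i | eq = mk⇔ (there ∘ to eq ∘ drop-there) (there ∘ from eq ∘ drop-there)
  ... | inj₂ j | eq = mk⇔ (to eq ∘ drop-there) (there ∘ from eq)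

  ∣++∣ : ∀ {a b} (S : Subset a) (T : Subset b) → ∣ S Vec.++ T ∣ ≡ ∣ S ∣ + ∣ T ∣
  ∣++∣ []            T = refl
  ∣++∣ (inside  ∷ S) T = cong suc (∣++∣ S T)
  ∣++∣ (outside ∷ S) T = ∣++∣ S T

  private
    there⇔ : ∀ {n} {s} {S : Subset n} {x} → suc x ∈ s ∷ S ⇔ x ∈ S
    there⇔ = mk⇔ drop-there there

  module _ (c : ℕ) (G : Rooted) where
    open Rooted

    extend-uniform : Uniform (2 + c) (forget G) → Uniform (2 + c) (forget (extend c G))
    extend-uniform u zero = cong suc (trans (∣++∣ (⊤ˢ {c}) _)
      (trans (cong₂ (λ x y → x + suc y) (∣⊤∣≡n c) (∣⊥∣≡0 (others G))) (ℕ.+-comm c 1)))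
    extend-uniform u (suc e) = trans (∣++∣ (⊥ˢ {c}) _) (trans (cong (_+ ∣ edgeʳ G e ∣) (∣⊥∣≡0 c)) (u e))

    extend-layered : Layered G → Layered (extend c G)
    extend-layered L = record
      { gate = gate′ ; parent = parent′ ; rank = rank′ ; member = member′ ; rank-< = rank-<′ }
      where
      open Layered L
      s o : ℕ
      s = suc (sizeʳ G)
      o = suc (others G)

      gate′ : Fin s → Fin (suc (c + o))
      gate′ zero    = zero
      gate′ (suc e) = suc (c ↑ʳ gate e)

      old-parent : Fin o → Fin s
      old-parent zero    = zero
      old-parent (suc i) = suc (parent i)

      parent′ : Fin (c + o) → Fin s
      parent′ x = [ const zero , old-parent ]′ (splitAt c x)

      rank′ : Fin (suc (c + o)) → ℕ
      rank′ zero    = 0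
      rank′ (suc x) = [ const 1 , suc ∘ rank ]′ (splitAt c x)

      old-member : ∀ v e → v ∈ edgeʳ G e ⇔ (old-parent v ≡ suc e ⊎ gate e ≡ v)
      old-member zero    e = mk⇔ (Sum.map (λ ()) id ∘ to (member zero e)) (from (member zero e) ∘ Sum.map (λ ()) id)
      old-member (suc i) e = mk⇔ (Sum.map (cong suc) id ∘ to (member _ e)) (from (member _ e) ∘ Sum.map suc-injective id)

      member-new : ∀ x → x ∈ ⊤ˢ {c} Vec.++ inside ∷ ⊥ˢ ⇔ parent′ x ≡ zero
      member-new x with splitAt c x | ∈-++ (⊤ˢ {c}) (inside ∷ ⊥ˢ {others G}) x
      ... | inj₁ i       | eq = mk⇔ (const refl) (const (from eq ∈⊤))
      ... | inj₂ zero    | eq = mk⇔ (const refl) (const (from eq here))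
      ... | inj₂ (suc i) | eq = mk⇔ (λ x∈ → contradiction (drop-there (to eq x∈)) ∉⊥) (λ ())

      member-old : ∀ x e → x ∈ ⊥ˢ {c} Vec.++ edgeʳ G e ⇔
        (parent′ x ≡ suc e ⊎ gate′ (suc e) ≡ suc x)
      member-old x e with splitAt c x in split | ∈-++ (⊥ˢ {c}) (edgeʳ G e) x
      ... | inj₁ i | eq = mk⇔ (λ x∈ → contradiction (to eq x∈) ∉⊥)
        λ { (inj₂ refl) → case-⊥ (trans (sym split) (splitAt-↑ʳ c o (gate e))) }
        where
        case-⊥ : ∀ {A : Set} {j} → inj₁ i ≡ inj₂ j → A
        case-⊥ ()
      ... | inj₂ v | eq = mk⇔
        (Sum.map id (λ { refl → cong suc (splitAt⁻¹-↑ʳ split) }) ∘ to (old-member v e) ∘ to eq)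
        (from eq ∘ from (old-member v e) ∘ Sum.map id
          (λ { refl → inj₂-injective (trans (sym (splitAt-↑ʳ c o (gate e))) split) }))

      member′ : ∀ v e → v ∈ edgeʳ (extend c G) e ⇔ (HangsBelow parent′ v e ⊎ gate′ e ≡ v)
      member′ zero    zero    = mk⇔ (λ _ → inj₂ refl) (λ _ → here)
      member′ zero    (suc e) = mk⇔ (λ ()) λ { (inj₁ ()) ; (inj₂ ()) }
      member′ (suc x) zero    = mk⇔ (inj₁ ∘ to (member-new x) ∘ drop-there)
        λ { (inj₁ p) → there (from (member-new x) p) ; (inj₂ ()) }
      member′ (suc x) (suc e) = member-old x e ⇔-∘ there⇔

      rank-<′ : ∀ x → rank′ (gate′ (parent′ x)) < rank′ (suc x)
      rank-<′ x with splitAt c x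
      ... | inj₁ i       = s≤s z≤n
      ... | inj₂ zero    = s≤s z≤n
      ... | inj₂ (suc i) rewrite splitAt-↑ʳ c o (gate (parent i)) = s≤s (rank-< i)

  hyperpath-layered : ∀ k r → Layered (hyperpath k r)
  hyperpath-layered k zero    = single-layered
  hyperpath-layered k (suc r) = extend-layered (k ∸ 2) (hyperpath k r) (hyperpath-layered k r)

  hyperpath-uniform : ∀ k r → Uniform (2 + k) (forget (hyperpath (2 + k) r))
  hyperpath-uniform k zero    ()
  hyperpath-uniform k (suc r) = extend-uniform k (hyperpath (2 + k) r) (hyperpath-uniform k r)

  Star-like : Rooted → Set
  Star-like G = ∀ e → zero ∈ Rooted.edgeʳ G e

  Broom-like : Rooted → Set
  Broom-like G = ∃[ f ] (zero ∉ Rooted.edgeʳ G f × ∀ e → e ≢ f → zero ∈ Rooted.edgeʳ G e)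

  module _ (G H : Rooted) where
    open Rooted

    private
      a = others G
      b = others H
      GH = coalesce G H
      E′ = Fin (sizeʳ G + sizeʳ H)

    -- Membership is phrased after splitting the edge index and the vertex index, so that each case
    -- refers to a single one of the two hypergraphs.
    CoalescedMember : Fin (suc (a + b)) → Fin (sizeʳ G) ⊎ Fin (sizeʳ H) → Set
    CoalescedMember zero    (inj₁ e) = zero ∈ edgeʳ G e
    CoalescedMember zero    (inj₂ e) = zero ∈ edgeʳ H e
    CoalescedMember (suc x) (inj₁ e) = [ (λ i → suc i ∈ edgeʳ G e) , const ⊥ ]′ (splitAt a x)
    CoalescedMember (suc x) (inj₂ e) = [ const ⊥ , (λ i → suc i ∈ edgeʳ H e) ]′ (splitAt a x)

    coalesce-∈ : ∀ v e → v ∈ edgeʳ GH e ⇔ CoalescedMember v (splitAt (sizeʳ G) e)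
    coalesce-∈ v e with splitAt (sizeʳ G) e
    coalesce-∈ zero e | inj₁ f with edgeʳ G f
    ... | s ∷ S = mk⇔ (λ { here → here }) (λ { here → here })
    coalesce-∈ zero e | inj₂ f with edgeʳ H f
    ... | s ∷ S = mk⇔ (λ { here → here }) (λ { here → here })
    coalesce-∈ (suc x) e | inj₁ f with edgeʳ G f
    ... | s ∷ S with splitAt a x | ∈-++ S (⊥ˢ {b}) x
    ...   | inj₁ i | eq = mk⇔ (there ∘ to eq ∘ drop-there) (there ∘ from eq ∘ drop-there)
    ...   | inj₂ i | eq = mk⇔ (∉⊥ ∘ to eq ∘ drop-there) ⊥-elim
    coalesce-∈ (suc x) e | inj₂ f with edgeʳ H f
    ... | s ∷ S with splitAt a x | ∈-++ (⊥ˢ {a}) S x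
    ...   | inj₁ i | eq = mk⇔ (∉⊥ ∘ to eq ∘ drop-there) ⊥-elim
    ...   | inj₂ i | eq = mk⇔ (there ∘ to eq ∘ drop-there) (there ∘ from eq ∘ drop-there)

    coalesce-uniform : ∀ {k} → Uniform k (forget G) → Uniform k (forget H) → Uniform k (forget GH)
    coalesce-uniform uG uH e with splitAt (sizeʳ G) e
    coalesce-uniform uG uH e | inj₁ f with edgeʳ G f | uG f
    ... | inside ∷ S  | u = trans (cong suc (trans (∣++∣ S _) (trans (cong (∣ S ∣ +_) (∣⊥∣≡0 b)) (ℕ.+-identityʳ _)))) u
    ... | outside ∷ S | u = trans (∣++∣ S _) (trans (cong (∣ S ∣ +_) (∣⊥∣≡0 b)) (trans (ℕ.+-identityʳ _) u))
    coalesce-uniform uG uH e | inj₂ f with edgeʳ H f | uH f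
    ... | inside ∷ S  | u = trans (cong suc (trans (∣++∣ (⊥ˢ {a}) S) (cong (_+ ∣ S ∣) (∣⊥∣≡0 a)))) u
    ... | outside ∷ S | u = trans (∣++∣ (⊥ˢ {a}) S) (trans (cong (_+ ∣ S ∣) (∣⊥∣≡0 a)) u)

    coalesce-layered : Layered G → Layered H → Layered GH
    coalesce-layered LG LH = record
      { gate = gate′ ; parent = parent′ ; rank = rank′ ; member = member′ ; rank-< = rank-<′ }
      where
      module G = Layered LG
      module H = Layered LH

      left : Fin (suc a) → Fin (suc (a + b))
      left zero    = zero
      left (suc i) = suc (i ↑ˡ b)

      right : Fin (suc b) → Fin (suc (a + b))
      right zero    = zero
      right (suc i) = suc (a ↑ʳ i)

      gate′ : E′ → Fin (suc (a + b))
      gate′ e = [ left ∘ G.gate , right ∘ H.gate ]′ (splitAt (sizeʳ G) e)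

      parent′ : Fin (a + b) → E′
      parent′ x = [ (λ i → G.parent i ↑ˡ sizeʳ H) , (λ i → sizeʳ G ↑ʳ H.parent i) ]′ (splitAt a x)

      rank′ : Fin (suc (a + b)) → ℕ
      -- The two roots may carry different ranks. Zero is at most either of them, and lowering the
      -- rank of a root keeps all inequalities between a gate and the vertices below it.
      rank′ zero    = 0
      rank′ (suc x) = [ G.rank ∘ suc , H.rank ∘ suc ]′ (splitAt a x)

      left-zero : ∀ v → left v ≡ zero → v ≡ zero
      left-zero zero _ = refl

      right-zero : ∀ v → right v ≡ zero → v ≡ zero
      right-zero zero _ = refl

      left-suc : ∀ v x → left v ≡ suc x → ∃[ i ] (v ≡ suc i × splitAt a x ≡ inj₁ i)
      left-suc (suc i) _ refl = i , refl , splitAt-↑ˡ a i b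

      right-suc : ∀ v x → right v ≡ suc x → ∃[ i ] (v ≡ suc i × splitAt a x ≡ inj₂ i)
      right-suc (suc i) _ refl = i , refl , splitAt-↑ʳ a b i

      Holds : Fin (suc (a + b)) → E′ → Set
      Holds v e = HangsBelow parent′ v e ⊎ gate′ e ≡ v

      fill : ∀ v e → CoalescedMember v (splitAt (sizeʳ G) e) → Holds v e
      fill zero e m with splitAt (sizeʳ G) e
      ... | inj₁ f = inj₂ ([ (λ ()) , cong left ]′ (to (G.member _ f) m))
      ... | inj₂ f = inj₂ ([ (λ ()) , cong right ]′ (to (H.member _ f) m))
      fill (suc x) e m with splitAt (sizeʳ G) e in split
      fill (suc x) e m | inj₁ f with splitAt a x in splitˣ
      ... | inj₁ i = Sum.map (λ { refl → splitAt⁻¹-↑ˡ split })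
        (λ g≡ → trans (cong left g≡) (cong suc (splitAt⁻¹-↑ˡ splitˣ))) (to (G.member _ f) m)
      fill (suc x) e m | inj₂ f with splitAt a x in splitˣ
      ... | inj₂ i = Sum.map (λ { refl → splitAt⁻¹-↑ʳ split })
        (λ g≡ → trans (cong right g≡) (cong suc (splitAt⁻¹-↑ʳ splitˣ))) (to (H.member _ f) m)

      unfill : ∀ v e → Holds v e → CoalescedMember v (splitAt (sizeʳ G) e)
      unfill zero e (inj₂ g≡) with splitAt (sizeʳ G) e
      ... | inj₁ f = from (G.member _ f) (inj₂ (left-zero _ g≡))
      ... | inj₂ f = from (H.member _ f) (inj₂ (right-zero _ g≡))
      unfill (suc x) e (inj₁ refl) with splitAt a x in split
      ... | inj₁ i rewrite splitAt-↑ˡ (sizeʳ G) (G.parent i) (sizeʳ H) | split = from (G.member _ _) (inj₁ refl)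
      ... | inj₂ i rewrite splitAt-↑ʳ (sizeʳ G) (sizeʳ H) (H.parent i) | split = from (H.member _ _) (inj₁ refl)
      unfill (suc x) e (inj₂ g≡) with splitAt (sizeʳ G) e
      unfill (suc x) e (inj₂ g≡) | inj₁ f with left-suc _ x g≡
      ... | i , g≡′ , eq rewrite eq = from (G.member _ f) (inj₂ g≡′)
      unfill (suc x) e (inj₂ g≡) | inj₂ f with right-suc _ x g≡
      ... | i , g≡′ , eq rewrite eq = from (H.member _ f) (inj₂ g≡′)

      member′ : ∀ v e → v ∈ edgeʳ GH e ⇔ Holds v e
      member′ v e = mk⇔ (fill v e) (unfill v e) ⇔-∘ coalesce-∈ v e

      rank-left : ∀ v → rank′ (left v) ≤ G.rank v
      rank-left zero    = z≤n
      rank-left (suc i) rewrite splitAt-↑ˡ a i b = ℕ.≤-refl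

      rank-right : ∀ v → rank′ (right v) ≤ H.rank v
      rank-right zero    = z≤n
      rank-right (suc i) rewrite splitAt-↑ʳ a b i = ℕ.≤-refl

      rank-<′ : ∀ x → rank′ (gate′ (parent′ x)) < rank′ (suc x)
      rank-<′ x with splitAt a x
      ... | inj₁ i rewrite splitAt-↑ˡ (sizeʳ G) (G.parent i) (sizeʳ H) =
        ℕ.≤-<-trans (rank-left _) (G.rank-< i)
      ... | inj₂ i rewrite splitAt-↑ʳ (sizeʳ G) (sizeʳ H) (H.parent i) =
        ℕ.≤-<-trans (rank-right _) (H.rank-< i)

    coalesce-star : Star-like G → Star-like H → Star-like GH
    coalesce-star sG sH e = from (coalesce-∈ zero e) (root∈ (splitAt (sizeʳ G) e))
      where
      root∈ : ∀ x → CoalescedMember zero x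
      root∈ (inj₁ f) = sG f
      root∈ (inj₂ f) = sH f

    coalesce-broomˡ : Broom-like G → Star-like H → Broom-like GH
    coalesce-broomˡ (f , ∉f , rest) sH =
      f ↑ˡ sizeʳ H ,
      (λ z∈ → ∉f (subst (CoalescedMember zero) (splitAt-↑ˡ _ f (sizeʳ H)) (to (coalesce-∈ zero _) z∈))) ,
      λ e e≢ → from (coalesce-∈ zero e) (root∈ e e≢)
      where
      root∈ : ∀ e → e ≢ f ↑ˡ sizeʳ H → CoalescedMember zero (splitAt (sizeʳ G) e)
      root∈ e e≢ with splitAt (sizeʳ G) e in split
      ... | inj₁ g = rest g λ { refl → e≢ (sym (splitAt⁻¹-↑ˡ split)) }
      ... | inj₂ g = sH g

    coalesce-broomʳ : Star-like G → Broom-like H → Broom-like GH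
    coalesce-broomʳ sG (f , ∉f , rest) =
      sizeʳ G ↑ʳ f ,
      (λ z∈ → ∉f (subst (CoalescedMember zero) (splitAt-↑ʳ (sizeʳ G) _ f) (to (coalesce-∈ zero _) z∈))) ,
      λ e e≢ → from (coalesce-∈ zero e) (root∈ e e≢)
      where
      root∈ : ∀ e → e ≢ sizeʳ G ↑ʳ f → CoalescedMember zero (splitAt (sizeʳ G) e)
      root∈ e e≢ with splitAt (sizeʳ G) e in split
      ... | inj₁ g = sG g
      ... | inj₂ g = rest g λ { refl → e≢ (sym (splitAt⁻¹-↑ʳ split)) }

  -- The hyperstar and the candidate for the second last place.

  starʳ broomʳ : ℕ → ℕ → Rooted
  starʳ k p = List.foldr (λ n G → coalesce (hyperpath k n) G) single (replicate p 1)
  broomʳ k p = coalesce (hyperpath k 1) (coalesce (hyperpath k 2) (starʳ k p))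

  starlike-layered : ∀ k ns → Layered (List.foldr (λ n G → coalesce (hyperpath k n) G) single ns)
  starlike-layered k []       = single-layered
  starlike-layered k (n ∷ ns) = coalesce-layered _ _ (hyperpath-layered k n) (starlike-layered k ns)

  starlike-uniform : ∀ k ns → Uniform (2 + k) (starlike (2 + k) ns)
  starlike-uniform k []       ()
  starlike-uniform k (n ∷ ns) = coalesce-uniform (hyperpath (2 + k) n) _ (hyperpath-uniform k n) (starlike-uniform k ns)

  starlike-class : ∀ k {m} ns → size (starlike (2 + k) ns) ≡ m → UniformHypertree (2 + k) m (starlike (2 + k) ns)
  starlike-class k ns size≡ = starlike-uniform k ns , (layered-connected L , layered-acyclic L) , size≡
    where L = starlike-layered (2 + k) ns

  size-starʳ : ∀ k p → Rooted.sizeʳ (starʳ k p) ≡ p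
  size-starʳ k zero    = refl
  size-starʳ k (suc p) = cong suc (size-starʳ k p)

  single-edge-star : ∀ k → Star-like (hyperpath k 1)
  single-edge-star k zero = here

  starʳ-star : ∀ k p → Star-like (starʳ k p)
  starʳ-star k zero    ()
  starʳ-star k (suc p) = coalesce-star (hyperpath k 1) (starʳ k p) (single-edge-star k) (starʳ-star k p)

  -- The edge that misses the root is the outer edge of the hyperpath of length two.
  broomʳ-broom : ∀ k p → Broom-like (broomʳ k p)
  broomʳ-broom k p = coalesce-broomʳ (hyperpath k 1) _ (single-edge-star k)
    (coalesce-broomˡ (hyperpath k 2) (starʳ k p) path-broom (starʳ-star k p))
    where
    path-broom : Broom-like (hyperpath k 2)
    path-broom = suc zero , (λ ()) , λ
      { zero       _  → here
      ; (suc zero) ≢1 → contradiction refl ≢1 }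

  -- Degrees, excesses and their squares.

  another : ∀ {n} → 2 ≤ n → (v : Fin n) → ∃[ w ] v ≢ w
  another {suc (suc n)} _ zero    = suc zero , λ ()
  another {suc (suc n)} _ (suc v) = zero , λ ()
  another {suc zero} (s≤s ()) _

  degree-all-but-one : ∀ H {v f} → v ∉ edge H f → (∀ e → e ≢ f → v ∈ edge H e) → suc (degree H v) ≡ size H
  degree-all-but-one H {v} {f} v∉ rest = begin
    suc (degree H v)
      ≡⟨ cong₂ _+_ (sum-𝟙≟ f) (sym (degree-sum H v)) ⟨
    sum (λ e → 𝟙 (f ≟ᶠ e)) + sum (λ e → 𝟙 (v ∈? edge H e))
      ≡⟨ ∑-distrib-+ (λ e → 𝟙 (f ≟ᶠ e)) (λ e → 𝟙 (v ∈? edge H e)) ⟨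
    sum (λ e → 𝟙 (f ≟ᶠ e) + 𝟙 (v ∈? edge H e))
      ≡⟨ sum-cong-≗ one ⟩
    sum {size H} (λ _ → 1)
      ≡⟨ trans (sum-const (size H) 1) (ℕ.*-identityʳ _) ⟩
    size H ∎
    where
    open ≡-Reasoning
    one : ∀ e → 𝟙 (f ≟ᶠ e) + 𝟙 (v ∈? edge H e) ≡ 1
    one e with f ≟ᶠ e
    ... | yes refl = cong suc (𝟙-no (v ∈? edge H f) v∉)
    ... | no f≢e   = 𝟙-yes (v ∈? edge H e) (rest e (f≢e ∘ sym))

  degree≤size : ∀ H v → degree H v ≤ size H
  degree≤size H v = subst (_≤ size H) (sym (degree-sum H v)) (sum-𝟙≤ (λ e → v ∈? edge H e))

  full-degree : ∀ H {v} → degree H v ≡ size H → ∀ e → v ∈ edge H e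
  full-degree H {v} eq = sum-𝟙≡n⇒all (λ e → v ∈? edge H e) (trans (sym (degree-sum H v)) eq)

  degree-full : ∀ H {v} → (∀ e → v ∈ edge H e) → degree H v ≡ size H
  degree-full H {v} all∈ = trans (degree-sum H v)
    (trans (sum-cong-≗ (λ e → 𝟙-yes (v ∈? edge H e) (all∈ e)))
      (trans (sum-const (size H) 1) (ℕ.*-identityʳ _)))

  near-full-degree : ∀ H {v} → suc (degree H v) ≡ size H →
    ∃[ f ] (v ∉ edge H f × ∀ e → e ≢ f → v ∈ edge H e)
  near-full-degree H {v} eq =
    sum-𝟙-all-but-one (λ e → v ∈? edge H e) (trans (cong suc (sym (degree-sum H v))) eq)

  squares : Hypergraph → ℕ
  squares H = sum (λ v → degree H v * degree H v)

  excess : (H : Hypergraph) → Fin (order H) → ℕ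
  excess H v = pred (degree H v)

  excess² : Hypergraph → ℕ
  excess² H = sum (λ v → excess H v * excess H v)

  sum-degree : ∀ {k} H → Uniform k H → sum (degree H) ≡ size H * k
  sum-degree {k} H uniform = begin
    sum (degree H)
      ≡⟨ sum-cong-≗ (degree-sum H) ⟩
    sum (λ v → sum (λ e → 𝟙 (v ∈? edge H e)))
      ≡⟨ ∑-comm (λ v e → 𝟙 (v ∈? edge H e)) ⟩
    sum (λ e → sum (λ v → 𝟙 (v ∈? edge H e)))
      ≡⟨ sum-cong-≗ (λ e → trans (sym (∣∣-sum (edge H e))) (uniform e)) ⟩
    sum {size H} (λ _ → k)
      ≡⟨ sum-const (size H) k ⟩
    size H * k ∎
    where open ≡-Reasoning

  module HypertreeProperties {k m : ℕ} (H : Hypergraph) (C : UniformHypertree (2 + k) (suc m) H) where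
    private
      uniform   = proj₁ C
      connected = proj₁ (proj₁ (proj₂ C))
      acyclic   = proj₂ (proj₁ (proj₂ C))
      size≡     = proj₂ (proj₂ C)

      vertexOf : ∀ e → ∃[ v ] v ∈ edge H e
      vertexOf e = sum-𝟙-positive (λ v → v ∈? edge H e)
        (subst (1 ≤_) (trans (sym (uniform e)) (∣∣-sum (edge H e))) (s≤s z≤n))

    abstract
      rootAt : ∀ r → Rooting H r
      rootAt = rooting H connected acyclic vertexOf

    private
      some-vertex : Fin (order H)
      some-vertex = proj₁ (vertexOf (subst Fin (sym size≡) zero))

    order≡ : order H ≡ suc (suc m * suc k)
    order≡ = trans (Rooted-counting.order≡ H (rootAt some-vertex) uniform) (cong (λ s → suc (s * suc k)) size≡)

    -- No vertex is isolated: rooted at some other vertex, the hypertree gives `v` a parent. So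
    -- `pred` in `excess` loses nothing.
    suc-excess : ∀ v → suc (excess H v) ≡ degree H v
    suc-excess v with another (subst (2 ≤_) (sym order≡) (s≤s (s≤s z≤n))) v
    ... | w , v≢w rewrite Rooted-counting.degree-nonroot H (rootAt w) v v≢w = refl

    -- With m + 1 edges, the degrees add up to (m+1)(k+2) and there are 1 + (m+1)(k+1) vertices; the
    -- difference is free of k.
    sum-excess : sum (excess H) ≡ m
    sum-excess = ℕ.suc-injective (ℕ.+-cancelʳ-≡ (suc m * suc k) _ _ (begin
      suc (sum (excess H)) + suc m * suc k
        ≡⟨ ℕ.+-suc (sum (excess H)) _ ⟨
      sum (excess H) + suc (suc m * suc k)
        ≡⟨ ℕ.+-comm _ (sum (excess H)) ⟨
      suc (suc m * suc k) + sum (excess H)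
        ≡⟨ cong (_+ sum (excess H)) (trans (sum-const (order H) 1) (trans (ℕ.*-identityʳ _) order≡)) ⟨
      sum {order H} (λ _ → 1) + sum (excess H)
        ≡⟨ ∑-distrib-+ (λ _ → 1) (excess H) ⟨
      sum (λ v → suc (excess H v))
        ≡⟨ sum-cong-≗ suc-excess ⟩
      sum (degree H)
        ≡⟨ sum-degree H uniform ⟩
      size H * (2 + k)
        ≡⟨ cong (_* (2 + k)) size≡ ⟩
      suc m * (2 + k)
        ≡⟨ ℕ.*-suc (suc m) (suc k) ⟩
      suc m + suc m * suc k ∎))
      where open ≡-Reasoning

    squares≡ : squares H ≡ excess² H + ((m + m) + suc (suc m * suc k))
    squares≡ = begin
      sum (λ v → degree H v * degree H v)
        ≡⟨ sum-cong-≗ (λ v → trans (cong₂ _*_ (sym (suc-excess v)) (sym (suc-excess v))) (square (excess H v))) ⟩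
      sum (λ v → x v * x v + ((x v + x v) + 1))
        ≡⟨ ∑-distrib-+ (λ v → x v * x v) (λ v → (x v + x v) + 1) ⟩
      excess² H + sum (λ v → (x v + x v) + 1)
        ≡⟨ cong (excess² H +_) (∑-distrib-+ (λ v → x v + x v) (λ _ → 1)) ⟩
      excess² H + (sum (λ v → x v + x v) + sum {order H} (λ _ → 1))
        ≡⟨ cong (excess² H +_) (cong₂ _+_
             (trans (∑-distrib-+ x x) (cong₂ _+_ sum-excess sum-excess))
             (trans (sum-const (order H) 1) (trans (ℕ.*-identityʳ _) order≡))) ⟩
      excess² H + ((m + m) + suc (suc m * suc k)) ∎
      where
      open ≡-Reasoning
      x = excess H
      square : ∀ x → suc x * suc x ≡ x * x + ((x + x) + 1)
      square = solve-∀

    -- One factor of each square is replaced by its bound `b`, the other ones add up to `m`.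
    excess²-upper : ∀ b → (∀ v → degree H v ≤ suc b) → excess² H ≤ b * m
    excess²-upper b d≤ = begin
      sum (λ v → excess H v * excess H v)
        ≤⟨ sum-mono-≤ (λ v → ℕ.*-monoˡ-≤ (excess H v) (ℕ.pred-mono-≤ (d≤ v))) ⟩
      sum (λ v → b * excess H v)
        ≡⟨ *-distribˡ-sum b (excess H) ⟨
      b * sum (excess H)
        ≡⟨ cong (b *_) sum-excess ⟩
      b * m ∎
      where open ℕ.≤-Reasoning

    excess²-star : ∀ v → degree H v ≡ suc m → m * m ≤ excess² H
    excess²-star v d≡ = subst (_≤ excess² H) (cong (λ d → pred d * pred d) d≡)
      (term≤sum (λ v → excess H v * excess H v) v)

    -- The edge f missing v has a gate, which is a second vertex of degree at least 2.
    excess²-broom : ∀ {v f} → v ∉ edge H f → (∀ e → e ≢ f → v ∈ edge H e) → pred m * pred m + 1 ≤ excess² H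
    excess²-broom {v} {f} v∉ rest = begin
      pred m * pred m + 1
        ≤⟨ ℕ.+-mono-≤ (ℕ.≤-reflexive (cong (λ d → d * d) (sym excess-v))) (ℕ.*-mono-≤ 1≤excess 1≤excess) ⟩
      excess H v * excess H v + excess H (gate f) * excess H (gate f)
        ≤⟨ terms≤sum (λ v → excess H v * excess H v) v≢gate ⟩
      excess² H ∎
      where
      open ℕ.≤-Reasoning
      R = rootAt v
      open Rooting R
      open Rooted-counting H R

      v≢gate : v ≢ gate f
      v≢gate eq = v∉ (from (member v f) (inj₂ (sym eq)))

      excess-v : excess H v ≡ pred m
      excess-v = cong (pred ∘ pred) (trans (degree-all-but-one H v∉ rest) size≡)

      1≤excess : 1 ≤ excess H (gate f)
      1≤excess rewrite degree-nonroot (gate f) (v≢gate ∘ sym) =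
        ℕ.≤-trans (ℕ.≤-reflexive (sym (𝟙-yes (gate f ≟ᶠ gate f) refl)))
          (term≤sum (λ e → 𝟙 (gate e ≟ᶠ gate f)) f)

  squares-< : ∀ {k m} H G → UniformHypertree (2 + k) (suc m) H → UniformHypertree (2 + k) (suc m) G →
    excess² H < excess² G → squares H < squares G
  squares-< {k} {m} H G CH CG H<G = subst₂ _<_
    (sym (HypertreeProperties.squares≡ H CH)) (sym (HypertreeProperties.squares≡ G CG))
    (ℕ.+-monoˡ-< ((m + m) + suc (suc m * suc k)) H<G)

  star-≅ : ∀ {k m} H G → UniformHypertree (2 + k) (suc m) H → UniformHypertree (2 + k) (suc m) G → ∀ {u v} →
    (∀ e → u ∈ edge H e) → (∀ e → v ∈ edge G e) → H ≅ G
  star-≅ H G CH CG {u} {v} = star-iso H G (HypertreeProperties.rootAt H CH u) (HypertreeProperties.rootAt G CG v)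
    (proj₁ CH) (proj₁ CG) (trans (proj₂ (proj₂ CH)) (sym (proj₂ (proj₂ CG))))

  broom-≅ : ∀ {k m} H G → UniformHypertree (2 + k) (suc m) H → UniformHypertree (2 + k) (suc m) G → ∀ {u v f g} →
    u ∉ edge H f → (∀ e → e ≢ f → u ∈ edge H e) → v ∉ edge G g → (∀ e → e ≢ g → v ∈ edge G e) → H ≅ G
  broom-≅ H G CH CG {u} {v} = broom-iso H G (HypertreeProperties.rootAt H CH u) (HypertreeProperties.rootAt G CG v)
    (proj₁ CH) (proj₁ CG) (trans (proj₂ (proj₂ CH)) (sym (proj₂ (proj₂ CG))))

  -- Extremality of the star and the broom for the sum of squared degrees, with m = 3 + p.

  module Extremal (k p : ℕ) {star broom : Hypergraph}
    (star-class : UniformHypertree (2 + k) (3 + p) star) (broom-class : UniformHypertree (2 + k) (3 + p) broom)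
    {c : Fin (order star)} (star-center : ∀ e → c ∈ edge star e)
    {r : Fin (order broom)} {f : Fin (size broom)} (r∉f : r ∉ edge broom f)
    (broom-center : ∀ e → e ≢ f → r ∈ edge broom e) where

    private
      Class : Hypergraph → Set
      Class = UniformHypertree (2 + k) (3 + p)

      degree≢ : ∀ {H} → Class H → ¬ (H ≅ star) → ∀ v → degree H v ≢ 3 + p
      degree≢ {H} CH H≇ v eq = H≇ (star-≅ H star CH star-class
        (full-degree H (trans eq (sym (proj₂ (proj₂ CH))))) star-center)

      degree≤ : ∀ {H} → Class H → ∀ v → degree H v ≤ 3 + p
      degree≤ {H} CH v = subst (degree H v ≤_) (proj₂ (proj₂ CH)) (degree≤size H v)

      degree≢′ : ∀ {H} → Class H → ¬ (H ≅ broom) → ∀ v → degree H v ≢ 2 + p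
      degree≢′ {H} CH H≇ v eq with near-full-degree H {v} (trans (cong suc eq) (sym (proj₂ (proj₂ CH))))
      ... | f , v∉ , rest = H≇ (broom-≅ H broom CH broom-class v∉ rest r∉f broom-center)

      ≤∧≢⇒≤ : ∀ {a b} → a ≤ suc b → a ≢ suc b → a ≤ b
      ≤∧≢⇒≤ a≤ a≢ = ℕ.≤-pred (ℕ.≤∧≢⇒< a≤ a≢)

      expand : ∀ p → p * (2 + p) + 2 ≡ suc p * suc p + 1
      expand = solve-∀

    squares-star : ∀ H → Class H → ¬ (H ≅ star) → squares H < squares star
    squares-star H CH H≇ = squares-< H star CH star-class (begin-strict
      excess² H            ≤⟨ HypertreeProperties.excess²-upper H CH (suc p)
                                (λ v → ≤∧≢⇒≤ (degree≤ CH v) (degree≢ CH H≇ v)) ⟩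
      suc p * (2 + p)      <⟨ ℕ.*-monoˡ-< (2 + p) (ℕ.n<1+n (suc p)) ⟩
      (2 + p) * (2 + p)    ≤⟨ HypertreeProperties.excess²-star star star-class c
                                (trans (degree-full star star-center) (proj₂ (proj₂ star-class))) ⟩
      excess² star         ∎)
      where open ℕ.≤-Reasoning

    squares-broom : ∀ H → Class H → ¬ (H ≅ broom) → ¬ (H ≅ star) → squares H < squares broom
    squares-broom H CH H≇broom H≇star = squares-< H broom CH broom-class (begin-strict
      excess² H            ≤⟨ HypertreeProperties.excess²-upper H CH p (λ v → ≤∧≢⇒≤
                                (≤∧≢⇒≤ (degree≤ CH v) (degree≢ CH H≇star v)) (degree≢′ CH H≇broom v)) ⟩
      -- The 2 is the exact gap: excluding degrees m and m - 1 bounds the excesses by p, while the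
      -- broom reaches (p+1)² + 1 = p(p+2) + 2.
      p * (2 + p)          <⟨ ℕ.m<m+n (p * (2 + p)) {2} (s≤s z≤n) ⟩
      p * (2 + p) + 2      ≡⟨ expand p ⟩
      suc p * suc p + 1    ≤⟨ HypertreeProperties.excess²-broom broom broom-class r∉f broom-center ⟩
      excess² broom        ∎)
      where open ℕ.≤-Reasoning

    -- An isomorphism would pull the centre back to a vertex lying in all edges. It is not `r`, and
    -- its excess together with that of `r` exceeds the total excess.
    broom≇star : ¬ (broom ≅ star)
    broom≇star iso = ℕ.<-irrefl (sym (HypertreeProperties.sum-excess broom broom-class)) (begin-strict
      2 + p                                       <⟨ ℕ.m<n+m (2 + p) {suc p} (s≤s z≤n) ⟩
      suc p + (2 + p)                             ≡⟨ cong₂ _+_ (sym excess-root) (sym excess-center) ⟩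
      excess broom r + excess broom center        ≤⟨ terms≤sum (excess broom) root≢center ⟩
      sum (excess broom)                          ∎)
      where
      open ℕ.≤-Reasoning
      open _≅_ iso
      center : Fin (order broom)
      center = vertices ⟨$⟩ˡ c

      center∈ : ∀ e → center ∈ edge broom e
      center∈ e = from (incidence center e)
        (subst (_∈ edge star (edges ⟨$⟩ʳ e)) (sym (inverseʳ vertices)) (star-center (edges ⟨$⟩ʳ e)))

      root≢center : r ≢ center
      root≢center eq = r∉f (subst (_∈ edge broom f) (sym eq) (center∈ f))

      excess-root : excess broom r ≡ suc p
      excess-root = cong (pred ∘ pred) (trans (degree-all-but-one broom r∉f broom-center) (proj₂ (proj₂ broom-class)))

      excess-center : excess broom center ≡ 2 + p
      excess-center = cong pred (trans (degree-full broom center∈) (proj₂ (proj₂ broom-class)))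

-- Evaluation of the trace formula.

module Traces where
  open Hypertrees
  open import Algebra.Bundles using (CommutativeMonoid; Semiring; CommutativeRing)
  import Algebra.Properties.Semiring.Sum ℕ.+-*-semiring as Σℕ
  open Σℕ using (sum; sum-cong-≗)
  open import Data.Bool.Base using (true; false; if_then_else_)
  open import Data.Fin.Base using (Fin; zero; suc)
  open import Data.Fin.Properties using (suc-injective) renaming (_≟_ to _≟ᶠ_)
  open import Data.Fin.Subset using (Subset; ∣_∣; ⋃; ⁅_⁆) renaming (_∈_ to _∈ˢ_; _⊆_ to _⊆ˢ_)
  open import Data.Fin.Subset.Properties using (_∈?_; x∈p∪q⁻; x∈p∪q⁺; x∈⁅x⁆; x∈⁅y⁆⇒x≡y; ∉⊥; ⊆-antisym; p⊂q⇒∣p∣<∣q∣)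
  open import Data.List.Base as List using (List; []; _∷_; _++_; map; concatMap; foldr; allFin; upTo)
  open import Data.List.Membership.Propositional using (_∈_)
  open import Data.List.Membership.Propositional.Properties using (∈-allFin; ∈-++⁺ˡ; ∈-++⁺ʳ; ∈-++⁻)
  open import Data.List.Properties using (map-tabulate; ++-identityʳ)
  open import Data.List.Relation.Binary.Permutation.Propositional using (_↭_; ↭-refl; ↭-trans; ↭-sym; prep; swap; ↭-reflexive)
  open import Data.List.Relation.Binary.Permutation.Propositional.Properties using (∈-resp-↭; Any-resp-↭; ++⁺ˡ; shift)
  open import Data.List.Relation.Unary.All as All using (All; []; _∷_)
  open import Data.List.Relation.Unary.All.Properties as All using ()
  open import Data.List.Relation.Unary.AllPairs using ([]; _∷_)
  open import Data.List.Relation.Unary.Any using (Any; here; there)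
  open import Data.List.Relation.Unary.Unique.Propositional using (Unique)
  open import Data.List.Relation.Unary.Unique.Propositional.Properties using (allFin⁺)
  open import Data.Nat.Base as ℕ using (ℕ; zero; suc; _∸_; _!)
  open import Data.Nat.Tactic.RingSolver using (solve-∀)
  open import Data.Product.Base using (∃-syntax; _×_; _,_; proj₁; proj₂; map₂)
  open import Data.Product.Properties using (,-injectiveˡ; ,-injectiveʳ) renaming (≡-dec to ×-≡-dec)
  open import Data.Sum.Base using (_⊎_; inj₁; inj₂)
  open import Data.Vec.Base as Vec using (Vec; []; _∷_; replicate; lookup)
  open import Data.Vec.Properties using (∷-injectiveˡ; ∷-injectiveʳ) renaming (≡-dec to Vec-≡-dec)
  import Data.Vec.Relation.Unary.All as VecAll
  open import Function.Base using (_∘_; id)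
  open import Level using (Level)
  open import Relation.Binary.Definitions using (DecidableEquality)
  open import Relation.Binary.PropositionalEquality as ≡ using (_≡_; _≢_)
  open import Relation.Nullary.Decidable using (Dec; yes; no; does; dec-true; dec-false; _⊎-dec_)
  open import Relation.Nullary.Negation using (¬_; contradiction)

  -- Each unordered pair of distinct indices occurs once, smaller index first.
  pairs : ∀ n → List (Fin n × Fin n)
  pairs zero    = []
  pairs (suc n) = map (λ j → zero , suc j) (allFin n) ++ map (λ (i , j) → suc i , suc j) (pairs n)

  pairs-≢ : ∀ n → All (λ (i , j) → i ≢ j) (pairs n)
  pairs-≢ zero    = []
  pairs-≢ (suc n) = All.++⁺ (All.map⁺ (All.universal (λ _ ()) (allFin n)))
    (All.map⁺ (All.map (λ i≢j → i≢j ∘ suc-injective) (pairs-≢ n)))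

  point : ∀ {n} → ℕ → Fin n → Vec ℕ n
  point a zero    = a ∷ replicate _ 0
  point a (suc i) = 0 ∷ point a i

  -- Meant for distinct indices; the value at (zero , zero) is junk.
  points : ∀ {n} → Fin n × Fin n → Vec ℕ n
  points (zero  , zero)  = replicate _ 0
  points (zero  , suc j) = 1 ∷ point 1 j
  points (suc i , zero)  = 1 ∷ point 1 i
  points (suc i , suc j) = 0 ∷ points (i , j)

  -- Sums over lists in a semiring, applied both to the field and to ℕ.

  module ListSum {c ℓ} (S : Semiring c ℓ) where
    open Semiring S hiding (zero)
    open import Relation.Binary.Reasoning.Setoid setoid
    open import Algebra.Properties.CommutativeSemigroup (CommutativeMonoid.commutativeSemigroup +-commutativeMonoid) using (interchange)

    private variable
      a : Level
      A B : Set a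

    ∑ : List A → (A → Carrier) → Carrier
    ∑ xs f = foldr (λ x s → f x + s) 0# xs

    ∑-cong-∈ : (xs : List A) {f g : A → Carrier} → (∀ {x} → x ∈ xs → f x ≈ g x) → ∑ xs f ≈ ∑ xs g
    ∑-cong-∈ []       f≈g = refl
    ∑-cong-∈ (x ∷ xs) f≈g = +-cong (f≈g (here ≡.refl)) (∑-cong-∈ xs (f≈g ∘ there))

    ∑-cong : (xs : List A) {f g : A → Carrier} → (∀ x → f x ≈ g x) → ∑ xs f ≈ ∑ xs g
    ∑-cong xs f≈g = ∑-cong-∈ xs (λ {x} _ → f≈g x)

    ∑-zero : (xs : List A) {f : A → Carrier} → (∀ {x} → x ∈ xs → f x ≈ 0#) → ∑ xs f ≈ 0#
    ∑-zero []       f≈0 = refl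
    ∑-zero (x ∷ xs) f≈0 = trans (+-cong (f≈0 (here ≡.refl)) (∑-zero xs (f≈0 ∘ there))) (+-identityˡ 0#)

    ∑-++ : (xs ys : List A) (f : A → Carrier) → ∑ (xs ++ ys) f ≈ ∑ xs f + ∑ ys f
    ∑-++ []       ys f = sym (+-identityˡ _)
    ∑-++ (x ∷ xs) ys f = trans (+-congˡ (∑-++ xs ys f)) (sym (+-assoc _ _ _))

    ∑-map : (g : A → B) (xs : List A) (f : B → Carrier) → ∑ (map g xs) f ≡ ∑ xs (f ∘ g)
    ∑-map g []       f = ≡.refl
    ∑-map g (x ∷ xs) f = ≡.cong (f (g x) +_) (∑-map g xs f)

    ∑-concatMap : (g : A → List B) (xs : List A) (f : B → Carrier) →
      ∑ (concatMap g xs) f ≈ ∑ xs (λ x → ∑ (g x) f)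
    ∑-concatMap g []       f = refl
    ∑-concatMap g (x ∷ xs) f = trans (∑-++ (g x) _ f) (+-congˡ (∑-concatMap g xs f))

    ∑-distrib-+ : (xs : List A) (f g : A → Carrier) → ∑ xs (λ x → f x + g x) ≈ ∑ xs f + ∑ xs g
    ∑-distrib-+ []       f g = sym (+-identityˡ 0#)
    ∑-distrib-+ (x ∷ xs) f g = trans (+-congˡ (∑-distrib-+ xs f g)) (interchange _ _ _ _)

    ∑-comm : (xs : List A) (ys : List B) (f : A → B → Carrier) →
      ∑ xs (λ x → ∑ ys (f x)) ≈ ∑ ys (λ y → ∑ xs (λ x → f x y))
    ∑-comm []       ys f = sym (∑-zero ys (λ _ → refl))
    ∑-comm (x ∷ xs) ys f = trans (+-congˡ (∑-comm xs ys f)) (sym (∑-distrib-+ ys (f x) _))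

    *-distribˡ-∑ : ∀ a (xs : List A) (f : A → Carrier) → a * ∑ xs f ≈ ∑ xs (λ x → a * f x)
    *-distribˡ-∑ a []       f = zeroʳ a
    *-distribˡ-∑ a (x ∷ xs) f = trans (distribˡ a _ _) (+-congˡ (*-distribˡ-∑ a xs f))

    ∑-single : {xs : List A} {x : A} (f : A → Carrier) → Unique xs → x ∈ xs →
      (∀ {y} → y ≢ x → f y ≈ 0#) → ∑ xs f ≈ f x
    ∑-single {xs = y ∷ xs} f (y∉ ∷ _) (here ≡.refl) f≈0 =
      trans (+-congˡ (∑-zero xs (λ z∈ → f≈0 (All.lookup y∉ z∈ ∘ ≡.sym)))) (+-identityʳ _)
    ∑-single {xs = y ∷ xs} f (y∉ ∷ u) (there x∈) f≈0 =
      trans (+-cong (f≈0 (All.lookup y∉ x∈)) (∑-single f u x∈ f≈0)) (+-identityˡ _)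

    ∑-allFin-single : ∀ {n} (i : Fin n) (f : Fin n → Carrier) → (∀ {j} → j ≢ i → f j ≈ 0#) → ∑ (allFin n) f ≈ f i
    ∑-allFin-single {n} i f = ∑-single f (allFin⁺ n) (∈-allFin i)

    ∑-allFin-suc : ∀ n (f : Fin (suc n) → Carrier) → ∑ (allFin (suc n)) f ≡ f zero + ∑ (allFin n) (f ∘ suc)
    ∑-allFin-suc n f = ≡.cong (f zero +_) (≡.trans (≡.cong (λ xs → ∑ xs f) (≡.sym (map-tabulate id suc)))
      (∑-map suc (allFin n) f))

    ∑-vectors-suc : (xs : List A) (r : ℕ) (f : Vec A (suc r) → Carrier) →
      ∑ (vectors xs (suc r)) f ≈ ∑ xs (λ x → ∑ (vectors xs r) (λ γ → f (x ∷ γ)))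
    ∑-vectors-suc xs r f = trans (∑-concatMap (λ x → map (x ∷_) (vectors xs r)) xs f)
      (∑-cong xs (λ x → reflexive (∑-map (x ∷_) (vectors xs r) f)))

    ∑-vectors-single : ∀ {n} (i : Fin n) r (f : Vec (Fin n) r → Carrier) →
      (∀ γ → γ ≢ replicate r i → f γ ≈ 0#) → ∑ (vectors (allFin n) r) f ≈ f (replicate r i)
    ∑-vectors-single         i zero    f f≈0 = +-identityʳ _
    ∑-vectors-single {n = n} i (suc r) f f≈0 = begin
      ∑ (vectors (allFin n) (suc r)) f
        ≈⟨ ∑-vectors-suc (allFin n) r f ⟩
      ∑ (allFin n) (λ j → ∑ (vectors (allFin n) r) (λ γ → f (j ∷ γ)))
        ≈⟨ ∑-allFin-single i _ (λ {j} j≢i → ∑-zero (vectors (allFin n) r)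
             (λ {γ} _ → f≈0 (j ∷ γ) (j≢i ∘ ∷-injectiveˡ))) ⟩
      ∑ (vectors (allFin n) r) (λ γ → f (i ∷ γ))
        ≈⟨ ∑-vectors-single i r (λ γ → f (i ∷ γ)) (λ γ γ≢ → f≈0 (i ∷ γ) (γ≢ ∘ ∷-injectiveʳ)) ⟩
      f (replicate (suc r) i) ∎

    ∑-compositions-suc : ∀ n d (f : Vec ℕ (suc n) → Carrier) →
      ∑ (compositions (suc n) d) f ≈ ∑ (upTo (suc d)) (λ a → ∑ (compositions n (d ℕ.∸ a)) (λ ds → f (a ∷ ds)))
    ∑-compositions-suc n d f = trans
      (∑-concatMap (λ a → map (a ∷_) (compositions n (d ℕ.∸ a))) (upTo (suc d)) f)
      (∑-cong (upTo (suc d)) (λ a → reflexive (∑-map (a ∷_) (compositions n (d ℕ.∸ a)) f)))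

    ∑-compositions-0 : ∀ n (f : Vec ℕ n → Carrier) → ∑ (compositions n 0) f ≈ f (replicate n 0)
    ∑-compositions-0 zero    f = +-identityʳ _
    ∑-compositions-0 (suc n) f = trans (∑-compositions-suc n 0 f)
      (trans (+-identityʳ _) (∑-compositions-0 n (λ ds → f (0 ∷ ds))))

    ∑-compositions-1 : ∀ n (f : Vec ℕ n → Carrier) → ∑ (compositions n 1) f ≈ ∑ (allFin n) (λ i → f (point 1 i))
    ∑-compositions-1 zero    f = refl
    ∑-compositions-1 (suc n) f = begin
      ∑ (compositions (suc n) 1) f
        ≈⟨ ∑-compositions-suc n 1 f ⟩
      ∑ (compositions n 1) (λ ds → f (0 ∷ ds)) + (∑ (compositions n 0) (λ ds → f (1 ∷ ds)) + 0#)
        ≈⟨ +-cong (∑-compositions-1 n _) (trans (+-identityʳ _) (∑-compositions-0 n _)) ⟩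
      ∑ (allFin n) (λ i → f (point 1 (suc i))) + f (point 1 zero)
        ≈⟨ +-comm _ _ ⟩
      f (point 1 zero) + ∑ (allFin n) (λ i → f (point 1 (suc i)))
        ≡⟨ ∑-allFin-suc n (λ i → f (point 1 i)) ⟨
      ∑ (allFin (suc n)) (λ i → f (point 1 i)) ∎

    ∑-pairs-suc : ∀ n (f : Fin (suc n) × Fin (suc n) → Carrier) → ∑ (pairs (suc n)) f ≈
      ∑ (allFin n) (λ j → f (zero , suc j)) + ∑ (pairs n) (λ (i , j) → f (suc i , suc j))
    ∑-pairs-suc n f = trans (∑-++ (map (λ j → zero , suc j) (allFin n)) _ f)
      (+-cong (reflexive (∑-map _ (allFin n) f)) (reflexive (∑-map _ (pairs n) f)))

    ∑-compositions-2 : ∀ n (f : Vec ℕ n → Carrier) →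
      ∑ (compositions n 2) f ≈ ∑ (allFin n) (λ i → f (point 2 i)) + ∑ (pairs n) (λ ij → f (points ij))
    ∑-compositions-2 zero    f = sym (+-identityˡ 0#)
    ∑-compositions-2 (suc n) f = begin
      ∑ (compositions (suc n) 2) f
        ≈⟨ ∑-compositions-suc n 2 f ⟩
      ∑ (compositions n 2) (λ ds → f (0 ∷ ds)) +
        (∑ (compositions n 1) (λ ds → f (1 ∷ ds)) + (∑ (compositions n 0) (λ ds → f (2 ∷ ds)) + 0#))
        ≈⟨ +-cong (∑-compositions-2 n _)
             (+-cong (∑-compositions-1 n _) (trans (+-identityʳ _) (∑-compositions-0 n _))) ⟩
      (S₂ + P) + (S₁ + f (point 2 zero))
        ≈⟨ +-cong refl (+-comm _ _) ⟩
      (S₂ + P) + (f (point 2 zero) + S₁)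
        ≈⟨ interchange _ _ _ _ ⟩
      (S₂ + f (point 2 zero)) + (P + S₁)
        ≈⟨ +-cong (trans (+-comm _ _) (reflexive (≡.sym (∑-allFin-suc n (λ i → f (point 2 i))))))
             (trans (+-comm _ _) (sym (∑-pairs-suc n (λ ij → f (points ij))))) ⟩
      ∑ (allFin (suc n)) (λ i → f (point 2 i)) + ∑ (pairs (suc n)) (λ ij → f (points ij)) ∎
      where
      S₂ = ∑ (allFin n) (λ i → f (point 2 (suc i)))
      S₁ = ∑ (allFin n) (λ j → f (1 ∷ point 1 j))
      P  = ∑ (pairs n) (λ (i , j) → f (points (suc i , suc j)))

  -- Natural numbers and inverse factorials in an ordered field.

  module FieldLemmas {c ℓ₁ ℓ₂} (F : OrderedField c ℓ₁ ℓ₂) where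
    open OrderedField F using (commutativeRing; _<_; fromℕ#; #⇒invertible)
    open OrderedFieldProperties F
    open CommutativeRing commutativeRing
    open import Algebra.Properties.Ring ring using (-0#≈0#)

    fromℕ#-+ : ∀ m n → fromℕ# (m ℕ.+ n) ≈ fromℕ# m + fromℕ# n
    fromℕ#-+ zero    n = sym (+-identityˡ _)
    fromℕ#-+ (suc m) n = trans (+-congˡ (fromℕ#-+ m n)) (sym (+-assoc _ _ _))

    fromℕ#-* : ∀ m n → fromℕ# (m ℕ.* n) ≈ fromℕ# m * fromℕ# n
    fromℕ#-* zero    n = sym (zeroˡ _)
    fromℕ#-* (suc m) n = trans (fromℕ#-+ n (m ℕ.* n))
      (trans (+-cong (sym (*-identityˡ _)) (fromℕ#-* m n)) (sym (distribʳ _ _ _)))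

    recip-inverse : ∀ x 0<x → recip x 0<x * x ≈ 1#
    recip-inverse x 0<x = trans (*-congˡ (sym (trans (+-congˡ -0#≈0#) (+-identityʳ x))))
      (proj₁ (proj₂ (#⇒invertible (inj₂ 0<x))))

    1/!-inverse : ∀ n → 1/ n ! * fromℕ# (n !) ≈ 1#
    1/!-inverse n = recip-inverse _ _

    1/0!≈1 : 1/ 0 ! ≈ 1#
    1/0!≈1 = trans (sym (trans (*-congˡ (+-identityʳ 1#)) (*-identityʳ _))) (1/!-inverse 0)

  -- Linear functionals on polynomials.

  module Evaluation {c ℓ₁ ℓ₂} (F : OrderedField c ℓ₁ ℓ₂) {X : Set} (_≟_ : DecidableEquality X) where
    open OrderedField F using (commutativeRing; fromℕ#)
    open CommutativeRing commutativeRing hiding (zero)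
    open Polynomials F _≟_ renaming (∑ to ∑ᴾ)
    open ListSum semiring
    open import Relation.Binary.Reasoning.Setoid setoid
    open import Algebra.Properties.CommutativeSemigroup *-commutativeSemigroup using (x∙yz≈y∙xz)

    -- Extended linearly by `eval`. A functional may differ on two orderings of the same monomial,
    -- so polynomials never have to be brought into a normal form.
    Functional : Set c
    Functional = Monomial → Carrier

    eval : Functional → Poly → Carrier
    eval φ p = ∑ p (λ t → proj₁ t * φ (proj₂ t))

    eval-cong : ∀ {φ ψ} p → (∀ w → φ w ≈ ψ w) → eval φ p ≈ eval ψ p
    eval-cong p φ≈ψ = ∑-cong p (λ t → *-congˡ (φ≈ψ (proj₂ t)))

    eval-scale : ∀ φ a p → eval φ (scale a p) ≈ a * eval φ p
    eval-scale φ a p = begin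
      ∑ (map (λ (b , w) → a * b , w) p) (λ t → proj₁ t * φ (proj₂ t))
        ≡⟨ ∑-map _ p _ ⟩
      ∑ p (λ t → a * proj₁ t * φ (proj₂ t))
        ≈⟨ ∑-cong p (λ t → *-assoc _ _ _) ⟩
      ∑ p (λ t → a * (proj₁ t * φ (proj₂ t)))
        ≈⟨ *-distribˡ-∑ a p _ ⟨
      a * eval φ p ∎

    eval-*ˡ : ∀ a φ p → eval (λ w → a * φ w) p ≈ a * eval φ p
    eval-*ˡ a φ p = trans (∑-cong p (λ t → x∙yz≈y∙xz _ _ _)) (sym (*-distribˡ-∑ a p _))

    eval-∑ᴾ : ∀ {A : Set} φ (xs : List A) f → eval φ (∑ᴾ xs f) ≈ ∑ xs (λ x → eval φ (f x))
    eval-∑ᴾ φ []       f = refl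
    eval-∑ᴾ φ (x ∷ xs) f = trans (∑-++ (f x) _ _) (+-congˡ (eval-∑ᴾ φ xs f))

    eval-∑ : ∀ {A : Set} (xs : List A) (φ : A → Functional) p →
      eval (λ w → ∑ xs (λ x → φ x w)) p ≈ ∑ xs (λ x → eval (φ x) p)
    eval-∑ xs φ p = trans (∑-cong p (λ t → *-distribˡ-∑ (proj₁ t) xs _)) (∑-comm p xs _)

    eval-var : ∀ φ x p → eval φ (var x *ᴾ p) ≈ eval (φ ∘ (x ∷_)) p
    eval-var φ x p = begin
      ∑ (map (λ (b , w) → 1# * b , x ∷ w) p ++ []) (λ t → proj₁ t * φ (proj₂ t))
        ≈⟨ trans (∑-++ (map (λ (b , w) → 1# * b , x ∷ w) p) [] _) (+-identityʳ _) ⟩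
      ∑ (map (λ (b , w) → 1# * b , x ∷ w) p) (λ t → proj₁ t * φ (proj₂ t))
        ≡⟨ ∑-map _ p _ ⟩
      ∑ p (λ t → 1# * proj₁ t * φ (x ∷ proj₂ t))
        ≈⟨ ∑-cong p (λ t → *-congʳ (*-identityˡ _)) ⟩
      eval (φ ∘ (x ∷_)) p ∎

    δ : Functional
    δ []      = 1#
    δ (_ ∷ _) = 0#

    constantTerm-eval : ∀ p → constantTerm p ≈ eval δ p
    constantTerm-eval []                = refl
    constantTerm-eval ((a , [])    ∷ p) = +-cong (sym (*-identityʳ a)) (constantTerm-eval p)
    constantTerm-eval ((a , _ ∷ _) ∷ p) =
      trans (constantTerm-eval p) (sym (trans (+-congʳ (zeroʳ a)) (+-identityˡ _)))

    -- The adjoint of `∂ x`: by `eval-∂`, evaluating after differentiation is evaluating this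
    -- functional on the original polynomial.
    ∂* : X → Functional → Functional
    ∂* x φ w = ∑ (∂ᴹ x w) φ

    eval-∂ : ∀ φ x p → eval φ (∂ x p) ≈ eval (∂* x φ) p
    eval-∂ φ x p = begin
      ∑ (concatMap (λ (a , w) → map (a ,_) (∂ᴹ x w)) p) (λ t → proj₁ t * φ (proj₂ t))
        ≈⟨ ∑-concatMap _ p _ ⟩
      ∑ p (λ t → ∑ (map (proj₁ t ,_) (∂ᴹ x (proj₂ t))) (λ t → proj₁ t * φ (proj₂ t)))
        ≈⟨ ∑-cong p (λ t → trans (reflexive (∑-map (proj₁ t ,_) (∂ᴹ x (proj₂ t)) _))
             (sym (*-distribˡ-∑ (proj₁ t) (∂ᴹ x (proj₂ t)) φ))) ⟩
      eval (∂* x φ) p ∎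

    ∂*-cong : ∀ {φ ψ} x → (∀ w → φ w ≈ ψ w) → ∀ w → ∂* x φ w ≈ ∂* x ψ w
    ∂*-cong x φ≈ψ w = ∑-cong (∂ᴹ x w) φ≈ψ

    ∂ᴹ-↭ : ∀ x w → All (λ w′ → w ↭ x ∷ w′) (∂ᴹ x w)
    ∂ᴹ-↭ x []      = []
    ∂ᴹ-↭ x (y ∷ w) with x ≟ y
    ... | yes ≡.refl = ↭-refl ∷ All.map⁺ (All.map (λ p → ↭-trans (prep y p) (swap y x ↭-refl)) (∂ᴹ-↭ x w))
    ... | no _       = All.map⁺ (All.map (λ p → ↭-trans (prep y p) (swap y x ↭-refl)) (∂ᴹ-↭ x w))

    ∂*-vanish : ∀ {φ} x w → (∀ {w′} → w ↭ x ∷ w′ → φ w′ ≈ 0#) → ∂* x φ w ≈ 0#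
    ∂*-vanish x w φ≈0 = ∑-zero (∂ᴹ x w) (λ w′∈ → φ≈0 (All.lookup (∂ᴹ-↭ x w) w′∈))

    ∂*-power : ∀ φ x N → ∂* x φ (List.replicate (suc N) x) ≈ fromℕ# (suc N) * φ (List.replicate N x)
    ∂*-power φ x N rewrite dec-true (x ≟ x) ≡.refl = begin
      φ (List.replicate N x) + ∑ (map (x ∷_) (∂ᴹ x (List.replicate N x))) φ
        ≈⟨ +-cong (sym (*-identityˡ _)) (trans (reflexive (∑-map (x ∷_) (∂ᴹ x (List.replicate N x)) φ)) (rest N)) ⟩
      1# * φ (List.replicate N x) + fromℕ# N * φ (List.replicate N x)
        ≈⟨ distribʳ _ _ _ ⟨
      fromℕ# (suc N) * φ (List.replicate N x) ∎
      where
      rest : ∀ N → ∂* x (φ ∘ (x ∷_)) (List.replicate N x) ≈ fromℕ# N * φ (List.replicate N x)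
      rest zero    = sym (zeroˡ _)
      rest (suc N) = ∂*-power (φ ∘ (x ∷_)) x N

    ∂*-power-≢ : ∀ φ x y N → x ≢ y → ∂* x φ (List.replicate N y) ≈ 0#
    ∂*-power-≢ φ x y zero    x≢y = refl
    ∂*-power-≢ φ x y (suc N) x≢y rewrite dec-false (x ≟ y) x≢y =
      trans (reflexive (∑-map (y ∷_) (∂ᴹ x (List.replicate N y)) φ)) (∂*-power-≢ (φ ∘ (y ∷_)) x y N x≢y)

  lookup-replicate-0 : ∀ {n} (j : Fin n) → lookup (replicate n 0) j ≡ 0
  lookup-replicate-0 zero    = ≡.refl
  lookup-replicate-0 (suc j) = lookup-replicate-0 j

  lookup-point : ∀ {n} a (i : Fin n) → lookup (point a i) i ≡ a
  lookup-point a zero    = ≡.refl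
  lookup-point a (suc i) = lookup-point a i

  lookup-point-≢ : ∀ {n} a (i j : Fin n) → j ≢ i → lookup (point a i) j ≡ 0
  lookup-point-≢ a zero    zero    j≢i = contradiction ≡.refl j≢i
  lookup-point-≢ a zero    (suc j) j≢i = lookup-replicate-0 j
  lookup-point-≢ a (suc i) zero    j≢i = ≡.refl
  lookup-point-≢ a (suc i) (suc j) j≢i = lookup-point-≢ a i j (j≢i ∘ ≡.cong suc)

  lookup-points : ∀ {n} (i j : Fin n) → i ≢ j →
    lookup (points (i , j)) i ≡ 1 × lookup (points (i , j)) j ≡ 1 ×
    (∀ l → l ≢ i → l ≢ j → lookup (points (i , j)) l ≡ 0)
  lookup-points zero    zero    i≢j = contradiction ≡.refl i≢j
  lookup-points zero    (suc j) i≢j = ≡.refl , lookup-point 1 j , λ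
    { zero    l≢ _  → contradiction ≡.refl l≢
    ; (suc l) _  l≢ → lookup-point-≢ 1 j l (l≢ ∘ ≡.cong suc) }
  lookup-points (suc i) zero    i≢j = lookup-point 1 i , ≡.refl , λ
    { zero    _  l≢ → contradiction ≡.refl l≢
    ; (suc l) l≢ _  → lookup-point-≢ 1 i l (l≢ ∘ ≡.cong suc) }
  lookup-points (suc i) (suc j) i≢j with lookup-points i j (i≢j ∘ ≡.cong suc)
  ... | eqᵢ , eqⱼ , rest = eqᵢ , eqⱼ , λ
    { zero    _   _   → ≡.refl
    ; (suc l) l≢i l≢j → rest l (l≢i ∘ ≡.cong suc) (l≢j ∘ ≡.cong suc) }

  -- Adjoint row operators and diagonal terms of the trace formula.

  module Trace {c ℓ₁ ℓ₂} (F : OrderedField c ℓ₁ ℓ₂) {k n : ℕ} (T : Spectral.Tensor F k n) where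
    open OrderedField F using (commutativeRing; fromℕ#)
    open CommutativeRing commutativeRing hiding (zero)
    open OrderedFieldProperties F using (1/_!)
    open FieldLemmas F
    open ListSum semiring
    open Evaluation F (×-≡-dec (_≟ᶠ_ {n}) (_≟ᶠ_ {n})) public
    open Polynomials F (×-≡-dec (_≟ᶠ_ {n}) (_≟ᶠ_ {n})) using (Monomial; Poly; scale) renaming (∑ to ∑ᴾ)
    open import Relation.Binary.Reasoning.Setoid setoid
    open import Algebra.Properties.Semiring.Exp semiring using (_^_)
    open import Algebra.Properties.CommutativeSemigroup *-commutativeSemigroup using (x∙yz≈y∙xz)

    private
      r = k ∸ 1
      V = Fin n

      -- The order k of the tensor T cannot be inferred from its type.
      tracePower  = Spectral.tracePower F {k} {n} T
      matrixPower = Spectral.matrixPower F {k} {n} T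
      rowOperator = Spectral.rowOperator F {k} {n} T
      compositionOperator = Spectral.compositionOperator F {k} {n} T
      iterate     = Spectral.iterate F {k} {n} T
      Tr          = Spectral.Tr F {k} {n} T

      ∂ⱽ : ∀ {s} → V → Vec V s → Poly → Poly
      ∂ⱽ = Spectral.∂ⱽ F {k} {n} T

    -- The adjoints of the operators acting on polynomials, as transformations
    -- of functionals on monomials.
    ∂ⱽ* : ∀ {s} → V → Vec V s → Functional → Functional
    ∂ⱽ* i []      φ = φ
    ∂ⱽ* i (j ∷ γ) φ = ∂ⱽ* i γ (∂* (i , j) φ)

    row* : V → Functional → Functional
    row* i φ w = ∑ (vectors (allFin n) r) (λ γ → T i γ * ∂ⱽ* i γ φ w)

    iterate* : ℕ → V → Functional → Functional
    iterate* zero    i φ = φ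
    iterate* (suc e) i φ = iterate* e i (row* i φ)

    step : Vec ℕ n → V → Functional → Functional
    step ds i φ w = 1/ (lookup ds i ℕ.* r) ! * iterate* (lookup ds i) i φ w

    -- Adjoints compose in reverse: the head of the list, outermost as an operator on polynomials,
    -- acts first on the functional.
    composition* : Vec ℕ n → List V → Functional → Functional
    composition* ds []       φ = φ
    composition* ds (i ∷ is) φ = composition* ds is (step ds i φ)

    eval-∂ⱽ : ∀ {s} φ i (γ : Vec V s) p → eval φ (∂ⱽ i γ p) ≈ eval (∂ⱽ* i γ φ) p
    eval-∂ⱽ φ i []      p = refl
    eval-∂ⱽ φ i (j ∷ γ) p = trans (eval-∂ φ (i , j) (∂ⱽ i γ p)) (eval-∂ⱽ (∂* (i , j) φ) i γ p)

    eval-row : ∀ φ i p → eval φ (rowOperator i p) ≈ eval (row* i φ) p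
    eval-row φ i p = begin
      eval φ (rowOperator i p)
        ≈⟨ eval-∑ᴾ φ (vectors (allFin n) r) (λ γ → scale (T i γ) (∂ⱽ i γ p)) ⟩
      ∑ (vectors (allFin n) r) (λ γ → eval φ (scale (T i γ) (∂ⱽ i γ p)))
        ≈⟨ ∑-cong (vectors (allFin n) r) (λ γ → trans (eval-scale φ (T i γ) (∂ⱽ i γ p))
             (trans (*-congˡ (eval-∂ⱽ φ i γ p)) (sym (eval-*ˡ (T i γ) (∂ⱽ* i γ φ) p)))) ⟩
      ∑ (vectors (allFin n) r) (λ γ → eval (λ w → T i γ * ∂ⱽ* i γ φ w) p)
        ≈⟨ eval-∑ (vectors (allFin n) r) (λ γ w → T i γ * ∂ⱽ* i γ φ w) p ⟨
      eval (row* i φ) p ∎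

    eval-iterate : ∀ φ e i p → eval φ (iterate e (rowOperator i) p) ≈ eval (iterate* e i φ) p
    eval-iterate φ zero    i p = refl
    eval-iterate φ (suc e) i p = trans (eval-row φ i (iterate e (rowOperator i) p)) (eval-iterate (row* i φ) e i p)

    eval-composition : ∀ φ ds is p →
      eval φ (foldr (λ i q → scale (1/ (lookup ds i ℕ.* r) !) (iterate (lookup ds i) (rowOperator i) q)) p is)
        ≈ eval (composition* ds is φ) p
    eval-composition φ ds []       p = refl
    eval-composition φ ds (i ∷ is) p = trans (eval-scale φ _ (iterate (lookup ds i) (rowOperator i) q))
      (trans (*-congˡ (eval-iterate φ (lookup ds i) i q))
        (trans (sym (eval-*ˡ _ (iterate* (lookup ds i) i φ) q)) (eval-composition (step ds i φ) ds is p)))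
      where q = foldr (λ i q → scale (1/ (lookup ds i ℕ.* r) !) (iterate (lookup ds i) (rowOperator i) q)) p is

    ∂ⱽ*-cong : ∀ {s φ ψ} i (γ : Vec V s) → (∀ w → φ w ≈ ψ w) → ∀ w → ∂ⱽ* i γ φ w ≈ ∂ⱽ* i γ ψ w
    ∂ⱽ*-cong i []      φ≈ψ = φ≈ψ
    ∂ⱽ*-cong i (j ∷ γ) φ≈ψ = ∂ⱽ*-cong i γ (∂*-cong (i , j) φ≈ψ)

    row*-cong : ∀ {φ ψ} i → (∀ w → φ w ≈ ψ w) → ∀ w → row* i φ w ≈ row* i ψ w
    row*-cong i φ≈ψ w = ∑-cong (vectors (allFin n) r) (λ γ → *-congˡ (∂ⱽ*-cong i γ φ≈ψ w))

    iterate*-cong : ∀ {φ ψ} e i → (∀ w → φ w ≈ ψ w) → ∀ w → iterate* e i φ w ≈ iterate* e i ψ w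
    iterate*-cong zero    i φ≈ψ = φ≈ψ
    iterate*-cong (suc e) i φ≈ψ = iterate*-cong e i (row*-cong i φ≈ψ)

    step-cong : ∀ {φ ψ} ds i → (∀ w → φ w ≈ ψ w) → ∀ w → step ds i φ w ≈ step ds i ψ w
    step-cong ds i φ≈ψ w = *-congˡ (iterate*-cong (lookup ds i) i φ≈ψ w)

    composition*-cong : ∀ {φ ψ} ds is → (∀ w → φ w ≈ ψ w) → ∀ w → composition* ds is φ w ≈ composition* ds is ψ w
    composition*-cong ds []       φ≈ψ = φ≈ψ
    composition*-cong ds (i ∷ is) φ≈ψ = composition*-cong ds is (step-cong ds i φ≈ψ)

    step-zero : ∀ ds i φ → lookup ds i ≡ 0 → ∀ w → step ds i φ w ≈ φ w
    step-zero ds i φ eq w rewrite eq = trans (*-congʳ 1/0!≈1) (*-identityˡ _)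

    step-one : ∀ ds i φ → lookup ds i ≡ 1 → ∀ w → step ds i φ w ≈ 1/ (1 ℕ.* r) ! * row* i φ w
    step-one ds i φ eq w rewrite eq = refl

    composition*-none : ∀ ds is φ → (∀ {j} → j ∈ is → lookup ds j ≡ 0) → ∀ w → composition* ds is φ w ≈ φ w
    composition*-none ds []       φ 0s w = refl
    composition*-none ds (i ∷ is) φ 0s w =
      trans (composition*-none ds is _ (0s ∘ there) w) (step-zero ds i φ (0s (here ≡.refl)) w)

    composition*-one : ∀ ds {is i} → Unique is → i ∈ is → (∀ {j} → j ∈ is → j ≢ i → lookup ds j ≡ 0) →
      ∀ φ w → composition* ds is φ w ≈ step ds i φ w
    composition*-one ds {_ ∷ is} (i∉ ∷ _) (here ≡.refl) 0s φ =
      composition*-none ds is _ (λ j∈ → 0s (there j∈) (All.lookup i∉ j∈ ∘ ≡.sym))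
    composition*-one ds {j ∷ is} (j∉ ∷ u) (there i∈) 0s φ w =
      trans (composition*-cong ds is (step-zero ds j φ (0s (here ≡.refl) (All.lookup j∉ i∈))) w)
        (composition*-one ds u i∈ (0s ∘ there) φ w)

    -- Which alternative holds depends on whether `i` or `j` comes first in the list. This avoids
    -- proving that row operators commute.
    composition*-two : ∀ ds {is i j} → Unique is → i ∈ is → j ∈ is → i ≢ j →
      (∀ l → l ≢ i → l ≢ j → lookup ds l ≡ 0) → ∀ φ →
      (∀ w → composition* ds is φ w ≈ step ds j (step ds i φ) w) ⊎
      (∀ w → composition* ds is φ w ≈ step ds i (step ds j φ) w)
    composition*-two ds u (here ≡.refl) (here ≡.refl) i≢j 0s φ = contradiction ≡.refl i≢j
    composition*-two ds {i ∷ is} (i∉ ∷ u) (here ≡.refl) (there j∈) i≢j 0s φ = inj₁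
      (composition*-one ds u j∈ (λ {l} l∈ → 0s l (All.lookup i∉ l∈ ∘ ≡.sym)) (step ds i φ))
    composition*-two ds {j ∷ is} (j∉ ∷ u) (there i∈) (here ≡.refl) i≢j 0s φ = inj₂
      (composition*-one ds u i∈ (λ {l} l∈ l≢i → 0s l l≢i (All.lookup j∉ l∈ ∘ ≡.sym)) (step ds j φ))
    composition*-two ds {l ∷ is} (l∉ ∷ u) (there i∈) (there j∈) i≢j 0s φ
      with composition*-two ds u i∈ j∈ i≢j 0s φ
    ... | inj₁ x = inj₁ (λ w → trans (composition*-cong ds is skip w) (x w))
      where skip = step-zero ds l φ (0s l (All.lookup l∉ i∈) (All.lookup l∉ j∈))
    ... | inj₂ x = inj₂ (λ w → trans (composition*-cong ds is skip w) (x w))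
      where skip = step-zero ds l φ (0s l (All.lookup l∉ i∈) (All.lookup l∉ j∈))

    -- The monomials of the entry (a, b) of the N-th matrix power, with the arcs in the order of
    -- travel.
    data Walk : ℕ → V → V → Monomial → Set where
      []   : ∀ {a} → Walk zero a a []
      arc  : ∀ {N l b w} a → Walk N l b w → Walk (suc N) a b ((a , l) ∷ w)

    eval-matrixPower-suc : ∀ φ N a b → eval φ (matrixPower (suc N) a b) ≈
      ∑ (allFin n) (λ l → eval (φ ∘ ((a , l) ∷_)) (matrixPower N l b))
    eval-matrixPower-suc φ N a b = trans (eval-∑ᴾ φ (allFin n) _)
      (∑-cong (allFin n) (λ l → eval-var φ (a , l) (matrixPower N l b)))

    eval-matrixPower-vanish : ∀ φ N a b → (∀ {w} → Walk N a b w → φ w ≈ 0#) → eval φ (matrixPower N a b) ≈ 0#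
    eval-matrixPower-vanish φ zero a b φ≈0 with a ≟ᶠ b
    ... | yes ≡.refl = trans (+-identityʳ _) (trans (*-congˡ (φ≈0 [])) (zeroʳ 1#))
    ... | no _       = refl
    eval-matrixPower-vanish φ (suc N) a b φ≈0 = trans (eval-matrixPower-suc φ N a b)
      (∑-zero (allFin n) (λ {l} _ → eval-matrixPower-vanish _ N l b (λ p → φ≈0 (arc a p))))

    eval-tracePower : ∀ φ N → eval φ (tracePower N) ≈ ∑ (allFin n) (λ a → eval φ (matrixPower N a a))
    eval-tracePower φ N = eval-∑ᴾ φ (allFin n) (λ a → matrixPower N a a)

    -- Derivatives in row `i` remove only arcs leaving `i`. An arc leaving another vertex therefore
    -- survives and keeps the monomial from becoming constant.
    OffRow : V → Monomial → Set
    OffRow i = Any (λ x → proj₁ x ≢ i)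

    -- A walk from `i` back to `i` all of whose arcs leave `i` consists of loops: an arc to another
    -- vertex would have to be followed by an arc leaving that vertex.
    eval-loops : ∀ φ i N → (∀ {w} → OffRow i w → φ w ≈ 0#) →
      eval φ (matrixPower N i i) ≈ φ (List.replicate N (i , i))
    eval-loops φ i zero φ≈0 rewrite dec-true (i ≟ᶠ i) ≡.refl = trans (+-identityʳ _) (*-identityˡ _)
    eval-loops φ i (suc N) φ≈0 = begin
      eval φ (matrixPower (suc N) i i)
        ≈⟨ eval-matrixPower-suc φ N i i ⟩
      ∑ (allFin n) (λ l → eval (φ ∘ ((i , l) ∷_)) (matrixPower N l i))
        ≈⟨ ∑-allFin-single i _ (λ {l} l≢i → eval-matrixPower-vanish _ N l i (leaves l≢i)) ⟩
      eval (φ ∘ ((i , i) ∷_)) (matrixPower N i i)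
        ≈⟨ eval-loops (φ ∘ ((i , i) ∷_)) i N (φ≈0 ∘ there) ⟩
      φ (List.replicate (suc N) (i , i)) ∎
      where
      leaves : ∀ {N l w} → l ≢ i → Walk N l i w → φ ((i , l) ∷ w) ≈ 0#
      leaves l≢i []         = contradiction ≡.refl l≢i
      leaves l≢i (arc _ _) = φ≈0 (there (here l≢i))

    eval-tracePower-row : ∀ φ i N → (∀ {w} → OffRow i w → φ w ≈ 0#) →
      eval φ (tracePower (suc N)) ≈ φ (List.replicate (suc N) (i , i))
    eval-tracePower-row φ i N φ≈0 = begin
      eval φ (tracePower (suc N))
        ≈⟨ eval-tracePower φ (suc N) ⟩
      ∑ (allFin n) (λ a → eval φ (matrixPower (suc N) a a))
        ≈⟨ ∑-allFin-single i _ (λ {a} a≢i → eval-matrixPower-vanish φ (suc N) a a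
             (λ { (arc _ _) → φ≈0 (here a≢i) })) ⟩
      eval φ (matrixPower (suc N) i i)
        ≈⟨ eval-loops φ i (suc N) φ≈0 ⟩
      φ (List.replicate (suc N) (i , i)) ∎

    arcs : ∀ {s} → V → Vec V s → Monomial
    arcs i γ = Vec.toList (Vec.map (i ,_) γ)

    ∂ⱽ*-vanish : ∀ {s φ} i (γ : Vec V s) w → (∀ {w′} → w ↭ arcs i γ ++ w′ → φ w′ ≈ 0#) → ∂ⱽ* i γ φ w ≈ 0#
    ∂ⱽ*-vanish i []      w φ≈0 = φ≈0 ↭-refl
    ∂ⱽ*-vanish i (j ∷ γ) w φ≈0 = ∂ⱽ*-vanish i γ w (λ {w′} p → ∂*-vanish (i , j) w′
      (λ q → φ≈0 (↭-trans p (↭-trans (++⁺ˡ (arcs i γ) q) (shift (i , j) (arcs i γ) _)))))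

    row*-offRow : ∀ {φ} i → (∀ {w} → OffRow i w → φ w ≈ 0#) → ∀ {w} → OffRow i w → row* i φ w ≈ 0#
    row*-offRow {φ} i φ≈0 {w} off = ∑-zero (vectors (allFin n) r) (λ {γ} _ → trans
      (*-congˡ (∂ⱽ*-vanish i γ w (λ p → φ≈0 (rest γ (Any-resp-↭ p off))))) (zeroʳ _))
      where
      rest : ∀ {s} (γ : Vec V s) {w} → OffRow i (arcs i γ ++ w) → OffRow i w
      rest []      off         = off
      rest (j ∷ γ) (here i≢i)  = contradiction ≡.refl i≢i
      rest (j ∷ γ) (there off) = rest γ off

    iterate*-offRow : ∀ {φ} e i → (∀ {w} → OffRow i w → φ w ≈ 0#) → ∀ {w} → OffRow i w → iterate* e i φ w ≈ 0#
    iterate*-offRow zero    i φ≈0 = φ≈0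
    iterate*-offRow (suc e) i φ≈0 = iterate*-offRow e i (row*-offRow i φ≈0)

    private
      loops : V → ℕ → Monomial
      loops i N = List.replicate N (i , i)

    ∂ⱽ*-loops-zero : ∀ {s φ} i (γ : Vec V s) → (∀ N → φ (loops i N) ≈ 0#) → ∀ N → ∂ⱽ* i γ φ (loops i N) ≈ 0#
    ∂ⱽ*-loops-zero         i []      φ≈0 = φ≈0
    ∂ⱽ*-loops-zero {φ = φ} i (j ∷ γ) φ≈0 = ∂ⱽ*-loops-zero i γ ∂≈0
      where
      ∂≈0 : ∀ N → ∂* (i , j) φ (loops i N) ≈ 0#
      ∂≈0 N with j ≟ᶠ i
      ∂≈0 zero    | _          = refl
      ∂≈0 (suc N) | yes ≡.refl = trans (∂*-power φ (i , i) N) (trans (*-congˡ (φ≈0 N)) (zeroʳ _))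
      ∂≈0 (suc N) | no j≢i     = ∂*-power-≢ φ (i , j) (i , i) (suc N) (j≢i ∘ ,-injectiveʳ)

    ∂ⱽ*-loops-≢ : ∀ {s φ} i (γ : Vec V s) → γ ≢ replicate s i → ∀ N → ∂ⱽ* i γ φ (loops i N) ≈ 0#
    ∂ⱽ*-loops-≢         i []      γ≢ = contradiction ≡.refl γ≢
    ∂ⱽ*-loops-≢ {φ = φ} i (j ∷ γ) γ≢ with j ≟ᶠ i
    ... | yes ≡.refl = ∂ⱽ*-loops-≢ i γ (γ≢ ∘ ≡.cong (i ∷_))
    ... | no j≢i     = ∂ⱽ*-loops-zero i γ (λ N → ∂*-power-≢ φ (i , j) (i , i) N (j≢i ∘ ,-injectiveʳ))

    -- The factor `c` is the falling factorial (s+M)!/M!, characterised by a product so that no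
    -- division in ℕ occurs.
    ∂ⱽ*-loops : ∀ s φ i M → ∃[ c ] (c ℕ.* M ! ≡ (s ℕ.+ M) ! ×
      ∂ⱽ* i (replicate s i) φ (loops i (s ℕ.+ M)) ≈ fromℕ# c * φ (loops i M))
    ∂ⱽ*-loops zero    φ i M = 1 , ℕ.*-identityˡ _ ,
      sym (trans (*-congʳ (+-identityʳ 1#)) (*-identityˡ _))
    ∂ⱽ*-loops (suc s) φ i M with ∂ⱽ*-loops s (∂* (i , i) φ) i (suc M)
    ... | c , c! , eq = c ℕ.* suc M ,
      ≡.trans (ℕ.*-assoc c (suc M) (M !)) (≡.trans c! (≡.cong _! (ℕ.+-suc s M))) ,
      (begin
        ∂ⱽ* i (replicate s i) (∂* (i , i) φ) (loops i (suc s ℕ.+ M))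
          ≡⟨ ≡.cong (λ N → ∂ⱽ* i (replicate s i) (∂* (i , i) φ) (loops i N)) (≡.sym (ℕ.+-suc s M)) ⟩
        ∂ⱽ* i (replicate s i) (∂* (i , i) φ) (loops i (s ℕ.+ suc M))
          ≈⟨ eq ⟩
        fromℕ# c * ∂* (i , i) φ (loops i (suc M))
          ≈⟨ *-congˡ (∂*-power φ (i , i) M) ⟩
        fromℕ# c * (fromℕ# (suc M) * φ (loops i M))
          ≈⟨ *-assoc _ _ _ ⟨
        fromℕ# c * fromℕ# (suc M) * φ (loops i M)
          ≈⟨ *-congʳ (fromℕ#-* c (suc M)) ⟨
        fromℕ# (c ℕ.* suc M) * φ (loops i M) ∎)

    diagonal : V → Carrier
    diagonal i = T i (replicate r i)

    row*-loops : ∀ φ i M → ∃[ c ] (c ℕ.* M ! ≡ (r ℕ.+ M) ! ×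
      row* i φ (loops i (r ℕ.+ M)) ≈ diagonal i * (fromℕ# c * φ (loops i M)))
    row*-loops φ i M with ∂ⱽ*-loops r φ i M
    ... | c , c! , eq = c , c! , trans
      (∑-vectors-single i r _ (λ γ γ≢ → trans (*-congˡ (∂ⱽ*-loops-≢ i γ γ≢ (r ℕ.+ M))) (zeroʳ _)))
      (*-congˡ eq)

    iterate*-loops : ∀ d φ i M → ∃[ c ] (c ℕ.* M ! ≡ (d ℕ.* r ℕ.+ M) ! ×
      iterate* d i φ (loops i (d ℕ.* r ℕ.+ M)) ≈ diagonal i ^ d * (fromℕ# c * φ (loops i M)))
    iterate*-loops zero    φ i M = 1 , ℕ.*-identityˡ _ ,
      sym (trans (*-identityˡ _) (trans (*-congʳ (+-identityʳ 1#)) (*-identityˡ _)))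
    iterate*-loops (suc d) φ i M with row*-loops φ i M | iterate*-loops d (row* i φ) i (r ℕ.+ M)
    ... | c , c! , eq | b , b! , eq′ = b ℕ.* c ,
      ≡.trans (ℕ.*-assoc b c (M !)) (≡.trans (≡.cong (b ℕ.*_) c!) (≡.trans b! (≡.cong _! exponent))) ,
      (begin
        iterate* d i (row* i φ) (loops i (suc d ℕ.* r ℕ.+ M))
          ≡⟨ ≡.cong (λ N → iterate* d i (row* i φ) (loops i N)) (≡.sym exponent) ⟩
        iterate* d i (row* i φ) (loops i (d ℕ.* r ℕ.+ (r ℕ.+ M)))
          ≈⟨ eq′ ⟩
        D ^ d * (fromℕ# b * row* i φ (loops i (r ℕ.+ M)))
          ≈⟨ *-congˡ (*-congˡ eq) ⟩
        D ^ d * (fromℕ# b * (D * (fromℕ# c * φ (loops i M))))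
          ≈⟨ *-congˡ (x∙yz≈y∙xz _ _ _) ⟩
        D ^ d * (D * (fromℕ# b * (fromℕ# c * φ (loops i M))))
          ≈⟨ *-assoc _ _ _ ⟨
        D ^ d * D * (fromℕ# b * (fromℕ# c * φ (loops i M)))
          ≈⟨ *-cong (*-comm _ _) (trans (sym (*-assoc _ _ _)) (*-congʳ (sym (fromℕ#-* b c)))) ⟩
        D ^ suc d * (fromℕ# (b ℕ.* c) * φ (loops i M)) ∎)
      where
      D = diagonal i
      exponent : d ℕ.* r ℕ.+ (r ℕ.+ M) ≡ suc d ℕ.* r ℕ.+ M
      exponent = ≡.trans (≡.sym (ℕ.+-assoc (d ℕ.* r) r M)) (≡.cong (ℕ._+ M) (ℕ.+-comm (d ℕ.* r) r))

    offRow-δ : ∀ {i w} → OffRow i w → δ w ≈ 0#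
    offRow-δ (here _)  = refl
    offRow-δ (there _) = refl

    -- For M = 0 the factor from `iterate*-loops` is the full factorial of (d+1)r, and the
    -- normalising factor of the trace formula cancels it.
    diagonal-term : ∀ d i → 1 ℕ.≤ r → eval (composition* (point (suc d) i) (allFin n) δ) (tracePower (suc d ℕ.* r))
      ≈ diagonal i ^ suc d
    diagonal-term d i 1≤r with iterate*-loops (suc d) δ i 0
    ... | c , c! , eq = begin
      eval (composition* ds (allFin n) δ) (tracePower N)
        ≈⟨ eval-cong (tracePower N) (λ w → trans
             (composition*-one ds (allFin⁺ n) (∈-allFin i) (λ {j} _ j≢i → lookup-point-≢ (suc d) i j j≢i) δ w)
             (reflexive (≡.cong (λ a → 1/ (a ℕ.* r) ! * iterate* a i δ w) (lookup-point (suc d) i)))) ⟩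
      eval (λ w → 1/ N ! * iterate* (suc d) i δ w) (tracePower N)
        ≈⟨ eval-*ˡ _ (iterate* (suc d) i δ) (tracePower N) ⟩
      1/ N ! * eval (iterate* (suc d) i δ) (tracePower N)
        ≈⟨ *-congˡ (trace≈ N (ℕ.≤-trans 1≤r (ℕ.m≤m+n r (d ℕ.* r)))) ⟩
      1/ N ! * iterate* (suc d) i δ (loops i N)
        ≡⟨ ≡.cong (λ N′ → 1/ N ! * iterate* (suc d) i δ (loops i N′)) (≡.sym (ℕ.+-identityʳ N)) ⟩
      1/ N ! * iterate* (suc d) i δ (loops i (N ℕ.+ 0))
        ≈⟨ *-congˡ eq ⟩
      1/ N ! * (diagonal i ^ suc d * (fromℕ# c * 1#))
        ≈⟨ x∙yz≈y∙xz _ _ _ ⟩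
      diagonal i ^ suc d * (1/ N ! * (fromℕ# c * 1#))
        ≈⟨ *-congˡ (trans (*-congˡ (trans (*-identityʳ _) (reflexive (≡.cong fromℕ# c≡)))) (1/!-inverse N)) ⟩
      diagonal i ^ suc d * 1#
        ≈⟨ *-identityʳ _ ⟩
      diagonal i ^ suc d ∎
      where
      ds = point (suc d) i
      N = suc d ℕ.* r
      c≡ : c ≡ N !
      c≡ = ≡.trans (≡.sym (ℕ.*-identityʳ c)) (≡.trans c! (≡.cong _! (ℕ.+-identityʳ N)))
      -- The exponent has to be positive: in the trace of the zeroth power every vertex would
      -- contribute, not only `i`.
      trace≈ : ∀ N → 1 ℕ.≤ N → eval (iterate* (suc d) i δ) (tracePower N) ≈ iterate* (suc d) i δ (loops i N)
      trace≈ (suc N) _ = eval-tracePower-row (iterate* (suc d) i δ) i N (iterate*-offRow (suc d) i offRow-δ)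

    -- Terms mixing two distinct rows.

    walk-target : ∀ {N a b w x l} → Walk N a b w → (x , l) ∈ w → l ≡ b ⊎ ∃[ y ] (l , y) ∈ w
    walk-target (arc a [])           (here ≡.refl) = inj₁ ≡.refl
    walk-target (arc a (arc l p))   (here ≡.refl) = inj₂ (_ , there (here ≡.refl))
    walk-target (arc a p)            (there ∈w) with walk-target p ∈w
    ... | inj₁ l≡b      = inj₁ l≡b
    ... | inj₂ (y , ∈w) = inj₂ (y , there ∈w)

    walk-loops : ∀ {N a b w} → Walk N a b w → (∀ {x l} → (x , l) ∈ w → x ≡ l) → ∀ {x l} → (x , l) ∈ w → x ≡ a
    walk-loops (arc a p) loop (here ≡.refl) = ≡.refl
    walk-loops (arc a p) loop (there ∈w)    = ≡.trans (walk-loops p (loop ∘ there) ∈w) (≡.sym (loop (here ≡.refl)))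

    ∈-arcs : ∀ {s x l} i (γ : Vec V s) → (x , l) ∈ arcs i γ → x ≡ i × l ∈ Vec.toList γ
    ∈-arcs i (j ∷ γ) (here ≡.refl) = ≡.refl , here ≡.refl
    ∈-arcs i (j ∷ γ) (there ∈w)    = map₂ there (∈-arcs i γ ∈w)

    arcs-∈ : ∀ {s l} i (γ : Vec V s) → l ∈ Vec.toList γ → (i , l) ∈ arcs i γ
    arcs-∈ i (j ∷ γ) (here ≡.refl) = here ≡.refl
    arcs-∈ i (j ∷ γ) (there l∈)    = there (arcs-∈ i γ l∈)

    -- Two indices support no entry off the diagonal. For hypergraphs this expresses that an edge
    -- has at least three vertices, the reason why k = 2 needs separate treatment.
    Thin : Set _
    Thin = ∀ i j γ → (∀ {l} → l ∈ Vec.toList γ → l ≡ i ⊎ l ≡ j) → γ ≢ replicate r i → T i γ ≈ 0#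

    -- Along a closed walk using arcs out of i and j only, every target is i or j;
    -- the two rows then have to be thin, and if neither leaves its vertex the
    -- walk cannot visit both.
    cross-vanish : Thin → 1 ℕ.≤ r → ∀ {i j} → i ≢ j → ∀ {N a w} → Walk N a a w → ∀ b →
      row* i (λ w → b * row* j δ w) w ≈ 0#
    cross-vanish thin 1≤r {i} {j} i≢j {a = a} {w} walk b =
      ∑-zero (vectors (allFin n) r) (λ {γ} _ → outer γ)
      where
      In : ∀ {s} → Vec V s → Set
      In γ = ∀ {l} → l ∈ Vec.toList γ → l ≡ i ⊎ l ≡ j

      _≟ᵛ_ : DecidableEquality (Vec V r)
      _≟ᵛ_ = Vec-≡-dec _≟ᶠ_

      ∈-replicate : ∀ s {x y : V} → y ∈ Vec.toList (replicate s x) → y ≡ x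
      ∈-replicate (suc s) (here y≡x) = y≡x
      ∈-replicate (suc s) (there y∈) = ∈-replicate s y∈

      some-∈ : ∀ {s} (γ : Vec V s) → 1 ℕ.≤ s → ∃[ l ] l ∈ Vec.toList γ
      some-∈ (l ∷ γ) _ = l , here ≡.refl

      module _ (γ γ′ : Vec V r) (w↭ : w ↭ arcs i γ ++ arcs j γ′) where
        i-arc : ∀ {l} → l ∈ Vec.toList γ → (i , l) ∈ w
        i-arc l∈ = ∈-resp-↭ (↭-sym w↭) (∈-++⁺ˡ (arcs-∈ i γ l∈))

        j-arc : ∀ {l} → l ∈ Vec.toList γ′ → (j , l) ∈ w
        j-arc l∈ = ∈-resp-↭ (↭-sym w↭) (∈-++⁺ʳ (arcs i γ) (arcs-∈ j γ′ l∈))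

        split : ∀ {x l} → (x , l) ∈ w →
          (x ≡ i × l ∈ Vec.toList γ) ⊎ (x ≡ j × l ∈ Vec.toList γ′)
        split x∈ with ∈-++⁻ (arcs i γ) (∈-resp-↭ w↭ x∈)
        ... | inj₁ x∈ᵢ = inj₁ (∈-arcs i γ x∈ᵢ)
        ... | inj₂ x∈ⱼ = inj₂ (∈-arcs j γ′ x∈ⱼ)

        source : ∀ {x l} → (x , l) ∈ w → x ≡ i ⊎ x ≡ j
        source x∈ with split x∈
        ... | inj₁ (x≡i , _) = inj₁ x≡i
        ... | inj₂ (x≡j , _) = inj₂ x≡j

        first-arc : ∀ {N a b w x l} → Walk N a b w → (x , l) ∈ w → ∃[ y ] (a , y) ∈ w
        first-arc (arc a p) _ = _ , here ≡.refl

        target : ∀ {x l} → (x , l) ∈ w → l ≡ i ⊎ l ≡ j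
        target x∈ with walk-target walk x∈
        ... | inj₁ ≡.refl    = source (proj₂ (first-arc walk x∈))
        ... | inj₂ (_ , ∈w)  = source ∈w

        both-loops : γ ≡ replicate r i → γ′ ≡ replicate r j → ∀ {x l} → (x , l) ∈ w → x ≡ l
        both-loops ≡.refl ≡.refl x∈ with split x∈
        ... | inj₁ (≡.refl , l∈) = ≡.sym (∈-replicate r l∈)
        ... | inj₂ (≡.refl , l∈) = ≡.sym (∈-replicate r l∈)

        -- If all arcs were loops the walk would never leave its start, yet it has arcs at `i` and
        -- at `j`.
        not-both : γ ≡ replicate r i → ¬ (γ′ ≡ replicate r j)
        not-both eq eq′ = i≢j (≡.trans (walk-loops walk loop (i-arc (proj₂ (some-∈ γ 1≤r))))
          (≡.sym (walk-loops walk loop (j-arc (proj₂ (some-∈ γ′ 1≤r))))))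
          where
          loop : ∀ {x l} → (x , l) ∈ w → x ≡ l
          loop = both-loops eq eq′

      In? : ∀ (γ : Vec V r) → Dec (All (λ l → l ≡ i ⊎ l ≡ j) (Vec.toList γ))
      In? γ = All.all? (λ l → (l ≟ᶠ i) ⊎-dec (l ≟ᶠ j)) (Vec.toList γ)

      swap⊎ : ∀ {l} → l ≡ i ⊎ l ≡ j → l ≡ j ⊎ l ≡ i
      swap⊎ (inj₁ x) = inj₂ x
      swap⊎ (inj₂ x) = inj₁ x

      δ-cons : ∀ w → ¬ (w ≡ []) → δ w ≈ 0#
      δ-cons []      w≢[] = contradiction ≡.refl w≢[]
      δ-cons (_ ∷ _) _    = refl

      ↭-++ : ∀ {γ γ′ : Vec V r} {w′} → w ↭ arcs i γ ++ w′ → w′ ↭ arcs j γ′ ++ [] → w ↭ arcs i γ ++ arcs j γ′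
      ↭-++ {γ} {γ′} p q = ↭-trans p (++⁺ˡ (arcs i γ) (↭-trans q (↭-reflexive (++-identityʳ (arcs j γ′)))))

      -- As `δ` vanishes off the empty monomial, only the case where `γ` and `γ′` use up all arcs of
      -- `w` matters. The hypothesis `γ-ok` records that `outer` has already treated, by thinness, a
      -- nonconstant `γ` with all targets in {i, j}.
      inner : ∀ γ (γ-ok : In γ → γ ≡ replicate r i) w′ → w ↭ arcs i γ ++ w′ → row* j δ w′ ≈ 0#
      inner γ γ-ok w′ p = ∑-zero (vectors (allFin n) r) (λ {γ′} _ → term γ′)
        where
        term : ∀ γ′ → T j γ′ * ∂ⱽ* j γ′ δ w′ ≈ 0#
        term γ′ with γ′ ≟ᵛ replicate r j | In? γ′
        ... | no γ′≢ | yes in′ = trans (*-congʳ (thin j i γ′ (swap⊎ ∘ All.lookup in′) γ′≢)) (zeroˡ _)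
        ... | no γ′≢ | no ¬in′ = trans (*-congˡ (∂ⱽ*-vanish j γ′ w′ (λ {w″} q → δ-cons w″ λ { ≡.refl →
          ¬in′ (All.tabulate (λ l∈ → target γ γ′ (↭-++ {γ} {γ′} p q) (j-arc γ γ′ (↭-++ {γ} {γ′} p q) l∈))) }))) (zeroʳ _)
        ... | yes γ′≡ | _ = trans (*-congˡ (∂ⱽ*-vanish j γ′ w′ (λ {w″} q → δ-cons w″ λ { ≡.refl →
          not-both γ γ′ (↭-++ {γ} {γ′} p q)
            (γ-ok (λ l∈ → target γ γ′ (↭-++ {γ} {γ′} p q) (i-arc γ γ′ (↭-++ {γ} {γ′} p q) l∈))) γ′≡ }))) (zeroʳ _)

      outer : ∀ γ → T i γ * ∂ⱽ* i γ (λ w → b * row* j δ w) w ≈ 0#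
      outer γ with γ ≟ᵛ replicate r i | In? γ
      ... | no γ≢ | yes in′ = trans (*-congʳ (thin i j γ (All.lookup in′) γ≢)) (zeroˡ _)
      ... | no γ≢ | no ¬in′ = trans (*-congˡ (∂ⱽ*-vanish i γ w (λ {w′} p → trans
        (*-congˡ (inner γ (λ in′ → contradiction (All.tabulate in′) ¬in′) w′ p)) (zeroʳ _)))) (zeroʳ _)
      ... | yes γ≡ | _ = trans (*-congˡ (∂ⱽ*-vanish i γ w (λ {w′} p → trans
        (*-congˡ (inner γ (λ _ → γ≡) w′ p)) (zeroʳ _)))) (zeroʳ _)

    private
      a₁ : Carrier
      a₁ = 1/ (1 ℕ.* r) !

      both-steps : ∀ ds i j → lookup ds i ≡ 1 → lookup ds j ≡ 1 → ∀ w →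
        step ds j (step ds i δ) w ≈ a₁ * row* j (λ w → a₁ * row* i δ w) w
      both-steps ds i j eqᵢ eqⱼ w = trans (step-one ds j _ eqⱼ w)
        (*-congˡ (row*-cong j (step-one ds i δ eqᵢ) w))

    -- Both orders of the two rows are required to give the same value, since `composition*-two`
    -- leaves open which one occurs.
    mixed-term : ∀ {i j} → i ≢ j → ∀ p {t} →
      eval (λ w → a₁ * row* j (λ w → a₁ * row* i δ w) w) p ≈ t →
      eval (λ w → a₁ * row* i (λ w → a₁ * row* j δ w) w) p ≈ t →
      eval (composition* (points (i , j)) (allFin n) δ) p ≈ t
    mixed-term {i} {j} i≢j p eq eq′ with lookup-points i j i≢j
    ... | eqᵢ , eqⱼ , 0s with composition*-two (points (i , j)) (allFin⁺ n) (∈-allFin i) (∈-allFin j) i≢j 0s δ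
    ...   | inj₁ x = trans (eval-cong p (λ w → trans (x w) (both-steps (points (i , j)) i j eqᵢ eqⱼ w))) eq
    ...   | inj₂ x = trans (eval-cong p (λ w → trans (x w) (both-steps (points (i , j)) j i eqⱼ eqᵢ w))) eq′

    mixed-term-thin : Thin → 1 ℕ.≤ r → ∀ {i j} → i ≢ j → ∀ N →
      eval (composition* (points (i , j)) (allFin n) δ) (tracePower N) ≈ 0#
    mixed-term-thin thin 1≤r i≢j N = mixed-term i≢j (tracePower N) (half (i≢j ∘ ≡.sym)) (half i≢j)
      where
      half : ∀ {i j} → i ≢ j → eval (λ w → a₁ * row* i (λ w → a₁ * row* j δ w) w) (tracePower N) ≈ 0#
      half i≢j = trans (eval-tracePower _ N) (∑-zero (allFin n) (λ {a} _ → eval-matrixPower-vanish _ N a a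
        (λ walk → trans (*-congˡ (cross-vanish thin 1≤r i≢j walk a₁)) (zeroʳ _))))

    Tr-compositions : ∀ d → Tr (suc d) ≈ fromℕ# (r ℕ.^ (n ∸ 1)) *
      ∑ (compositions n (suc d)) (λ ds → eval (composition* ds (allFin n) δ) (tracePower (suc d ℕ.* r)))
    Tr-compositions d = *-congˡ (trans (constantTerm-eval (∑ᴾ Ds terms)) (trans (eval-∑ᴾ δ Ds terms)
      (∑-cong Ds (λ ds → eval-composition δ ds (allFin n) (tracePower (suc d ℕ.* r))))))
      where
      Ds = compositions n (suc d)
      terms : Vec ℕ n → Poly
      terms ds = compositionOperator ds (tracePower (suc d ℕ.* r))

    Tr-1 : 1 ℕ.≤ r → Tr 1 ≈ fromℕ# (r ℕ.^ (n ∸ 1)) * ∑ (allFin n) diagonal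
    Tr-1 1≤r = trans (Tr-compositions 0) (*-congˡ (trans (∑-compositions-1 n _)
      (∑-cong (allFin n) (λ i → trans (diagonal-term 0 i 1≤r) (*-identityʳ _)))))

    Tr-2 : 1 ℕ.≤ r → (t : V × V → Carrier) →
      (∀ {i j} → i ≢ j → eval (composition* (points (i , j)) (allFin n) δ) (tracePower (2 ℕ.* r)) ≈ t (i , j)) →
      Tr 2 ≈ fromℕ# (r ℕ.^ (n ∸ 1)) * (∑ (allFin n) (λ i → diagonal i * diagonal i) + ∑ (pairs n) t)
    Tr-2 1≤r t mixed = trans (Tr-compositions 1) (*-congˡ (trans (∑-compositions-2 n _) (+-cong
      (∑-cong (allFin n) (λ i → trans (diagonal-term 1 i 1≤r) (*-congˡ (*-identityʳ _))))
      (∑-cong-∈ (pairs n) (λ ij∈ → mixed (All.lookup (pairs-≢ n) ij∈))))))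

  -- Mixed terms in the case k = 2.

  module GraphTrace {c ℓ₁ ℓ₂} (F : OrderedField c ℓ₁ ℓ₂) {n : ℕ} (T : Spectral.Tensor F 2 n) where
    open OrderedField F using (commutativeRing; fromℕ#)
    open CommutativeRing commutativeRing hiding (zero)
    open OrderedFieldProperties F using (1/_!)
    open Trace F {2} T
    open ListSum semiring
    open Polynomials F (×-≡-dec (_≟ᶠ_ {n}) (_≟ᶠ_ {n})) using (Monomial)
    open import Relation.Binary.Reasoning.Setoid setoid

    private
      V = Fin n
      _≟ˣ_ = ×-≡-dec (_≟ᶠ_ {n}) (_≟ᶠ_ {n})

      when : ∀ {p} {P : Set p} → Dec P → Carrier → Carrier
      when d x = if does d then x else 0#

      when-yes : ∀ {p} {P : Set p} (d : Dec P) x → P → when d x ≈ x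
      when-yes d x p rewrite dec-true d p = refl

      when-no : ∀ {p} {P : Set p} (d : Dec P) x → ¬ P → when d x ≈ 0#
      when-no d x ¬p rewrite dec-false d ¬p = refl

    eval-tracePower-2 : ∀ φ → eval φ (Spectral.tracePower F {2} T 2) ≈
      ∑ (allFin n) (λ a → ∑ (allFin n) (λ b → φ ((a , b) ∷ (b , a) ∷ [])))
    eval-tracePower-2 φ = trans (eval-tracePower φ 2) (∑-cong (allFin n) (λ a →
      trans (eval-matrixPower-suc φ 1 a a) (∑-cong (allFin n) (λ b →
        trans (eval-matrixPower-suc (φ ∘ ((a , b) ∷_)) 0 b a) (trans
          (∑-allFin-single a _ (λ {l} l≢a → eval-matrixPower-vanish _ 0 l a (λ { [] → contradiction ≡.refl l≢a })))
          (eval-matrixPower-0 (λ w → φ ((a , b) ∷ (b , a) ∷ w)) a))))))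
      where
      eval-matrixPower-0 : ∀ φ a → eval φ (Spectral.matrixPower F {2} T 0 a a) ≈ φ []
      eval-matrixPower-0 φ a rewrite dec-true (a ≟ᶠ a) ≡.refl = trans (+-identityʳ _) (*-identityˡ _)

    row*-graph : ∀ i φ w → row* i φ w ≈ ∑ (allFin n) (λ l → T i (l ∷ []) * ∂* (i , l) φ w)
    row*-graph i φ w = trans (∑-vectors-suc (allFin n) 0 (λ γ → T i γ * ∂ⱽ* i γ φ w))
      (∑-cong (allFin n) (λ l → +-identityʳ _))

    ∂*-arc : ∀ x φ y → ∂* x φ (y ∷ []) ≈ when (x ≟ˣ y) (φ [])
    ∂*-arc x φ y with does (x ≟ˣ y)
    ... | true  = +-identityʳ _
    ... | false = refl

    ∂*-two-arcs : ∀ x φ y z → ∂* x φ (y ∷ z ∷ []) ≈ when (x ≟ˣ y) (φ (z ∷ [])) + when (x ≟ˣ z) (φ (y ∷ []))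
    ∂*-two-arcs x φ y z with does (x ≟ˣ y) | does (x ≟ˣ z)
    ... | true  | true  = +-congˡ (+-identityʳ _)
    ... | true  | false = refl
    ... | false | true  = trans (+-identityʳ _) (sym (+-identityˡ _))
    ... | false | false = sym (+-identityˡ _)

    ∑-when : ∀ i l (f : V → V → Carrier) →
      ∑ (allFin n) (λ a → ∑ (allFin n) (λ b → when ((i , l) ≟ˣ (a , b)) (f a b))) ≈ f i l
    ∑-when i l f = trans
      (∑-allFin-single i _ (λ {a} a≢i → ∑-zero (allFin n) (λ {b} _ → when-no ((i , l) ≟ˣ (a , b)) _ (a≢i ∘ ≡.sym ∘ ,-injectiveˡ))))
      (trans (∑-allFin-single l _ (λ {b} b≢l → when-no ((i , l) ≟ˣ (i , b)) _ (b≢l ∘ ≡.sym ∘ ,-injectiveʳ)))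
        (when-yes ((i , l) ≟ˣ (i , l)) _ ≡.refl))

    -- The derivative of tr(A²) in aᵢₗ is 2aₗᵢ: the variable occurs once as the first and once as
    -- the second arc of a closed walk of length two.
    eval-row*-graph : ∀ i φ → eval (row* i φ) (Spectral.tracePower F {2} T 2) ≈
      ∑ (allFin n) (λ l → T i (l ∷ []) * (φ ((l , i) ∷ []) + φ ((l , i) ∷ [])))
    eval-row*-graph i φ = begin
      eval (row* i φ) p
        ≈⟨ eval-cong p (row*-graph i φ) ⟩
      eval (λ w → ∑ (allFin n) (λ l → T i (l ∷ []) * ∂* (i , l) φ w)) p
        ≈⟨ eval-∑ (allFin n) (λ l w → T i (l ∷ []) * ∂* (i , l) φ w) p ⟩
      ∑ (allFin n) (λ l → eval (λ w → T i (l ∷ []) * ∂* (i , l) φ w) p)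
        ≈⟨ ∑-cong (allFin n) (λ l → trans (eval-*ˡ (T i (l ∷ [])) (∂* (i , l) φ) p) (*-congˡ (pairing l))) ⟩
      ∑ (allFin n) (λ l → T i (l ∷ []) * (φ ((l , i) ∷ []) + φ ((l , i) ∷ []))) ∎
      where
      p = Spectral.tracePower F {2} T 2
      pairing : ∀ l → eval (∂* (i , l) φ) p ≈ φ ((l , i) ∷ []) + φ ((l , i) ∷ [])
      pairing l = begin
        eval (∂* (i , l) φ) p
          ≈⟨ eval-tracePower-2 (∂* (i , l) φ) ⟩
        ∑ (allFin n) (λ a → ∑ (allFin n) (λ b → ∂* (i , l) φ ((a , b) ∷ (b , a) ∷ [])))
          ≈⟨ ∑-cong (allFin n) (λ a → trans (∑-cong (allFin n) (λ b → ∂*-two-arcs (i , l) φ (a , b) (b , a)))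
               (∑-distrib-+ (allFin n) (λ b → when ((i , l) ≟ˣ (a , b)) (φ ((b , a) ∷ [])))
                 (λ b → when ((i , l) ≟ˣ (b , a)) (φ ((a , b) ∷ []))))) ⟩
        ∑ (allFin n) (λ a → ∑ (allFin n) (λ b → when ((i , l) ≟ˣ (a , b)) (φ ((b , a) ∷ [])))
          + ∑ (allFin n) (λ b → when ((i , l) ≟ˣ (b , a)) (φ ((a , b) ∷ []))))
          ≈⟨ ∑-distrib-+ (allFin n) (λ a → ∑ (allFin n) (λ b → when ((i , l) ≟ˣ (a , b)) (φ ((b , a) ∷ []))))
               (λ a → ∑ (allFin n) (λ b → when ((i , l) ≟ˣ (b , a)) (φ ((a , b) ∷ [])))) ⟩
        ∑ (allFin n) (λ a → ∑ (allFin n) (λ b → when ((i , l) ≟ˣ (a , b)) (φ ((b , a) ∷ []))))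
          + ∑ (allFin n) (λ a → ∑ (allFin n) (λ b → when ((i , l) ≟ˣ (b , a)) (φ ((a , b) ∷ []))))
          ≈⟨ +-cong (∑-when i l (λ a b → φ ((b , a) ∷ [])))
               (trans (∑-comm (allFin n) (allFin n) (λ a b → when ((i , l) ≟ˣ (b , a)) (φ ((a , b) ∷ []))))
                 (∑-when i l (λ b a → φ ((a , b) ∷ [])))) ⟩
        φ ((l , i) ∷ []) + φ ((l , i) ∷ []) ∎

    row*-δ : ∀ j l i → row* j δ ((l , i) ∷ []) ≈ when (j ≟ᶠ l) (T j (i ∷ []))
    row*-δ j l i = trans (row*-graph j δ _) (trans
      (∑-allFin-single i _ (λ {m} m≢i → trans (*-congˡ (trans (∂*-arc (j , m) δ (l , i))
        (when-no ((j , m) ≟ˣ (l , i)) _ (m≢i ∘ ,-injectiveʳ)))) (zeroʳ _)))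
      (trans (*-congˡ (∂*-arc (j , i) δ (l , i))) (last (j ≟ᶠ l))))
      where
      last : (d : Dec (j ≡ l)) → T j (i ∷ []) * when ((j , i) ≟ˣ (l , i)) 1# ≈ when d (T j (i ∷ []))
      last (yes ≡.refl) = trans (*-congˡ (when-yes ((j , i) ≟ˣ (j , i)) 1# ≡.refl)) (*-identityʳ _)
      last (no j≢l)     = trans (*-congˡ (when-no ((j , i) ≟ˣ (l , i)) 1# (j≢l ∘ ,-injectiveˡ))) (zeroʳ _)

    -- Up to the factors 1/1!, which are carried along, this is 2t²: the first row operator turns
    -- tr(A²) into arcs back to `i`, and the other row keeps only the arc from `j`.
    mixed-term-graph : ∀ {i j} → i ≢ j → ∀ {t} → T i (j ∷ []) ≈ t → T j (i ∷ []) ≈ t →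
      eval (composition* (points (i , j)) (allFin n) δ) (Spectral.tracePower F {2} T 2) ≈
        1/ 1 ! * (t * (1/ 1 ! * t + 1/ 1 ! * t))
    mixed-term-graph i≢j Tij Tji = mixed-term i≢j (Spectral.tracePower F {2} T 2) (half Tji Tij) (half Tij Tji)
      where
      half : ∀ {i j t} → T i (j ∷ []) ≈ t → T j (i ∷ []) ≈ t →
        eval (λ w → 1/ 1 ! * row* i (λ w → 1/ 1 ! * row* j δ w) w) (Spectral.tracePower F {2} T 2) ≈
        1/ 1 ! * (t * (1/ 1 ! * t + 1/ 1 ! * t))
      half {i} {j} {t} Tij Tji = trans (eval-*ˡ (1/ 1 !) (row* i φ) (Spectral.tracePower F {2} T 2)) (*-congˡ (trans (eval-row*-graph i φ)
        (trans (∑-allFin-single j _ (λ {l} l≢j → trans (*-congˡ (trans (+-cong (off l≢j) (off l≢j)) (+-identityˡ 0#))) (zeroʳ _)))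
          (*-cong Tij (+-cong on on)))))
        where
        φ : Functional
        φ w = 1/ 1 ! * row* j δ w
        off : ∀ {l} → l ≢ j → φ ((l , i) ∷ []) ≈ 0#
        off {l} l≢j = trans (*-congˡ (trans (row*-δ j l i) (when-no (j ≟ᶠ l) _ (l≢j ∘ ≡.sym)))) (zeroʳ _)
        on : φ ((j , i) ∷ []) ≈ 1/ 1 ! * t
        on = *-congˡ (trans (row*-δ j j i) (trans (when-yes (j ≟ᶠ j) _ ≡.refl) Tji))

  -- Index sets of tensor entries, and codegrees.

  ∈-⋃⁻ : ∀ {n} (xs : List (Fin n)) {v} → v ∈ˢ ⋃ (map ⁅_⁆ xs) → v ∈ xs
  ∈-⋃⁻ []       v∈ = contradiction v∈ ∉⊥
  ∈-⋃⁻ (x ∷ xs) v∈ with x∈p∪q⁻ ⁅ x ⁆ (⋃ (map ⁅_⁆ xs)) v∈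
  ... | inj₁ v∈x  = here (x∈⁅y⁆⇒x≡y x v∈x)
  ... | inj₂ v∈xs = there (∈-⋃⁻ xs v∈xs)

  ∈-⋃⁺ : ∀ {n} {xs : List (Fin n)} {v} → v ∈ xs → v ∈ˢ ⋃ (map ⁅_⁆ xs)
  ∈-⋃⁺ (here ≡.refl) = x∈p∪q⁺ (inj₁ (x∈⁅x⁆ _))
  ∈-⋃⁺ (there v∈)    = x∈p∪q⁺ (inj₂ (∈-⋃⁺ v∈))

  ∣∣≤2 : ∀ {n} (S : Subset n) i j → (∀ {v} → v ∈ˢ S → v ≡ i ⊎ v ≡ j) → ∣ S ∣ ℕ.≤ 2
  ∣∣≤2 S i j S⊆ = begin
    ∣ S ∣                                       ≡⟨ ∣∣-sum S ⟩
    sum (λ v → 𝟙 (v ∈? S))                      ≤⟨ sum-mono-≤ bound ⟩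
    sum (λ v → 𝟙 (i ≟ᶠ v) ℕ.+ 𝟙 (j ≟ᶠ v))       ≡⟨ Σℕ.∑-distrib-+ (λ v → 𝟙 (i ≟ᶠ v)) (λ v → 𝟙 (j ≟ᶠ v)) ⟩
    sum (λ v → 𝟙 (i ≟ᶠ v)) ℕ.+ sum (λ v → 𝟙 (j ≟ᶠ v)) ≡⟨ ≡.cong₂ ℕ._+_ (sum-𝟙≟ i) (sum-𝟙≟ j) ⟩
    2 ∎
    where
    open ℕ.≤-Reasoning
    bound : ∀ v → 𝟙 (v ∈? S) ℕ.≤ 𝟙 (i ≟ᶠ v) ℕ.+ 𝟙 (j ≟ᶠ v)
    bound v with v ∈? S
    ... | no _ = ℕ.z≤n
    ... | yes v∈ with S⊆ v∈
    ...   | inj₁ v≡i = ℕ.≤-trans (ℕ.≤-reflexive (≡.sym (𝟙-yes (i ≟ᶠ v) (≡.sym v≡i)))) (ℕ.m≤m+n _ _)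
    ...   | inj₂ v≡j = ℕ.≤-trans (ℕ.≤-reflexive (≡.sym (𝟙-yes (j ≟ᶠ v) (≡.sym v≡j)))) (ℕ.m≤n+m _ _)

  ∣∣≤1 : ∀ {n} (S : Subset n) i → (∀ {v} → v ∈ˢ S → v ≡ i) → ∣ S ∣ ℕ.≤ 1
  ∣∣≤1 S i S⊆ = ≡.subst (ℕ._≤ 1) (≡.sym (∣∣-sum S)) (≡.subst (sum (λ v → 𝟙 (v ∈? S)) ℕ.≤_) (sum-𝟙≟ i) (sum-mono-≤ bound))
    where
    bound : ∀ v → 𝟙 (v ∈? S) ℕ.≤ 𝟙 (i ≟ᶠ v)
    bound v with v ∈? S
    ... | no _ = ℕ.z≤n
    ... | yes v∈ = ℕ.≤-reflexive (≡.sym (𝟙-yes (i ≟ᶠ v) (≡.sym (S⊆ v∈))))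

  2≤∣∣ : ∀ {n} {S : Subset n} {i j} → i ≢ j → i ∈ˢ S → j ∈ˢ S → 2 ℕ.≤ ∣ S ∣
  2≤∣∣ {S = S} {i} {j} i≢j i∈ j∈ = ≡.subst₂ ℕ._≤_
    (≡.cong₂ ℕ._+_ (𝟙-yes (i ∈? S) i∈) (𝟙-yes (j ∈? S) j∈)) (≡.sym (∣∣-sum S))
    (terms≤sum (λ v → 𝟙 (v ∈? S)) i≢j)

  private
    pair-set : ∀ {n} → Fin n → Fin n → Subset n
    pair-set i j = ⋃ (map ⁅_⁆ (i ∷ j ∷ []))

  ∈-pairˡ : ∀ {n} (i j : Fin n) → i ∈ˢ pair-set i j
  ∈-pairˡ i j = ∈-⋃⁺ {xs = i ∷ j ∷ []} (here ≡.refl)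

  ∈-pairʳ : ∀ {n} (i j : Fin n) → j ∈ˢ pair-set i j
  ∈-pairʳ i j = ∈-⋃⁺ {xs = i ∷ j ∷ []} (there (here ≡.refl))

  pair-set-≡ : ∀ {n} {S : Subset n} {i j} → i ≢ j → i ∈ˢ S → j ∈ˢ S → ∣ S ∣ ≡ 2 → S ≡ pair-set i j
  pair-set-≡ {S = S} {i} {j} i≢j i∈ j∈ ∣S∣ = ⊆-antisym S⊆ pair⊆
    where
    pair⊆ : pair-set i j ⊆ˢ S
    pair⊆ v∈ with ∈-⋃⁻ (i ∷ j ∷ []) v∈
    ... | here ≡.refl         = i∈
    ... | there (here ≡.refl) = j∈
    S⊆ : S ⊆ˢ pair-set i j
    S⊆ {v} v∈ with v ∈? pair-set i j
    ... | yes v∈p = v∈p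
    ... | no v∉p  = contradiction (p⊂q⇒∣p∣<∣q∣ {p = pair-set i j} {S} (pair⊆ , v , v∈ , v∉p))
      (ℕ.≤⇒≯ (≡.subst (ℕ._≤ ∣ pair-set i j ∣) (≡.sym ∣S∣) (2≤∣∣ i≢j (∈-pairˡ i j) (∈-pairʳ i j))))

  -- A numerical form of adjacency: on distinct vertices of a graph it is 0 or 1, on the diagonal it
  -- is the degree, and its sums follow from exchanging summations.
  codegree : (H : Hypergraph) → Fin (order H) → Fin (order H) → ℕ
  codegree H i j = sum (λ e → 𝟙 (i ∈? edge H e) ℕ.* 𝟙 (j ∈? edge H e))

  𝟙-*-no : ∀ {p q} {P : Set p} {Q : Set q} (d : Dec P) (e : Dec Q) → (P → ¬ Q) → 𝟙 d ℕ.* 𝟙 e ≡ 0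
  𝟙-*-no (yes p) e     ¬pq = ≡.trans (ℕ.+-identityʳ _) (𝟙-no e (¬pq p))
  𝟙-*-no (no _)  e     ¬pq = ≡.refl

  codegree-edge : ∀ H → Uniform 2 H → ∀ {i j} → i ≢ j →
    (codegree H i j ≡ 1 × IsEdge H (pair-set i j)) ⊎ (codegree H i j ≡ 0 × ¬ IsEdge H (pair-set i j))
  codegree-edge H u {i} {j} i≢j with isEdge? H (pair-set i j)
  ... | yes (e , e≡) = inj₁ (≡.trans (sum-single _ e others) (≡.cong₂ ℕ._*_ (𝟙-yes (i ∈? edge H e) i∈) (𝟙-yes (j ∈? edge H e) j∈)) , e , e≡)
    where
    i∈ = ≡.subst (i ∈ˢ_) (≡.sym e≡) (∈-pairˡ i j)
    j∈ = ≡.subst (j ∈ˢ_) (≡.sym e≡) (∈-pairʳ i j)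
    others : ∀ f → f ≢ e → 𝟙 (i ∈? edge H f) ℕ.* 𝟙 (j ∈? edge H f) ≡ 0
    others f f≢e = 𝟙-*-no (i ∈? edge H f) (j ∈? edge H f)
      (λ i∈f j∈f → f≢e (distinct H (≡.trans (pair-set-≡ i≢j i∈f j∈f (u f)) (≡.sym e≡))))
  ... | no ¬edge = inj₂ (sum-zero _ (λ f → 𝟙-*-no (i ∈? edge H f) (j ∈? edge H f)
      (λ i∈f j∈f → ¬edge (f , pair-set-≡ i≢j i∈f j∈f (u f)))) , ¬edge)

  module ℕSum = ListSum ℕ.+-*-semiring

  ∑-allFin≡sum : ∀ n (f : Fin n → ℕ) → ℕSum.∑ (allFin n) f ≡ sum f
  ∑-allFin≡sum zero    f = ≡.refl
  ∑-allFin≡sum (suc n) f = ≡.trans (ℕSum.∑-allFin-suc n f) (≡.cong (f zero ℕ.+_) (∑-allFin≡sum n (f ∘ suc)))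

  -- Off the diagonal every entry of a symmetric matrix is met twice; stated with additions only to
  -- stay within ℕ.
  ∑-pairs-symmetric : ∀ n (f : Fin n → Fin n → ℕ) → (∀ i j → f i j ≡ f j i) →
    2 ℕ.* ℕSum.∑ (pairs n) (λ (i , j) → f i j) ℕ.+ sum (λ i → f i i) ≡ sum (λ i → sum (f i))
  ∑-pairs-symmetric zero    f symm = ≡.refl
  ∑-pairs-symmetric (suc n) f symm = begin
    2 ℕ.* ℕSum.∑ (pairs (suc n)) (λ (i , j) → f i j) ℕ.+ (f zero zero ℕ.+ D)
      ≡⟨ ≡.cong (λ x → 2 ℕ.* x ℕ.+ (f zero zero ℕ.+ D))
           (≡.trans (ℕSum.∑-pairs-suc n (λ (i , j) → f i j)) (≡.cong (ℕ._+ P) (∑-allFin≡sum n (f zero ∘ suc)))) ⟩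
    2 ℕ.* (R ℕ.+ P) ℕ.+ (f zero zero ℕ.+ D)
      ≡⟨ rearrange R P (f zero zero) D ⟩
    (f zero zero ℕ.+ R) ℕ.+ (R ℕ.+ (2 ℕ.* P ℕ.+ D))
      ≡⟨ ≡.cong ((f zero zero ℕ.+ R) ℕ.+_) (≡.cong₂ ℕ._+_
           (sum-cong-≗ (λ j → symm zero (suc j))) (∑-pairs-symmetric n (λ i j → f (suc i) (suc j)) (λ i j → symm (suc i) (suc j)))) ⟩
    (f zero zero ℕ.+ R) ℕ.+ (sum (λ i → f (suc i) zero) ℕ.+ sum (λ i → sum (λ j → f (suc i) (suc j))))
      ≡⟨ ≡.cong ((f zero zero ℕ.+ R) ℕ.+_) (Σℕ.∑-distrib-+ (λ i → f (suc i) zero) (λ i → sum (λ j → f (suc i) (suc j)))) ⟨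
    sum (λ i → sum (f i)) ∎
    where
    open ≡.≡-Reasoning
    D = sum (λ i → f (suc i) (suc i))
    R = sum (λ j → f zero (suc j))
    P = ℕSum.∑ (pairs n) (λ (i , j) → f (suc i) (suc j))
    rearrange : ∀ R P z D → 2 ℕ.* (R ℕ.+ P) ℕ.+ (z ℕ.+ D) ≡ (z ℕ.+ R) ℕ.+ (R ℕ.+ (2 ℕ.* P ℕ.+ D))
    rearrange = solve-∀

  sum-𝟙∈ : ∀ {k} H → Uniform k H → ∀ e → sum (λ v → 𝟙 (v ∈? edge H e)) ≡ k
  sum-𝟙∈ H u e = ≡.trans (≡.sym (∣∣-sum (edge H e))) (u e)

  sum-codegree : ∀ {k} H → Uniform k H → sum (λ i → sum (codegree H i)) ≡ size H ℕ.* (k ℕ.* k)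
  sum-codegree {k} H u = begin
    sum (λ i → sum (λ j → sum (λ e → x i e ℕ.* x j e)))
      ≡⟨ sum-cong-≗ (λ i → Σℕ.∑-comm (λ j e → x i e ℕ.* x j e)) ⟩
    sum (λ i → sum (λ e → sum (λ j → x i e ℕ.* x j e)))
      ≡⟨ Σℕ.∑-comm (λ i e → sum (λ j → x i e ℕ.* x j e)) ⟩
    sum (λ e → sum (λ i → sum (λ j → x i e ℕ.* x j e)))
      ≡⟨ sum-cong-≗ (λ e → ≡.trans
           (sum-cong-≗ (λ i → ≡.trans (≡.sym (Σℕ.*-distribˡ-sum (x i e) (λ j → x j e))) (≡.cong (x i e ℕ.*_) (sum-𝟙∈ H u e))))
           (≡.trans (≡.sym (Σℕ.*-distribʳ-sum k (λ i → x i e))) (≡.cong (ℕ._* k) (sum-𝟙∈ H u e)))) ⟩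
    sum {size H} (λ _ → k ℕ.* k)
      ≡⟨ sum-const (size H) (k ℕ.* k) ⟩
    size H ℕ.* (k ℕ.* k) ∎
    where
    open ≡.≡-Reasoning
    x : Fin (order H) → Fin (size H) → ℕ
    x i e = 𝟙 (i ∈? edge H e)

  sum-codegree-diagonal : ∀ {k} H → Uniform k H → sum (λ i → codegree H i i) ≡ size H ℕ.* k
  sum-codegree-diagonal H u = ≡.trans
    (sum-cong-≗ (λ i → ≡.trans (sum-cong-≗ (λ e → 𝟙-idem (i ∈? edge H e))) (≡.sym (degree-sum H i))))
    (sum-degree H u)
    where
    𝟙-idem : ∀ {p} {P : Set p} (d : Dec P) → 𝟙 d ℕ.* 𝟙 d ≡ 𝟙 d
    𝟙-idem (yes _) = ≡.refl
    𝟙-idem (no _)  = ≡.refl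

  -- All ordered pairs give 4m, the diagonal gives 2m, and the remaining 2m count each unordered
  -- pair twice.
  ∑-pairs-codegree : ∀ H → Uniform 2 H → ℕSum.∑ (pairs (order H)) (λ (i , j) → codegree H i j) ≡ size H
  ∑-pairs-codegree H u = ℕ.*-cancelˡ-≡ _ _ 2 (ℕ.+-cancelʳ-≡ (size H ℕ.* 2) _ _ (≡.trans
    (≡.cong (2 ℕ.* ℕSum.∑ (pairs (order H)) (λ (i , j) → codegree H i j) ℕ.+_) (≡.sym (sum-codegree-diagonal H u)))
    (≡.trans (∑-pairs-symmetric (order H) (codegree H) (λ i j → sum-cong-≗ (λ e → ℕ.*-comm (𝟙 (i ∈? edge H e)) _)))
      (≡.trans (sum-codegree H u) (double (size H))))))
    where
    double : ∀ m → m ℕ.* (2 ℕ.* 2) ≡ 2 ℕ.* m ℕ.+ m ℕ.* 2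
    double = solve-∀

  -- Diagonal and off-diagonal entries of the tensor.

  module TensorEntries {c ℓ₁ ℓ₂} (F : OrderedField c ℓ₁ ℓ₂) where
    open OrderedField F using (commutativeRing; fromℕ#)
    open CommutativeRing commutativeRing hiding (zero)
    open OrderedFieldProperties F using (1/_!)
    open Spectral F using (A⟨_⟩; degreeTensor; adjacencyTensor)
    open FieldLemmas F

    ≡replicate : ∀ {n s} {i : Fin n} {γ : Vec (Fin n) s} → VecAll.All (i ≡_) γ → γ ≡ replicate s i
    ≡replicate VecAll.[]              = ≡.refl
    ≡replicate (≡.refl VecAll.∷ all) = ≡.cong (_ ∷_) (≡replicate all)

    all-replicate : ∀ {n} s (i : Fin n) → VecAll.All (i ≡_) (replicate s i)
    all-replicate zero    i = VecAll.[]
    all-replicate (suc s) i = ≡.refl VecAll.∷ all-replicate s i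

    module _ (α : Carrier) (k : ℕ) (H : Hypergraph) where
      degreeTensor-diagonal : ∀ i → degreeTensor k H i (replicate (k ∸ 1) i) ≈ fromℕ# (degree H i)
      degreeTensor-diagonal i
        rewrite dec-true (VecAll.all? (i ≟ᶠ_) (replicate (k ∸ 1) i)) (all-replicate (k ∸ 1) i) = refl

      degreeTensor-off : ∀ i γ → γ ≢ replicate (k ∸ 1) i → degreeTensor k H i γ ≈ 0#
      degreeTensor-off i γ γ≢ rewrite dec-false (VecAll.all? (i ≟ᶠ_) γ) (γ≢ ∘ ≡replicate) = refl

      adjacencyTensor-off : ∀ i γ → ¬ IsEdge H (⋃ (map ⁅_⁆ (i ∷ Vec.toList γ))) → adjacencyTensor k H i γ ≈ 0#
      adjacencyTensor-off i γ ¬edge rewrite dec-false (isEdge? H (⋃ (map ⁅_⁆ (i ∷ Vec.toList γ)))) ¬edge = refl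

      adjacencyTensor-on : ∀ i γ → IsEdge H (⋃ (map ⁅_⁆ (i ∷ Vec.toList γ))) → adjacencyTensor k H i γ ≈ 1/ (k ∸ 1) !
      adjacencyTensor-on i γ isEdge rewrite dec-true (isEdge? H (⋃ (map ⁅_⁆ (i ∷ Vec.toList γ)))) isEdge = refl

      entry : ∀ i γ {a b} → degreeTensor k H i γ ≈ a → adjacencyTensor k H i γ ≈ b →
        A⟨ α ⟩ k H i γ ≈ α * a + (1# - α) * b
      entry i γ eq eq′ = +-cong (*-congˡ eq) (*-congˡ eq′)

      small-not-edge : ∀ {S b} → Uniform k H → ∣ S ∣ ℕ.≤ b → b ℕ.< k → ¬ IsEdge H S
      small-not-edge u ∣S∣≤b b<k (e , ≡.refl) = ℕ.<-irrefl (u e) (ℕ.≤-<-trans ∣S∣≤b b<k)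

      diagonal-entry : Uniform k H → 2 ℕ.≤ k → ∀ i → A⟨ α ⟩ k H i (replicate (k ∸ 1) i) ≈ α * fromℕ# (degree H i)
      diagonal-entry u 2≤k i = trans (entry i (replicate (k ∸ 1) i) (degreeTensor-diagonal i) (adjacencyTensor-off i (replicate (k ∸ 1) i)
        (small-not-edge u (∣∣≤1 _ i (λ v∈ → all-i (∈-⋃⁻ (i ∷ Vec.toList (replicate (k ∸ 1) i)) v∈))) 2≤k)))
        (trans (+-congˡ (zeroʳ _)) (+-identityʳ _))
        where
        all-i′ : ∀ s {v} → v ∈ Vec.toList (replicate s i) → v ≡ i
        all-i′ (suc s) (here v≡i) = v≡i
        all-i′ (suc s) (there v∈) = all-i′ s v∈
        all-i : ∀ {v} → v ∈ i ∷ Vec.toList (replicate (k ∸ 1) i) → v ≡ i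
        all-i (here v≡i) = v≡i
        all-i (there v∈) = all-i′ (k ∸ 1) v∈

      -- The index set of such an entry is contained in {i, j}, too small for an edge, and the
      -- degree tensor is zero off the diagonal.
      thin-entry : Uniform k H → 3 ℕ.≤ k → Trace.Thin F {k} (A⟨ α ⟩ k H)
      thin-entry u 3≤k i j γ γ⊆ γ≢ = trans (entry i γ (degreeTensor-off i γ γ≢) (adjacencyTensor-off i γ
        (small-not-edge u (∣∣≤2 _ i j (λ v∈ → in-pair (∈-⋃⁻ (i ∷ Vec.toList γ) v∈))) 3≤k)))
        (trans (+-cong (zeroʳ _) (zeroʳ _)) (+-identityˡ 0#))
        where
        in-pair : ∀ {v} → v ∈ i ∷ Vec.toList γ → v ≡ i ⊎ v ≡ j
        in-pair (here v≡i) = inj₁ v≡i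
        in-pair (there v∈) = γ⊆ v∈

    weight : Carrier → Carrier
    weight α = (1# - α) * 1/ 1 !

    module _ (α : Carrier) (H : Hypergraph) (u : Uniform 2 H) where
      graph-entry : ∀ {i j} → i ≢ j → A⟨ α ⟩ 2 H i (j ∷ []) ≈ weight α * fromℕ# (codegree H i j)
      graph-entry {i} {j} i≢j with codegree-edge H u i≢j
      ... | inj₁ (eq , isEdge) = trans
        (entry α 2 H i (j ∷ []) (degreeTensor-off α 2 H i (j ∷ []) j≢i) (adjacencyTensor-on α 2 H i (j ∷ []) isEdge))
        (trans (trans (+-congʳ (zeroʳ α)) (+-identityˡ _))
          (sym (trans (*-congˡ (trans (reflexive (≡.cong fromℕ# eq)) (+-identityʳ 1#))) (*-identityʳ _))))
        where
        j≢i : j ∷ [] ≢ i ∷ []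
        j≢i ≡.refl = i≢j ≡.refl
      ... | inj₂ (eq , ¬edge) = trans
        (entry α 2 H i (j ∷ []) (degreeTensor-off α 2 H i (j ∷ []) j≢i) (adjacencyTensor-off α 2 H i (j ∷ []) ¬edge))
        (trans (trans (+-cong (zeroʳ α) (zeroʳ _)) (+-identityˡ 0#))
          (sym (trans (*-congˡ (reflexive (≡.cong fromℕ# eq))) (zeroʳ _))))
        where
        j≢i : j ∷ [] ≢ i ∷ []
        j≢i ≡.refl = i≢j ≡.refl

  -- The first two traces of hypergraphs and their comparison.

  module AlphaTrace {c ℓ₁ ℓ₂} (F : OrderedField c ℓ₁ ℓ₂) (α : OrderedField.Carrier F) where
    open OrderedField F using (commutativeRing; fromℕ#; _<_; module <-Order; +-monoˡ-<; *-pos)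
    open CommutativeRing commutativeRing hiding (zero)
    open OrderedFieldProperties F using (1/_!; fromℕ#-suc-pos; fromℕ#-pos)
    open Spectral F using (A⟨_⟩; Tr[_,_]; S-Order)
    open FieldLemmas F
    open TensorEntries F
    open ListSum semiring
    open import Algebra.Properties.Ring ring using (-‿distribʳ-*)
    open import Relation.Binary.Reasoning.Setoid setoid

    ∑-fromℕ# : ∀ {A : Set} (xs : List A) (f : A → ℕ) → ∑ xs (λ x → fromℕ# (f x)) ≈ fromℕ# (ℕSum.∑ xs f)
    ∑-fromℕ# []       f = refl
    ∑-fromℕ# (x ∷ xs) f = trans (+-congˡ (∑-fromℕ# xs f)) (sym (fromℕ#-+ (f x) _))

    ∑-allFin-fromℕ# : ∀ n (a : Carrier) (f : Fin n → ℕ) → ∑ (allFin n) (λ i → a * fromℕ# (f i)) ≈ a * fromℕ# (sum f)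
    ∑-allFin-fromℕ# n a f = trans (sym (*-distribˡ-∑ a (allFin n) _))
      (*-congˡ (trans (∑-fromℕ# (allFin n) f) (reflexive (≡.cong fromℕ# (∑-allFin≡sum n f)))))

    -- The contribution of one edge of a graph: the value in `mixed-term-graph` for the entry
    -- `weight α`.
    κ : Carrier
    κ = 1/ 1 ! * (weight α * (1/ 1 ! * weight α + 1/ 1 ! * weight α))

    -- The contribution to Tr₂ of the pairs of distinct rows; it comes from the
    -- edges of a graph, and vanishes for k ≥ 3.
    mixed : ℕ → ℕ → Carrier
    mixed zero    m = κ * fromℕ# m
    mixed (suc _) m = 0#

    -- The prefactor of the trace formula for tensors of order 2 + k.
    multiplier : ℕ → ℕ → Carrier
    multiplier k n = fromℕ# (suc k ℕ.^ (n ∸ 1))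

    module _ {k} (H : Hypergraph) (u : Uniform (2 ℕ.+ k) H) where
      private
        n = order H
        d = degree H
        T = A⟨ α ⟩ (2 ℕ.+ k) H
        module T = Trace F {2 ℕ.+ k} T

        diagonal≈ : ∀ i → T.diagonal i ≈ α * fromℕ# (d i)
        diagonal≈ = diagonal-entry α (2 ℕ.+ k) H u (ℕ.s≤s (ℕ.s≤s ℕ.z≤n))

      Tr-1-value : Tr[ α , 2 ℕ.+ k ] H 1 ≈ multiplier k n * (α * fromℕ# (size H ℕ.* (2 ℕ.+ k)))
      Tr-1-value = trans (T.Tr-1 (ℕ.s≤s ℕ.z≤n)) (*-congˡ (trans (∑-cong (allFin n) diagonal≈)
        (trans (∑-allFin-fromℕ# n α d) (*-congˡ (reflexive (≡.cong fromℕ# (sum-degree H u)))))))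

      Tr-2-diagonal : ∑ (allFin n) (λ i → T.diagonal i * T.diagonal i) ≈ α * α * fromℕ# (squares H)
      Tr-2-diagonal = trans (∑-cong (allFin n) (λ i → trans (*-cong (diagonal≈ i) (diagonal≈ i))
        (trans (interchange α _ α _) (*-congˡ (sym (fromℕ#-* (d i) (d i)))))))
        (∑-allFin-fromℕ# n (α * α) (λ i → d i ℕ.* d i))
        where open import Algebra.Properties.CommutativeSemigroup *-commutativeSemigroup using (interchange)

    Tr-2-value : ∀ k (H : Hypergraph) (u : Uniform (2 ℕ.+ k) H) →
      Tr[ α , 2 ℕ.+ k ] H 2 ≈ multiplier k (order H) * (α * α * fromℕ# (squares H) + mixed k (size H))
    Tr-2-value (suc k) H u = trans
      (T.Tr-2 (ℕ.s≤s ℕ.z≤n) (λ _ → 0#) (λ i≢j → T.mixed-term-thin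
        (thin-entry α (3 ℕ.+ k) H u (ℕ.s≤s (ℕ.s≤s (ℕ.s≤s ℕ.z≤n)))) (ℕ.s≤s ℕ.z≤n) i≢j (2 ℕ.* (2 ℕ.+ k))))
      (*-congˡ (+-cong (Tr-2-diagonal H u) (∑-zero (pairs (order H)) (λ _ → refl))))
      where module T = Trace F {3 ℕ.+ k} (A⟨ α ⟩ (3 ℕ.+ k) H)
    Tr-2-value zero H u = trans
      (T.Tr-2 (ℕ.s≤s ℕ.z≤n) (λ (i , j) → κ * fromℕ# (codegree H i j)) mixed≈)
      (*-congˡ (+-cong (Tr-2-diagonal H u) (trans (sym (*-distribˡ-∑ κ (pairs (order H)) _))
        (*-congˡ (trans (∑-fromℕ# (pairs (order H)) (λ (i , j) → codegree H i j))
          (reflexive (≡.cong fromℕ# (∑-pairs-codegree H u))))))))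
      where
      module T = Trace F {2} (A⟨ α ⟩ 2 H)
      w = weight α

      flip-codegree : ∀ i j → codegree H i j ≡ codegree H j i
      flip-codegree i j = sum-cong-≗ (λ e → ℕ.*-comm (𝟙 (i ∈? edge H e)) _)

      -- The left side is quadratic in the codegree and the right side linear. They agree because
      -- the codegree of distinct vertices is 0 or 1.
      scaled : ∀ {i j} → i ≢ j → ∀ {t} → t ≈ w * fromℕ# (codegree H i j) →
        1/ 1 ! * (t * (1/ 1 ! * t + 1/ 1 ! * t)) ≈ κ * fromℕ# (codegree H i j)
      scaled {i} {j} i≢j {t} t≈ with codegree-edge H u i≢j
      ... | inj₁ (eq , _) = trans
        (*-congˡ (*-cong t≈w (+-cong (*-congˡ t≈w) (*-congˡ t≈w))))
        (sym (trans (*-congˡ (trans (reflexive (≡.cong fromℕ# eq)) (+-identityʳ 1#))) (*-identityʳ κ)))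
        where
        t≈w : t ≈ w
        t≈w = trans t≈ (trans (*-congˡ (trans (reflexive (≡.cong fromℕ# eq)) (+-identityʳ 1#))) (*-identityʳ w))
      ... | inj₂ (eq , _) = trans
        (*-congˡ (trans (*-congʳ (trans t≈ (trans (*-congˡ (reflexive (≡.cong fromℕ# eq))) (zeroʳ w)))) (zeroˡ _)))
        (trans (zeroʳ _) (sym (trans (*-congˡ (reflexive (≡.cong fromℕ# eq))) (zeroʳ κ))))

      mixed≈ : ∀ {i j} → i ≢ j → T.eval (T.composition* (points (i , j)) (allFin (order H)) T.δ)
        (Spectral.tracePower F {2} (A⟨ α ⟩ 2 H) 2) ≈ κ * fromℕ# (codegree H i j)
      mixed≈ {i} {j} i≢j = trans
        (GraphTrace.mixed-term-graph F (A⟨ α ⟩ 2 H) i≢j (graph-entry α H u i≢j)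
          (trans (graph-entry α H u (i≢j ∘ ≡.sym)) (*-congˡ (reflexive (≡.cong fromℕ# (flip-codegree j i))))))
        (scaled i≢j refl)

    *-monoˡ-< : ∀ {a x y} → 0# < a → x < y → a * x < a * y
    *-monoˡ-< {a} {x} {y} 0<a x<y = <-Order.<-respˡ-≈ (+-identityˡ (a * x))
      (<-Order.<-respʳ-≈ cancel (+-monoˡ-< (a * x) (*-pos 0<a 0<y-x)))
      where
      0<y-x : 0# < y - x
      0<y-x = <-Order.<-respˡ-≈ (-‿inverseʳ x) (+-monoˡ-< (- x) x<y)
      cancel : a * (y - x) + a * x ≈ a * y
      cancel = begin
        a * (y - x) + a * x  ≈⟨ distribˡ a (y - x) x ⟨
        a * (y - x + x)      ≈⟨ *-congˡ (trans (+-assoc y (- x) x) (trans (+-congˡ (-‿inverseˡ x)) (+-identityʳ y))) ⟩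
        a * y                ∎

    fromℕ#-mono-< : ∀ {m n} → m ℕ.< n → fromℕ# m < fromℕ# n
    fromℕ#-mono-< {m} m<n with ℕ.m≤n⇒∃[o]m+o≡n m<n
    ... | d , ≡.refl = <-Order.<-respˡ-≈ (+-identityˡ _) (<-Order.<-respʳ-≈
      (trans (+-comm _ _) (trans (sym (fromℕ#-+ m (suc d))) (reflexive (≡.cong fromℕ# (ℕ.+-suc m d)))))
      (+-monoˡ-< (fromℕ# m) (fromℕ#-suc-pos d)))

    -- Traces 0 and 1 see only the numbers of vertices and edges, so index 2 decides. There the
    -- squares carry the positive factor α² times the multiplier, and the mixed part is common to
    -- both sides.
    precedes : ∀ {k m} → 0# < α → ∀ {H G} → UniformHypertree (2 ℕ.+ k) (2 ℕ.+ m) H → UniformHypertree (2 ℕ.+ k) (2 ℕ.+ m) G →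
      squares H ℕ.< squares G → S-Order α (2 ℕ.+ k) H G
    precedes {k} {m} 0<α {H} {G} CH CG H<G = order≡ , 2 , ℕ.s≤s ℕ.z≤n , 2≤ , agree , less
      where
      uH = proj₁ CH
      uG = proj₁ CG
      size≡ : size H ≡ size G
      size≡ = ≡.trans (proj₂ (proj₂ CH)) (≡.sym (proj₂ (proj₂ CG)))

      order≡ : order H ≡ order G
      order≡ = ≡.trans (HypertreeProperties.order≡ H CH) (≡.sym (HypertreeProperties.order≡ G CG))

      -- Index 2 must lie below the number of eigenvalues. Two edges already force three vertices,
      -- and the power is at least one.
      2≤ : 2 ℕ.≤ order H ℕ.* suc k ℕ.^ (order H ∸ 1) ∸ 1
      2≤ = ℕ.∸-monoˡ-≤ 1 (ℕ.*-mono-≤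
        (≡.subst (3 ℕ.≤_) (≡.sym (HypertreeProperties.order≡ H CH))
          (ℕ.s≤s (ℕ.≤-trans (ℕ.m≤m+n 2 m) (ℕ.m≤m*n (2 ℕ.+ m) (suc k)))))
        (ℕ.m^n>0 (suc k) (order H ∸ 1)))

      agree : ∀ t → t ℕ.< 2 → Tr[ α , 2 ℕ.+ k ] H t ≈ Tr[ α , 2 ℕ.+ k ] G t
      agree zero _ = reflexive (≡.cong (λ n → fromℕ# (n ℕ.* suc k ℕ.^ (n ∸ 1))) order≡)
      agree (suc zero) _ = trans (Tr-1-value H uH) (trans
        (reflexive (≡.cong₂ (λ n s → multiplier k n * (α * fromℕ# (s ℕ.* (2 ℕ.+ k)))) order≡ size≡))
        (sym (Tr-1-value G uG)))
      agree (suc (suc t)) (ℕ.s≤s (ℕ.s≤s ()))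

      less : Tr[ α , 2 ℕ.+ k ] H 2 < Tr[ α , 2 ℕ.+ k ] G 2
      less = <-Order.<-respˡ-≈ (sym (trans (Tr-2-value k H uH)
          (reflexive (≡.cong₂ (λ n s → multiplier k n * (α * α * fromℕ# (squares H) + mixed k s)) order≡ size≡))))
        (<-Order.<-respʳ-≈ (sym (Tr-2-value k G uG))
          (*-monoˡ-< (fromℕ#-pos (suc k ℕ.^ (order G ∸ 1)) {{ℕ.m^n≢0 (suc k) (order G ∸ 1)}})
            (+-monoˡ-< (mixed k (size G)) (*-monoˡ-< (*-pos 0<α 0<α) (fromℕ#-mono-< H<G)))))

open import Data.List.Base using (_∷_; replicate)
open import Data.Nat.Base as ℕ using (ℕ; suc; _≤_; _∸_)
open import Data.Product.Base using (_,_; proj₁; proj₂)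
open import Relation.Binary.PropositionalEquality as ≡ using ()
open Hypertrees
open Traces

theorem6p6 : ∀ {c ℓ₁ ℓ₂} (R : Reals c ℓ₁ ℓ₂) (k m : ℕ) → 2 ≤ k → 3 ≤ m →
    (α : Reals.Carrier R) → Reals._<_ R (Reals.0# R) α → Reals._<_ R α (Reals.1# R) →
    IsSecondLast (Spectral.S-Order (Reals.orderedField R) α k) (UniformHypertree k m) (starlike k (1 ∷ 2 ∷ replicate (m ∸ 3) 1))
theorem6p6 R (suc (suc k)) (suc (suc (suc p))) (ℕ.s≤s (ℕ.s≤s ℕ.z≤n)) (ℕ.s≤s (ℕ.s≤s (ℕ.s≤s ℕ.z≤n))) α 0<α α<1 =
  -- Writing m as 3 + p makes `m ∸ 3` compute to `p`, so that the starlike hypertree of the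
  -- statement unfolds to the broom.
  forget (starʳ (2 ℕ.+ k) (3 ℕ.+ p)) ,
  (star-class , λ H CH H≇star → precedes 0<α CH star-class (squares-star H CH H≇star)) ,
  broom-class , broom≇star ,
  λ H CH H≇broom H≇star → precedes 0<α CH broom-class (squares-broom H CH H≇broom H≇star)
  where
  open AlphaTrace (Reals.orderedField R) α using (precedes)

  star-class : UniformHypertree (2 ℕ.+ k) (3 ℕ.+ p) (forget (starʳ (2 ℕ.+ k) (3 ℕ.+ p)))
  star-class = starlike-class k (replicate (3 ℕ.+ p) 1) (size-starʳ (2 ℕ.+ k) (3 ℕ.+ p))

  broom-class : UniformHypertree (2 ℕ.+ k) (3 ℕ.+ p) (forget (broomʳ (2 ℕ.+ k) p))
  broom-class = starlike-class k (1 ∷ 2 ∷ replicate p 1) (≡.cong (3 ℕ.+_) (size-starʳ (2 ℕ.+ k) p))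

  broom-root = broomʳ-broom (2 ℕ.+ k) p
  open Extremal k p star-class broom-class (starʳ-star (2 ℕ.+ k) (3 ℕ.+ p))
    (proj₁ (proj₂ broom-root)) (proj₂ (proj₂ broom-root))
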